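{- For all $\Delta\in\mathbb{N}$ and $\alpha>0$ there exists $n_0$ such that every digraph $G$ of order $n\ge n_0$ with $\delta^0(G)\ge \bigl(\tfrac12+\alpha\bigr)n$ contains every oriented tree $T$ of order $n$ with $\Delta(T)\le\Delta$.
   Context: A digraph has no loops and at most one edge in each direction between two vertices. $\delta^0(G)$ (minimum semidegree) is the minimum over all vertices $x$ of $\min\{\deg^+_G(x),\deg^-_G(x)\}$. An oriented tree is an orientation of a tree (each edge $\{u,v\}$ replaced by exactly one of $(u,v)$, $(v,u)$); $\Delta(T)$ is the maximum degree of the underlying undirected tree. "$G$ contains $T$" means $G$ has a subdigraph isomorphic to $T$ (here necessarily spanning). -}

module Defs where

open import Data.Nat using (ℕ; zero; suc; _∸_)
open import Data.Fin using (Fin)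
open import Data.Bool using (Bool; true; false; _∨_; _∧_)
open import Data.List using (List; length; filter; allFin)
open import Data.Product using (_×_; _,_; proj₁; proj₂; ∃; Σ)
open import Data.Sum using (_⊎_)
open import Relation.Binary.PropositionalEquality using (_≡_; _≢_)
open import Relation.Binary.Construct.Closure.ReflexiveTransitive using (Star)
open import Relation.Nullary using (¬_)
open import Relation.Nullary.Decidable using (_⊎-dec_)
open import Data.Fin.Properties using (_≟_)
open import Function using (Injective)
open import Data.Rational using (ℚ; _≤_; _+_; _*_; ½)
import Data.Rational as ℚ
import Data.Integer as ℤ

-- Digraphs on vertex set Fin n.
-- adj u v = true  means there is an edge (u , v).
-- No loops; at most one edge in each direction is automatic for a
-- Boolean adjacency relation (both (u,v) and (v,u) may be present).

record Digraph (n : ℕ) : Set where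
  field
    adj   : Fin n → Fin n → Bool
    loopless : ∀ v → adj v v ≡ false
open Digraph public

ℕtoℚ : ℕ → ℚ
ℕtoℚ k = ℤ.+ k ℚ./ 1

outdeg : ∀ {n} → Digraph n → Fin n → ℕ
outdeg {n} G x = length (filter (λ y → adj G x y Data.Bool.≟ true) (allFin n))

indeg : ∀ {n} → Digraph n → Fin n → ℕ
indeg {n} G x = length (filter (λ y → adj G y x Data.Bool.≟ true) (allFin n))

-- δ⁰(G) ≥ c  :  every vertex has out- and in-degree at least c
-- (equivalent to min over x of min{deg⁺,deg⁻} ≥ c, for n ≥ 1; for
-- n = 0 the minimum is vacuous).
MinSemidegreeAtLeast : ∀ {n} → Digraph n → ℚ → Set
MinSemidegreeAtLeast G c =
  ∀ x → (c ≤ ℕtoℚ (outdeg G x)) × (c ≤ ℕtoℚ (indeg G x))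

record OrientedTree (n : ℕ) : Set where
  field
    arc : Fin (n ∸ 1) → Fin n × Fin n
  Touches : Fin n → Fin n → Set
  Touches u v = ∃ λ i → (arc i ≡ (u , v)) ⊎ (arc i ≡ (v , u))
  field
    noLoop : ∀ i → proj₁ (arc i) ≢ proj₂ (arc i)
    noMulti : ∀ i j → (arc i ≡ arc j ⊎ arc i ≡ (proj₂ (arc j) , proj₁ (arc j))) → i ≡ j
    connected : ∀ u v → Star Touches u v
  -- simple, connected, n vertices, n - 1 edges: a tree.
open OrientedTree public

treeDeg : ∀ {n} → OrientedTree n → Fin n → ℕ
treeDeg {n} T v =
  length (filter (λ i → (proj₁ (arc T i) ≟ v) ⊎-dec (proj₂ (arc T i) ≟ v))
                 (allFin (n ∸ 1)))

MaxDegAtMost : ∀ {n} → OrientedTree n → ℕ → Set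
MaxDegAtMost T D = ∀ v → treeDeg T v Data.Nat.≤ D

Contains : ∀ {n} → Digraph n → OrientedTree n → Set
Contains {n} G T =
  Σ (Fin n → Fin n) λ f → Injective _≡_ _≡_ f ×
    (∀ i → adj G (f (proj₁ (arc T i))) (f (proj₂ (arc T i))) ≡ true)

{-# OPTIONS --safe #-}
module Submission where

-- Every step rearranges a bijection f from the vertices of T to those of G, and the proof needs
-- no regularity lemma. Write T top-down and remove a small set L of vertices, each with at most one child
-- outside L, such that T - L has components of bounded size; L comes from averaging over random
-- words: a vertex is kept in L as long as the ranks on its path avoid the word.
-- A few components A are reserved. In them, many disjoint stars N[t] are embedded greedily, choosing
-- the images by multiplicative weights so that, for all vertices a, a', w and all orientations, linearly
-- many stars have f(t) adjacent to a and a', and f(N(t)) adjacent to w in the right directions.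
-- The rest of A is placed greedily: only two placed neighbours matter at a time, and any two
-- vertices have many common neighbours.
-- Most other components are grouped by isomorphism type into groups of u. The unused part of G is split
-- into sets of size u in which every vertex has more than half of the set as out- and in-neighbours (repeated
-- halving of bounded discrepancy), and each class of corresponding tree vertices is mapped to one
-- such set along a perfect matching from the images of the parents.
-- What remains is added to L and treated top-down: if l sits at w, while its placed neighbours sit at a
-- and a', exchange the images of l and of the centre t of an unused star absorbing (a, a', w).

open import Defs
open import Data.Nat using (ℕ; zero; suc; _+_; _*_; _∸_; _^_; _≤_; _<_; _≥_; z≤n; s≤s; _≤?_; _<?_; NonZero; >-nonZero; _/_; _%_)
open import Data.Nat.Properties hiding (_≟_; suc-injective)
open import Data.Nat.DivMod using (m≡m%n+[m/n]*n; m%n<n; m/n*n≤m; [m+kn]%n≡m%n; m<n⇒m%n≡m)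
open import Data.Nat.Tactic.RingSolver using (solve-∀)
import Algebra.Properties.Semiring.Sum +-*-semiring as Lib
open import Data.Bool.Properties using (not-¬; ∧-comm; ∧-assoc; ∨-comm)
open import Data.List using (List; []; _∷_; _∷ʳ_; length; replicate; filter; allFin; tabulate)
open import Data.List.Properties using (length-++; length-replicate)
open import Data.Fin using (Fin; zero; suc; toℕ; fromℕ<; combine; remQuot; splitAt; _↑ˡ_; _↑ʳ_)
open import Data.Fin.Properties using (_≟_; any?; toℕ-injective; toℕ<n; toℕ-fromℕ<; suc-injective; splitAt-↑ˡ; splitAt-↑ʳ; ↑ˡ-injective; ↑ʳ-injective; combine-remQuot; remQuot-combine; inject≤-injective; finToFun-funToFin)
open import Data.Fin.Permutation using (Permutation′; _⟨$⟩ʳ_; _⟨$⟩ˡ_; _∘ₚ_; inverseˡ; inverseʳ; transpose)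
open import Data.Bool using (Bool; true; false; _∧_; _∨_; not; if_then_else_)
open import Data.Nat.Coprimality using (Coprime)
import Data.Integer as ℤ
import Data.Integer.Properties as ℤ
import Data.Rational as ℚ
import Data.Rational.Properties as ℚ
import Data.Rational.Unnormalised as ℚᵘ
import Data.Rational.Unnormalised.Properties as ℚᵘ
open import Data.Rational.Unnormalised using (mkℚᵘ)
open import Data.Product using (Σ; ∃; _×_; _,_; proj₁; proj₂)
open import Data.Sum using (_⊎_; inj₁; inj₂; [_,_]′)
open import Data.Empty using (⊥; ⊥-elim)
open import Function using (_∘_; id; case_of_)
open import Relation.Nullary using (¬_; Dec; yes; no; does)
open import Relation.Nullary.Decidable using (dec-true; dec-false; _×-dec_; _⊎-dec_)
open import Relation.Binary.Definitions using (tri<; tri≈; tri>)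
open import Relation.Binary.PropositionalEquality using (_≡_; _≢_; refl; sym; trans; cong; cong₂; subst; subst₂; module ≡-Reasoning)
open import Relation.Binary.Construct.Closure.ReflexiveTransitive using (Star; _◅_) renaming (ε to nil)

-- The threshold 1/2 enters twice. Two neighbourhoods of size n/2 + g share 2g vertices, which feeds
-- the greedy steps; and in a fair part of size u each row and column of the matching problem has at
-- least u/2 entries. The matching step can be iterated because a class is mapped onto a whole part:
-- its images are fair again, so the next layer can be matched to any other part. Absorption needs,
-- for each test, more stars than there are vertices to absorb. The stars available to a test make
-- up a fixed fraction of n depending on Δ and α, while |L| becomes an arbitrarily small fraction as
-- the depth d grows; so d is chosen after the number of stars, and the number of types and of parts
-- after d. An exchange is harmless because a star contains all neighbours of its centre: only edges
-- at l and at t change, and the test prescribes them all. Having at most one child outside L keeps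
-- the number of tests cubic in n, and all gains are exponential in a linear quantity. Every random
-- choice is replaced by integer averaging: conditional expectations for the word, a potential for
-- the halving, weights for the stars.

private variable
  n m k N : ℕ

-- Booleans and decidable tests

≡true⇒ : {A : Set} (d : Dec A) → does d ≡ true → A
≡true⇒ (yes a) _ = a

≡false⇒ : {A : Set} (d : Dec A) → does d ≡ false → ¬ A
≡false⇒ (no ¬a) _ = ¬a

∧-split : ∀ {a b} → a ∧ b ≡ true → (a ≡ true) × (b ≡ true)
∧-split {true} {true} _ = refl , refl

∧-join : ∀ {a b} → a ≡ true → b ≡ true → a ∧ b ≡ true
∧-join refl refl = refl

∨-split : ∀ {a b} → a ∨ b ≡ true → (a ≡ true) ⊎ (b ≡ true)
∨-split {true} _ = inj₁ refl
∨-split {false} e = inj₂ e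

∨-inl : ∀ {a b} → a ≡ true → a ∨ b ≡ true
∨-inl refl = refl

∨-inr : ∀ {a b} → b ≡ true → a ∨ b ≡ true
∨-inr {true} _ = refl
∨-inr {false} e = e

∨-false : ∀ {a b} → a ∨ b ≡ false → (a ≡ false) × (b ≡ false)
∨-false {false} {false} _ = refl , refl

not-true : ∀ {a} → not a ≡ true → a ≡ false
not-true {false} _ = refl

not-false : ∀ {a} → a ≡ false → not a ≡ true
not-false refl = refl

true≢false : ∀ {a} → a ≡ true → a ≡ false → ⊥
true≢false refl ()

¬true⇒false : ∀ {a} → ¬ (a ≡ true) → a ≡ false
¬true⇒false {true} h = ⊥-elim (h refl)
¬true⇒false {false} h = refl

bool-cases : ∀ a → (a ≡ true) ⊎ (a ≡ false)
bool-cases true = inj₁ refl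
bool-cases false = inj₂ refl

opaque
  _==_ : Fin n → Fin n → Bool
  i == j = does (i ≟ j)

  ==-refl : (i : Fin n) → (i == i) ≡ true
  ==-refl i = dec-true (i ≟ i) refl

  ==⇒≡ : {i j : Fin n} → (i == j) ≡ true → i ≡ j
  ==⇒≡ {i = i} {j} = ≡true⇒ (i ≟ j)

  ≢⇒==false : {i j : Fin n} → i ≢ j → (i == j) ≡ false
  ≢⇒==false {i = i} {j} = dec-false (i ≟ j)

  ∃ᵇ : (Fin n → Bool) → Bool
  ∃ᵇ P = does (any? λ i → P i Data.Bool.≟ true)

  ∃ᵇ-intro : (P : Fin n → Bool) (i : Fin n) → P i ≡ true → ∃ᵇ P ≡ true
  ∃ᵇ-intro P i e = dec-true (any? λ i → P i Data.Bool.≟ true) (i , e)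

  ∃ᵇ-elim : (P : Fin n → Bool) → ∃ᵇ P ≡ true → ∃ λ i → P i ≡ true
  ∃ᵇ-elim P = ≡true⇒ (any? λ i → P i Data.Bool.≟ true)

-- Finite sums and counting

-- Opaque, so that unification recovers the summand and the range from a sum.
opaque
  sum : (Fin n → ℕ) → ℕ
  sum = Lib.sum

  sum-zero : (f : Fin 0 → ℕ) → sum f ≡ 0
  sum-zero f = refl

  sum-suc : (f : Fin (suc n) → ℕ) → sum f ≡ f zero + sum (λ i → f (suc i))
  sum-suc f = refl

  sum-cong-≗ : {f g : Fin n → ℕ} → (∀ i → f i ≡ g i) → sum f ≡ sum g
  sum-cong-≗ {f = f} {g} h = Lib.sum-cong-≗ {_} {f} {g} h

  ∑-distrib-+ : (f g : Fin n → ℕ) → sum (λ i → f i + g i) ≡ sum f + sum g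
  ∑-distrib-+ f g = Lib.∑-distrib-+ f g

  ∑-comm : (f : Fin m → Fin n → ℕ) → sum (λ i → sum (f i)) ≡ sum (λ j → sum (λ i → f i j))
  ∑-comm f = Lib.∑-comm f

  sum-permute : (f : Fin n → ℕ) (π : Permutation′ n) → sum f ≡ sum (λ i → f (π ⟨$⟩ʳ i))
  sum-permute f π = Lib.sum-permute f π

  sum-*ˡ : ∀ c (f : Fin n → ℕ) → sum (λ i → c * f i) ≡ c * sum f
  sum-*ˡ c f = sym (Lib.*-distribˡ-sum c f)

𝟙 : Bool → ℕ
𝟙 true = 1
𝟙 false = 0

count : (Fin n → Bool) → ℕ
count P = sum (λ i → 𝟙 (P i))

𝟙≤1 : ∀ b → 𝟙 b ≤ 1
𝟙≤1 true = ≤-refl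
𝟙≤1 false = z≤n

𝟙-mono : ∀ {a b} → (a ≡ true → b ≡ true) → 𝟙 a ≤ 𝟙 b
𝟙-mono {true} h rewrite h refl = ≤-refl
𝟙-mono {false} h = z≤n

sum-mono : {f g : Fin n → ℕ} → (∀ i → f i ≤ g i) → sum f ≤ sum g
sum-mono {zero} h = ≤-reflexive (trans (sum-zero _) (sym (sum-zero _)))
sum-mono {suc n} h = subst₂ _≤_ (sym (sum-suc _)) (sym (sum-suc _)) (+-mono-≤ (h zero) (sum-mono (h ∘ suc)))

sum-const : ∀ n c → sum {n} (λ _ → c) ≡ n * c
sum-const zero c = sum-zero _
sum-const (suc n) c = trans (sum-suc _) (cong (c +_) (sum-const n c))

sum-*ʳ : ∀ c (f : Fin n → ℕ) → sum (λ i → f i * c) ≡ sum f * c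
sum-*ʳ c f = trans (sum-cong-≗ (λ i → *-comm (f i) c)) (trans (sum-*ˡ c f) (*-comm c (sum f)))

term≤sum : (f : Fin n → ℕ) (i : Fin n) → f i ≤ sum f
term≤sum f zero = subst (f zero ≤_) (sym (sum-suc f)) (m≤m+n _ _)
term≤sum f (suc i) = subst (f (suc i) ≤_) (sym (sum-suc f)) (≤-trans (term≤sum (f ∘ suc) i) (m≤n+m _ _))

sum>0⇒∃ : (f : Fin n → ℕ) → 0 < sum f → ∃ λ i → 0 < f i
sum>0⇒∃ {n} f p with any? (λ i → 0 <? f i)
... | yes q = q
... | no ¬q = ⊥-elim (<-irrefl refl (<-≤-trans p (≤-trans
  (sum-mono (λ i → ≮⇒≥ (λ r → ¬q (i , r)))) (≤-reflexive (trans (sum-const _ 0) (*-zeroʳ n))))))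

sum-≤⇒∃ : (f g : Fin (suc n) → ℕ) → sum f ≤ sum g → ∃ λ i → f i ≤ g i
sum-≤⇒∃ {n} f g h with any? (λ i → f i ≤? g i)
... | yes p = p
... | no ¬p = ⊥-elim (<-irrefl refl (≤-<-trans h (go n f g (λ i → ≰⇒> (λ q → ¬p (i , q))))))
  where
  go : ∀ n (f g : Fin (suc n) → ℕ) → (∀ i → g i < f i) → sum g < sum f
  go zero f g h = subst₂ _<_ (sym (sum-suc _)) (sym (sum-suc _))
    (+-mono-<-≤ (h zero) (≤-reflexive (trans (sum-zero _) (sym (sum-zero _)))))
  go (suc n) f g h = subst₂ _<_ (sym (sum-suc _)) (sym (sum-suc _))
    (+-mono-< (h zero) (go n (f ∘ suc) (g ∘ suc) (h ∘ suc)))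

average-max : (f : Fin (suc n) → ℕ) → ∃ λ i → sum f ≤ suc n * f i
average-max {n} f with sum-≤⇒∃ (λ _ → sum f) (λ i → suc n * f i)
  (≤-reflexive (trans (sum-const (suc n) (sum f)) (sym (sum-*ˡ (suc n) f))))
... | r = r

average-min : (f : Fin (suc n) → ℕ) → ∃ λ i → suc n * f i ≤ sum f
average-min {n} f with sum-≤⇒∃ (λ i → suc n * f i) (λ _ → sum f)
  (≤-reflexive (trans (sum-*ˡ (suc n) f) (sym (sum-const (suc n) (sum f)))))
... | r = r

count-mono : {P Q : Fin n → Bool} → (∀ i → P i ≡ true → Q i ≡ true) → count P ≤ count Q
count-mono h = sum-mono (λ i → 𝟙-mono (h i))

count≤n : (P : Fin n → Bool) → count P ≤ n
count≤n {n} P = ≤-trans (sum-mono (λ i → 𝟙≤1 (P i))) (≤-reflexive (trans (sum-const n 1) (*-identityʳ n)))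

count-false : (P : Fin n → Bool) → (∀ i → P i ≡ false) → count P ≡ 0
count-false {n} P h = trans (sum-cong-≗ (λ i → cong 𝟙 (h i))) (trans (sum-const n 0) (*-zeroʳ n))

count-pos : (P : Fin n → Bool) → 0 < count P → ∃ λ i → P i ≡ true
count-pos P h = let (i , q) = sum>0⇒∃ _ h in i , 𝟙>0 (P i) q
  where
  𝟙>0 : ∀ b → 0 < 𝟙 b → b ≡ true
  𝟙>0 true _ = refl

count≥1 : (P : Fin n → Bool) (i : Fin n) → P i ≡ true → 1 ≤ count P
count≥1 P i e = ≤-trans (≤-reflexive (sym (cong 𝟙 e))) (term≤sum (λ i → 𝟙 (P i)) i)

count-≤1 : (P : Fin n → Bool) → (∀ i j → P i ≡ true → P j ≡ true → i ≡ j) → count P ≤ 1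
count-≤1 {zero} P h = ≤-trans (≤-reflexive (sum-zero _)) z≤n
count-≤1 {suc n} P h = ≤-trans (≤-reflexive (sum-suc _)) (go (P zero) refl)
  where
  go : ∀ b → P zero ≡ b → 𝟙 (P zero) + count (P ∘ suc) ≤ 1
  go false e = ≤-trans (≤-reflexive (cong (λ b → 𝟙 b + count (P ∘ suc)) e))
    (count-≤1 (P ∘ suc) (λ i j p q → suc-injective (h (suc i) (suc j) p q)))
  go true e = ≤-reflexive (cong₂ _+_ (cong 𝟙 e) (count-false (P ∘ suc)
      (λ i → ¬true⇒false λ p → case h zero (suc i) e p of λ ())))

count-single : (i : Fin n) → count (λ j → i == j) ≡ 1
count-single i = ≤-antisym (count-≤1 _ (λ j k p q → trans (sym (==⇒≡ p)) (==⇒≡ q)))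
  (count≥1 _ i (==-refl i))

count-∧+n : (P Q : Fin n → Bool) → count P + count Q ≤ n + count (λ i → P i ∧ Q i)
count-∧+n {n} P Q = begin
  count P + count Q ≡⟨ sym (∑-distrib-+ (λ i → 𝟙 (P i)) (λ i → 𝟙 (Q i))) ⟩
  sum (λ i → 𝟙 (P i) + 𝟙 (Q i)) ≤⟨ sum-mono (λ i → p (P i) (Q i)) ⟩
  sum (λ i → 1 + 𝟙 (P i ∧ Q i)) ≡⟨ ∑-distrib-+ {n} (λ i → 1) (λ i → 𝟙 (P i ∧ Q i)) ⟩
  sum {n} (λ i → 1) + count (λ i → P i ∧ Q i) ≡⟨ cong (_+ count (λ i → P i ∧ Q i)) (trans (sum-const n 1) (*-identityʳ n)) ⟩
  n + count (λ i → P i ∧ Q i) ∎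
  where
  open ≤-Reasoning
  p : ∀ a b → 𝟙 a + 𝟙 b ≤ 1 + 𝟙 (a ∧ b)
  p true b = ≤-refl
  p false b = 𝟙≤1 b

count-∧not : (P Q : Fin n → Bool) → count P ≤ count (λ i → P i ∧ not (Q i)) + count Q
count-∧not P Q = ≤-trans (sum-mono (λ i → p (P i) (Q i)))
  (≤-reflexive (∑-distrib-+ (λ i → 𝟙 (P i ∧ not (Q i))) (λ i → 𝟙 (Q i))))
  where
  p : ∀ a b → 𝟙 a ≤ 𝟙 (a ∧ not b) + 𝟙 b
  p true true = ≤-refl
  p true false = ≤-refl
  p false b = z≤n

count-∨ : (P Q : Fin n → Bool) → count (λ i → P i ∨ Q i) ≤ count P + count Q
count-∨ P Q = ≤-trans (sum-mono (λ i → p (P i) (Q i)))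
  (≤-reflexive (∑-distrib-+ (λ i → 𝟙 (P i)) (λ i → 𝟙 (Q i))))
  where
  p : ∀ a b → 𝟙 (a ∨ b) ≤ 𝟙 a + 𝟙 b
  p true b = s≤s z≤n
  p false b = ≤-refl

count-not : (P : Fin n → Bool) → count P + count (not ∘ P) ≡ n
count-not {n} P = trans (sym (∑-distrib-+ (λ i → 𝟙 (P i)) (λ i → 𝟙 (not (P i)))))
  (trans (sum-cong-≗ (λ i → p (P i))) (trans (sum-const n 1) (*-identityʳ n)))
  where
  p : ∀ a → 𝟙 a + 𝟙 (not a) ≡ 1
  p true = refl
  p false = refl

sum-fibres : (h : Fin n → Fin m) (f : Fin n → ℕ) →
  sum f ≡ sum (λ c → sum (λ i → f i * 𝟙 (h i == c)))
sum-fibres h f = sym (trans (∑-comm (λ c i → f i * 𝟙 (h i == c)))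
  (sum-cong-≗ λ i → trans (sum-*ˡ (f i) (λ c → 𝟙 (h i == c)))
    (trans (cong (f i *_) (count-single (h i))) (*-identityʳ (f i)))))

𝟙-* : ∀ a b → 𝟙 a * 𝟙 b ≡ 𝟙 (a ∧ b)
𝟙-* true b = *-identityˡ (𝟙 b)
𝟙-* false b = refl

count-fibres : (h : Fin n → Fin m) (P : Fin n → Bool) →
  count P ≡ sum (λ c → count (λ i → P i ∧ (h i == c)))
count-fibres h P = trans (sum-fibres h (λ i → 𝟙 (P i)))
  (sum-cong-≗ λ c → sum-cong-≗ λ i → 𝟙-* (P i) (h i == c))

count-injection : (P : Fin n → Bool) (h : Fin n → Fin m) →
  (∀ i j → P i ≡ true → P j ≡ true → h i ≡ h j → i ≡ j) → count P ≤ m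
count-injection {m = m} P h inj = begin
  count P ≡⟨ count-fibres h P ⟩
  sum (λ c → count (λ i → P i ∧ (h i == c))) ≤⟨ sum-mono (λ c → count-≤1 _ (λ i j p q →
     inj i j (proj₁ (∧-split p)) (proj₁ (∧-split q))
       (trans (==⇒≡ (proj₂ (∧-split {P i} p))) (sym (==⇒≡ (proj₂ (∧-split {P j} q))))))) ⟩
  sum {m} (λ c → 1) ≡⟨ trans (sum-const m 1) (*-identityʳ m) ⟩
  m ∎
  where open ≤-Reasoning

count-permute : (π : Permutation′ n) (P : Fin n → Bool) → count (λ i → P (π ⟨$⟩ʳ i)) ≡ count P
count-permute π P = sym (sum-permute (λ i → 𝟙 (P i)) π)

rankIn : (Fin n → Bool) → Fin n → ℕ
rankIn P x = count (λ y → P y ∧ does (toℕ y <? toℕ x))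

select : (P : Fin n → Bool) (i : ℕ) → i < count P → ∃ λ x → (P x ≡ true) × (rankIn P x ≡ i)
select {zero} P i h = ⊥-elim (n≮0 (subst (i <_) (sum-zero _) h))
select {suc n} P i h = go (P zero) refl i (subst (i <_) (sum-suc _) h)
  where
  later : ∀ {i} → ∃ (λ x → (P (suc x) ≡ true) × (rankIn (P ∘ suc) x ≡ i)) →
    ∃ λ x → (P x ≡ true) × (rankIn P x ≡ 𝟙 (P zero ∧ true) + i)
  later (x , Px , r) = suc x , Px , trans (sum-suc _) (cong (𝟙 (P zero ∧ true) +_) r)
  ∧-false : ∀ b → b ∧ false ≡ false
  ∧-false true = refl
  ∧-false false = refl
  go : ∀ b → P zero ≡ b → ∀ i → i < 𝟙 (P zero) + count (P ∘ suc) → ∃ λ x → (P x ≡ true) × (rankIn P x ≡ i)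
  go true e zero h = zero , e , count-false _ (λ y → ∧-false (P y))
  go true e (suc i) h with later (select (P ∘ suc) i (≤-pred (subst (λ b → suc i < 𝟙 b + count (P ∘ suc)) e h)))
  ... | x , Px , r = x , Px , trans r (cong (λ b → 𝟙 (b ∧ true) + i) e)
  go false e i h with later (select (P ∘ suc) i (subst (λ b → i < 𝟙 b + count (P ∘ suc)) e h))
  ... | x , Px , r = x , Px , trans r (cong (λ b → 𝟙 (b ∧ true) + i) e)

rankIn-< : (P : Fin n → Bool) (x y : Fin n) → P x ≡ true → toℕ x < toℕ y → rankIn P x < rankIn P y
rankIn-< P x y Px x<y = begin
  1 + rankIn P x ≡⟨ cong (_+ rankIn P x) (sym (count-single x)) ⟩
  count (x ==_) + rankIn P x ≡⟨ sym (∑-distrib-+ (λ z → 𝟙 (x == z)) (λ z → 𝟙 (P z ∧ does (toℕ z <? toℕ x)))) ⟩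
  sum (λ z → 𝟙 (x == z) + 𝟙 (P z ∧ does (toℕ z <? toℕ x))) ≤⟨ sum-mono go ⟩
  rankIn P y ∎
  where
  open ≤-Reasoning
  go : ∀ z → 𝟙 (x == z) + 𝟙 (P z ∧ does (toℕ z <? toℕ x)) ≤ 𝟙 (P z ∧ does (toℕ z <? toℕ y))
  go z with x ≟ z
  ... | yes refl rewrite ==-refl x | Px | dec-false (toℕ x <? toℕ x) (<-irrefl refl) | dec-true (toℕ x <? toℕ y) x<y = ≤-refl
  ... | no x≢z rewrite ≢⇒==false x≢z = 𝟙-mono λ e → let (a , b) = ∧-split {P z} e in
    ∧-join a (dec-true (toℕ z <? toℕ y) (<-trans (≡true⇒ (toℕ z <? toℕ x) b) x<y))

rankIn-injective : (P : Fin n → Bool) (x y : Fin n) → P x ≡ true → P y ≡ true → rankIn P x ≡ rankIn P y → x ≡ y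
rankIn-injective P x y Px Py e with <-cmp (toℕ x) (toℕ y)
... | tri< a _ _ = ⊥-elim (<-irrefl e (rankIn-< P x y Px a))
... | tri≈ _ b _ = toℕ-injective b
... | tri> _ _ c = ⊥-elim (<-irrefl (sym e) (rankIn-< P y x Py c))

rankIn<count : (P : Fin n → Bool) (x : Fin n) → P x ≡ true → rankIn P x < count P
rankIn<count P x Px = begin
  1 + rankIn P x ≡⟨ cong (_+ rankIn P x) (sym (count-single x)) ⟩
  count (x ==_) + rankIn P x ≡⟨ sym (∑-distrib-+ (λ z → 𝟙 (x == z)) (λ z → 𝟙 (P z ∧ does (toℕ z <? toℕ x)))) ⟩
  sum (λ z → 𝟙 (x == z) + 𝟙 (P z ∧ does (toℕ z <? toℕ x))) ≤⟨ sum-mono go ⟩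
  count P ∎
  where
  open ≤-Reasoning
  go : ∀ z → 𝟙 (x == z) + 𝟙 (P z ∧ does (toℕ z <? toℕ x)) ≤ 𝟙 (P z)
  go z with x ≟ z
  ... | yes refl rewrite ==-refl x | Px | dec-false (toℕ x <? toℕ x) (<-irrefl refl) = ≤-refl
  ... | no x≢z rewrite ≢⇒==false x≢z = 𝟙-mono λ e → proj₁ (∧-split e)

count-image : ∀ {u} (vs : Fin u → Fin n) → (∀ i j → vs i ≡ vs j → i ≡ j) → (P Q : Fin n → Bool) →
  (∀ i → P (vs i) ≡ false) → (∀ x → P x ≡ true → Q x ≡ true) → (∀ i → Q (vs i) ≡ true) →
  count P + u ≤ count Q
count-image {u = u} vs inj P Q out P⊆Q inn = begin
  count P + u ≡⟨ cong (count P +_) (sym (trans (sum-cong-≗ (λ i → count-single (vs i))) (trans (sum-const u 1) (*-identityʳ u)))) ⟩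
  count P + sum (λ i → count (vs i ==_)) ≡⟨ cong (count P +_) (∑-comm (λ i x → 𝟙 (vs i == x))) ⟩
  count P + sum (λ x → count (λ i → vs i == x)) ≡⟨ sym (∑-distrib-+ (λ x → 𝟙 (P x)) (λ x → count (λ i → vs i == x))) ⟩
  sum (λ x → 𝟙 (P x) + count (λ i → vs i == x)) ≤⟨ sum-mono go ⟩
  count Q ∎
  where
  open ≤-Reasoning
  go : ∀ x → 𝟙 (P x) + count (λ i → vs i == x) ≤ 𝟙 (Q x)
  go x with P x in eq
  ... | true rewrite P⊆Q x eq = ≤-reflexive (cong suc (count-false _ λ i → ≢⇒==false
          λ e → true≢false (trans (cong P e) eq) (out i)))
  ... | false with Q x in eq'
  ... | true = count-≤1 _ (λ i j p q → inj i j (trans (==⇒≡ p) (sym (==⇒≡ q))))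
  ... | false = ≤-reflexive (count-false _ λ i → ≢⇒==false λ e → true≢false (inn i) (trans (cong Q e) eq'))

-- The greedy constructions on permutations below are instances: `Inv k` is the partial object after
-- the elements below `k` are treated, and being `Set`-valued it carries data. On a rooted tree,
-- increasing indices mean that parents come before children.
finLoop : (Inv : ℕ → Set) → Inv 0 → (∀ (i : Fin n) → Inv (toℕ i) → Inv (suc (toℕ i))) → Inv n
finLoop {n} Inv base step = go n ≤-refl
  where
  go : ∀ k → k ≤ n → Inv k
  go zero _ = base
  go (suc k) k<n = subst (Inv ∘ suc) (toℕ-fromℕ< k<n)
    (step (fromℕ< k<n) (subst Inv (sym (toℕ-fromℕ< k<n)) (go k (<⇒≤ k<n))))

-- Modifying permutations

⟨$⟩-injective : (f : Permutation′ n) {i j : Fin n} → f ⟨$⟩ʳ i ≡ f ⟨$⟩ʳ j → i ≡ j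
⟨$⟩-injective f e = trans (sym (inverseˡ f)) (trans (cong (f ⟨$⟩ˡ_) e) (inverseˡ f))

opaque
  swapAt : Fin n → Fin n → Permutation′ n → Permutation′ n
  swapAt i j f = transpose i j ∘ₚ f

  swapAt-left : ∀ i j (f : Permutation′ n) → swapAt i j f ⟨$⟩ʳ i ≡ f ⟨$⟩ʳ j
  swapAt-left i j f rewrite dec-true (i ≟ i) refl = refl

  swapAt-right : ∀ i j (f : Permutation′ n) → swapAt i j f ⟨$⟩ʳ j ≡ f ⟨$⟩ʳ i
  swapAt-right i j f with j ≟ i
  ... | yes refl = refl
  ... | no _ rewrite dec-true (j ≟ j) refl = refl

  swapAt-other : ∀ i j (f : Permutation′ n) {x} → x ≢ i → x ≢ j → swapAt i j f ⟨$⟩ʳ x ≡ f ⟨$⟩ʳ x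
  swapAt-other i j f {x} p q rewrite dec-false (x ≟ i) p | dec-false (x ≟ j) q = refl

-- A partial embedding is a permutation together with the set of vertices whose images are meant.
-- Giving `v` the image `y` is a transposition with the present preimage of `y`, so injectivity
-- costs nothing and only these two vertices move.
assign : Fin n → Fin n → Permutation′ n → Permutation′ n
assign v y f = swapAt v (f ⟨$⟩ˡ y) f

assign-at : ∀ v y (f : Permutation′ n) → assign v y f ⟨$⟩ʳ v ≡ y
assign-at v y f = trans (swapAt-left v (f ⟨$⟩ˡ y) f) (inverseʳ f)

assign-other : ∀ v y (f : Permutation′ n) {x} → x ≢ v → f ⟨$⟩ʳ x ≢ y → assign v y f ⟨$⟩ʳ x ≡ f ⟨$⟩ʳ x
assign-other v y f p q = swapAt-other v (f ⟨$⟩ˡ y) f p (λ e → q (trans (cong (f ⟨$⟩ʳ_) e) (inverseʳ f)))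

private
  -- Let `P` be the rows whose value suits `i` and `Q` the rows that accept the value of `i`. The
  -- hypotheses alone give only |P| + |Q| ≥ u. As `i` is not in `P`, adding it gains the missing one
  -- and forces a common row; this is not `i`, since row `i` rejects its own value.
  exchange : ∀ {u} (R : Fin u → Fin u → Bool) →
    (∀ i → u ≤ 2 * count (R i)) → (∀ j → u ≤ 2 * count (λ i → R i j)) →
    (π : Permutation′ u) (i : Fin u) → R i (π ⟨$⟩ʳ i) ≡ false →
    ∃ λ j → (R i (π ⟨$⟩ʳ j) ≡ true) × (R j (π ⟨$⟩ʳ i) ≡ true)
  exchange {u} R deg deg′ π i eq = from (count-pos _ common)
    where
    P Q P′ : Fin u → Bool
    P j = R i (π ⟨$⟩ʳ j)
    Q j = R j (π ⟨$⟩ʳ i)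
    P′ j = P j ∨ (i == j)
    cP : u ≤ 2 * count P
    cP = subst (λ x → u ≤ 2 * x) (sym (count-permute π (R i))) (deg i)
    cP′ : count P + 1 ≤ count P′
    cP′ = count-image {u = 1} (λ _ → i) (λ { zero zero _ → refl }) P P′ (λ _ → eq) (λ x → ∨-inl) (λ _ → ∨-inr {P i} (==-refl i))
    arith : ∀ a b → u ≤ 2 * a → u ≤ 2 * b → suc u ≤ a + 1 + b
    arith a b p q = *-cancelˡ-< 2 u (a + 1 + b) (begin-strict
      2 * u ≡⟨ cong (u +_) (+-identityʳ u) ⟩
      u + u ≤⟨ +-mono-≤ p q ⟩
      2 * a + 2 * b <⟨ m<m+n _ {2} (s≤s z≤n) ⟩
      2 * a + 2 * b + 2 ≡⟨ lem a b ⟩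
      2 * (a + 1 + b) ∎)
      where
      open ≤-Reasoning
      lem : ∀ a b → 2 * a + 2 * b + 2 ≡ 2 * (a + 1 + b)
      lem = solve-∀
    common : 0 < count (λ j → P′ j ∧ Q j)
    common = +-cancelˡ-< u 0 _ (begin-strict
      u + 0 ≡⟨ +-identityʳ u ⟩
      u <⟨ arith (count P) (count Q) cP (deg′ (π ⟨$⟩ʳ i)) ⟩
      count P + 1 + count Q ≤⟨ +-monoˡ-≤ (count Q) cP′ ⟩
      count P′ + count Q ≤⟨ count-∧+n P′ Q ⟩
      u + count (λ j → P′ j ∧ Q j) ∎)
      where open ≤-Reasoning
    from : (∃ λ j → P′ j ∧ Q j ≡ true) → ∃ λ j → (P j ≡ true) × (Q j ≡ true)
    from (j , e) with ∧-split {P′ j} e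
    ... | p , q with ∨-split {P j} p
    ... | inj₁ p′ = j , p′ , q
    ... | inj₂ i≡j = ⊥-elim (true≢false q (subst (λ x → R x (π ⟨$⟩ʳ i) ≡ false) (==⇒≡ i≡j) eq))

-- A violated row i can be repaired by exchanging its value with that of a row j,
-- since the good choices for i and for j together cover more than all rows.
perfectMatching : ∀ {u} (R : Fin u → Fin u → Bool) →
  (∀ i → u ≤ 2 * count (R i)) → (∀ j → u ≤ 2 * count (λ i → R i j)) →
  ∃ λ (π : Permutation′ u) → ∀ i → R i (π ⟨$⟩ʳ i) ≡ true
perfectMatching {u} R deg deg′ = let (π , ok) = finLoop {u} Inv (Data.Fin.Permutation.id , λ _ ()) step in
    π , λ i → ok i (toℕ<n i)
  where
  Inv : ℕ → Set
  Inv k = ∃ λ (π : Permutation′ u) → ∀ i → toℕ i < k → R i (π ⟨$⟩ʳ i) ≡ true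
  step : ∀ i → Inv (toℕ i) → Inv (suc (toℕ i))
  extend : ∀ i (π : Permutation′ u) → (∀ j → toℕ j < toℕ i → R j (π ⟨$⟩ʳ j) ≡ true) →
    R i (π ⟨$⟩ʳ i) ≡ true → ∀ j → toℕ j < suc (toℕ i) → R j (π ⟨$⟩ʳ j) ≡ true
  extend i π ok eq j j<si with m≤n⇒m<n∨m≡n (≤-pred j<si)
  ... | inj₁ j<i = ok j j<i
  ... | inj₂ j≡i = subst (λ j → R j (π ⟨$⟩ʳ j) ≡ true) (sym (toℕ-injective j≡i)) eq
  swapped : ∀ i (π : Permutation′ u) → (∀ j → toℕ j < toℕ i → R j (π ⟨$⟩ʳ j) ≡ true) →
    (∃ λ j → (R i (π ⟨$⟩ʳ j) ≡ true) × (R j (π ⟨$⟩ʳ i) ≡ true)) → Inv (suc (toℕ i))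
  swapped i π ok (j , Pj , Qj) = swapAt i j π , ok′
    where
    ok′ : ∀ x → toℕ x < suc (toℕ i) → R x (swapAt i j π ⟨$⟩ʳ x) ≡ true
    ok′ x x<si with x ≟ i | x ≟ j
    ... | yes refl | _ = trans (cong (R x) (swapAt-left x j π)) Pj
    ... | no _ | yes refl = trans (cong (R x) (swapAt-right i x π)) Qj
    ... | no x≢i | no x≢j = trans (cong (R x) (swapAt-other i j π x≢i x≢j))
      (ok x (≤∧≢⇒< (≤-pred x<si) (x≢i ∘ toℕ-injective)))
  step i (π , ok) = [ (λ eq → π , extend i π ok eq)
                    , (λ eq → swapped i π ok (exchange R deg deg′ π i eq)) ]′ (bool-cases (R i (π ⟨$⟩ʳ i)))

-- Exponential estimates

^-distribʳ-* : ∀ p a b → (a * b) ^ p ≡ a ^ p * b ^ p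
^-distribʳ-* zero a b = refl
^-distribʳ-* (suc p) a b = trans (cong (a * b *_) (^-distribʳ-* p a b)) (lem a b (a ^ p) (b ^ p))
  where
  lem : ∀ a b x y → a * b * (x * y) ≡ a * x * (b * y)
  lem = solve-∀

-- Bernoulli's inequality for (1 + 1/D)^k, cleared of denominators.
bernoulli : ∀ D k → D ^ k * (D + k) ≤ D * suc D ^ k
bernoulli D zero = ≤-reflexive (lem D)
  where
  lem : ∀ D → 1 * (D + 0) ≡ D * 1
  lem = solve-∀
bernoulli D (suc k) = begin
  D * D ^ k * (D + suc k) ≤⟨ m≤m+n _ (D ^ k * k) ⟩
  D * D ^ k * (D + suc k) + D ^ k * k ≡⟨ lem D (D ^ k) k ⟩
  suc D * (D ^ k * (D + k)) ≤⟨ *-monoʳ-≤ (suc D) (bernoulli D k) ⟩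
  suc D * (D * suc D ^ k) ≡⟨ lem′ D (suc D ^ k) ⟩
  D * (suc D * suc D ^ k) ∎
  where
  open ≤-Reasoning
  lem : ∀ D p k → D * p * (D + suc k) + p * k ≡ suc D * (p * (D + k))
  lem = solve-∀
  lem′ : ∀ D p → suc D * (D * p) ≡ D * (suc D * p)
  lem′ = solve-∀

-- By `bernoulli` with k = D, each block of D factors 1 + 1/D contributes at least 2; the remaining
-- factors are at least 1.
growth : ∀ D′ p s → let D = suc D′ in D * p ≤ s → 2 ^ p * D ^ s ≤ suc D ^ s
growth D′ p s h = subst (λ s → 2 ^ p * D ^ s ≤ suc D ^ s) (m+[n∸m]≡n h) (begin
  2 ^ p * D ^ (D * p + r) ≡⟨ cong (2 ^ p *_) (^-distribˡ-+-* D (D * p) r) ⟩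
  2 ^ p * (D ^ (D * p) * D ^ r) ≡⟨ sym (*-assoc (2 ^ p) (D ^ (D * p)) (D ^ r)) ⟩
  2 ^ p * D ^ (D * p) * D ^ r ≤⟨ *-mono-≤ (powers p) (^-monoˡ-≤ r (n≤1+n D)) ⟩
  suc D ^ (D * p) * suc D ^ r ≡⟨ sym (^-distribˡ-+-* (suc D) (D * p) r) ⟩
  suc D ^ (D * p + r) ∎)
  where
  open ≤-Reasoning
  D = suc D′
  r = s ∸ D * p
  double : 2 * D ^ D ≤ suc D ^ D
  double = *-cancelˡ-≤ D (≤-trans (≤-reflexive (lem D (D ^ D))) (bernoulli D D))
    where
    lem : ∀ D p → D * (2 * p) ≡ p * (D + D)
    lem = solve-∀
  powers : ∀ p → 2 ^ p * D ^ (D * p) ≤ suc D ^ (D * p)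
  powers p = begin
    2 ^ p * D ^ (D * p) ≡⟨ cong (2 ^ p *_) (sym (^-*-assoc D D p)) ⟩
    2 ^ p * (D ^ D) ^ p ≡⟨ sym (^-distribʳ-* p 2 (D ^ D)) ⟩
    (2 * D ^ D) ^ p ≤⟨ ^-monoˡ-≤ p double ⟩
    (suc D ^ D) ^ p ≡⟨ ^-*-assoc (suc D) D p ⟩
    suc D ^ (D * p) ∎

-- From (1 - 1/(Y+1))^b ≥ 1 - b/(Y+1), which is at least 1/2 here.
decay-half : ∀ Y b → b + b ≤ suc Y → suc Y ^ b ≤ 2 * Y ^ b
decay-half Y b b+b≤Y = *-cancelˡ-≤ (suc Y) (begin
  suc Y * suc Y ^ b ≤⟨ *-monoˡ-≤ (suc Y ^ b) half ⟩
  2 * (suc Y ∸ b) * suc Y ^ b ≡⟨ lem (suc Y ∸ b) (suc Y ^ b) ⟩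
  2 * (suc Y ^ b * (suc Y ∸ b)) ≤⟨ *-monoʳ-≤ 2 (reverse-bernoulli b) ⟩
  2 * (suc Y * Y ^ b) ≡⟨ lem″ (suc Y) (Y ^ b) ⟩
  suc Y * (2 * Y ^ b) ∎)
  where
  open ≤-Reasoning
  lem : ∀ a b → 2 * a * b ≡ 2 * (b * a)
  lem = solve-∀
  lem″ : ∀ a b → 2 * (a * b) ≡ a * (2 * b)
  lem″ = solve-∀
  half : suc Y ≤ 2 * (suc Y ∸ b)
  half = begin
    suc Y ≡⟨ sym (m+n∸n≡m (suc Y) b) ⟩
    suc Y + b ∸ b ≤⟨ ∸-monoˡ-≤ b (+-monoʳ-≤ (suc Y) (m+n≤o⇒m≤o∸n b b+b≤Y)) ⟩
    (suc Y + (suc Y ∸ b)) ∸ b ≡⟨ +-∸-comm (suc Y ∸ b) (≤-trans (m≤m+n b b) b+b≤Y) ⟩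
    (suc Y ∸ b) + (suc Y ∸ b) ≡⟨ cong ((suc Y ∸ b) +_) (sym (+-identityʳ _)) ⟩
    2 * (suc Y ∸ b) ∎
  reverse-bernoulli : ∀ b → suc Y ^ b * (suc Y ∸ b) ≤ suc Y * Y ^ b
  reverse-bernoulli zero = ≤-reflexive (*-comm 1 (suc Y))
  reverse-bernoulli (suc b) with b ≤? Y
  ... | no ¬p rewrite m≤n⇒m∸n≡0 (<⇒≤ (≰⇒> ¬p)) = ≤-trans (≤-reflexive (*-zeroʳ (suc Y * suc Y ^ b))) z≤n
  ... | yes p = begin
    suc Y * suc Y ^ b * (Y ∸ b) ≤⟨ m≤m+n _ (suc Y ^ b * b) ⟩
    suc Y * suc Y ^ b * (Y ∸ b) + suc Y ^ b * b ≡⟨ lem′ (suc Y ^ b) (Y ∸ b) b Y (sym (m∸n+n≡m p)) ⟩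
    Y * (suc Y ^ b * suc (Y ∸ b)) ≡⟨ cong (λ z → Y * (suc Y ^ b * z)) (sym (+-∸-assoc 1 p)) ⟩
    Y * (suc Y ^ b * (suc Y ∸ b)) ≤⟨ *-monoʳ-≤ Y (reverse-bernoulli b) ⟩
    Y * (suc Y * Y ^ b) ≡⟨ lem‴ Y (Y ^ b) ⟩
    suc Y * (Y * Y ^ b) ∎
    where
    lem′ : ∀ p z b Y → Y ≡ z + b → suc Y * p * z + p * b ≡ Y * (p * suc z)
    lem′ p z b _ refl = solve p z b
      where
      solve : ∀ p z b → suc (z + b) * p * z + p * b ≡ (z + b) * (p * suc z)
      solve = solve-∀
    lem‴ : ∀ Y p → Y * (suc Y * p) ≡ suc Y * (Y * p)
    lem‴ = solve-∀

-- The `b` factors are cut into at most `y` blocks of length at most `h`, each losing a factor 2.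
decay : ∀ Y h y b → h + h ≤ suc Y → b ≤ h * y → suc Y ^ b ≤ 2 ^ y * Y ^ b
decay Y h zero b hh bh with subst (b ≤_) (*-zeroʳ h) bh
... | z≤n = ≤-refl
decay Y h (suc y) b hh bh with b ≤? h
... | yes b≤h = ≤-trans (decay-half Y b (≤-trans (+-mono-≤ b≤h b≤h) hh))
  (*-monoˡ-≤ (Y ^ b) (*-monoʳ-≤ 2 (m^n>0 2 y)))
... | no ¬p = subst (λ b → suc Y ^ b ≤ 2 ^ suc y * Y ^ b) (m+[n∸m]≡n h≤b) (begin
  suc Y ^ (h + r) ≡⟨ ^-distribˡ-+-* (suc Y) h r ⟩
  suc Y ^ h * suc Y ^ r ≤⟨ *-mono-≤ (decay-half Y h hh) (decay Y h y r hh r≤) ⟩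
  2 * Y ^ h * (2 ^ y * Y ^ r) ≡⟨ lem (Y ^ h) (2 ^ y) (Y ^ r) ⟩
  2 * 2 ^ y * (Y ^ h * Y ^ r) ≡⟨ cong (2 * 2 ^ y *_) (sym (^-distribˡ-+-* Y h r)) ⟩
  2 ^ suc y * Y ^ (h + r) ∎)
  where
  open ≤-Reasoning
  h≤b = <⇒≤ (≰⇒> ¬p)
  r = b ∸ h
  r≤ : r ≤ h * y
  r≤ = m≤n+o⇒m∸n≤o b h (subst (b ≤_) (*-suc h y) bh)
  lem : ∀ a b c → 2 * a * (b * c) ≡ 2 * b * (a * c)
  lem = solve-∀

-- Fair partitions

pick : Bool → {A : Set} → A → A → A
pick true a b = a
pick false a b = b

pick-flip : ∀ c {A : Set} (a b : A) (P : A → Bool) → P (pick c a b) ≡ pick c (P a) (P b)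
pick-flip true a b P = refl
pick-flip false a b P = refl

private
  -- D = `suc D′` times 1 + 1/D, 1 - 1/D or 1: rational stand-ins for the increments of an
  -- exponential moment of (chosen minus rejected), made integral by the scaling.
  factor : ℕ → Bool → Bool → ℕ
  factor D′ true false = suc (suc D′)
  factor D′ false true = D′
  factor D′ true true = suc D′
  factor D′ false false = suc D′

  factor-sum : ∀ D′ a b → factor D′ a b + factor D′ b a ≡ 2 * suc D′
  factor-sum D′ true true = cong (suc D′ +_) (sym (+-identityʳ (suc D′)))
  factor-sum D′ true false = lem D′
    where
    lem : ∀ D → suc (suc D) + D ≡ 2 * suc D
    lem = solve-∀
  factor-sum D′ false true = lem D′
    where
    lem : ∀ D → D + suc (suc D) ≡ 2 * suc D
    lem = solve-∀
  factor-sum D′ false false = cong (suc D′ +_) (sym (+-identityʳ (suc D′)))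

  prod : (Fin m → ℕ) → ℕ
  prod {zero} f = 1
  prod {suc m} f = f zero * prod (f ∘ suc)

  cons : Bool → (Fin m → Bool) → Fin (suc m) → Bool
  cons b ε zero = b
  cons b ε (suc i) = ε i

  potential : ℕ → (Fin m → Bool) → (Fin m → Bool) → (Fin m → Bool) → ℕ
  potential D′ ε X Y = prod (λ i → factor D′ (pick (ε i) (X i) (Y i)) (pick (ε i) (Y i) (X i)))

  -- The two signs of a pair change the total potential by factors averaging to D.
  signs : ∀ D′ {N} (X Y : Fin N → Fin m → Bool) →
    ∃ λ (ε : Fin m → Bool) → sum (λ τ → potential D′ ε (X τ) (Y τ)) ≤ N * suc D′ ^ m
  signs {zero} D′ {N} X Y = (λ ()) , ≤-reflexive (sum-const N 1)
  signs {suc m} D′ {N} X Y = choose (signs D′ (λ τ → X τ ∘ suc) (λ τ → Y τ ∘ suc))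
    where
    D = suc D′
    choose : (∃ λ (ε : Fin m → Bool) → sum (λ τ → potential D′ ε (X τ ∘ suc) (Y τ ∘ suc)) ≤ N * D ^ m) →
      ∃ λ (ε : Fin (suc m) → Bool) → sum (λ τ → potential D′ ε (X τ) (Y τ)) ≤ N * (D * D ^ m)
    choose (ε , h) = [ (λ le → cons true ε , bound s₁ s₂ total le)
                     , (λ le → cons false ε , bound s₂ s₁ (trans (+-comm s₂ s₁) total) le) ]′ (≤-total s₁ s₂)
      where
      w : Fin N → ℕ
      w τ = potential D′ ε (X τ ∘ suc) (Y τ ∘ suc)
      s₁ = sum (λ τ → factor D′ (X τ zero) (Y τ zero) * w τ)
      s₂ = sum (λ τ → factor D′ (Y τ zero) (X τ zero) * w τ)
      total : s₁ + s₂ ≡ 2 * D * sum w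
      total = trans (sym (∑-distrib-+ (λ τ → factor D′ (X τ zero) (Y τ zero) * w τ) (λ τ → factor D′ (Y τ zero) (X τ zero) * w τ)))
        (trans (sum-cong-≗ (λ τ → trans (sym (*-distribʳ-+ (w τ) (factor D′ (X τ zero) (Y τ zero)) _))
          (cong (_* w τ) (factor-sum D′ (X τ zero) (Y τ zero))))) (sum-*ˡ (2 * D) w))
      bound : ∀ a b → a + b ≡ 2 * D * sum w → a ≤ b → a ≤ N * (D * D ^ m)
      bound a b e le = begin
        a ≤⟨ *-cancelˡ-≤ 2 (≤-trans (≤-reflexive (cong (a +_) (+-identityʳ a))) (≤-trans (+-monoʳ-≤ a le)
               (≤-reflexive (trans e (*-assoc 2 D (sum w)))))) ⟩
        D * sum w ≤⟨ *-monoʳ-≤ D h ⟩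
        D * (N * D ^ m) ≡⟨ lem D N (D ^ m) ⟩
        N * (D * D ^ m) ∎
        where
        open ≤-Reasoning
        lem : ∀ a b c → a * (b * c) ≡ b * (a * c)
        lem = solve-∀

  -- `a`, `b` and `e` count the positions in S only, in T only and in both; `c` counts those in both
  -- or in neither, where the factor is D.
  record Exponents (D′ : ℕ) (S T : Fin m → Bool) : Set where
    constructor exponents
    field
      a b c e : ℕ
      prod≡ : prod (λ i → factor D′ (S i) (T i)) ≡ suc (suc D′) ^ a * D′ ^ b * suc D′ ^ c
      countS : count S ≡ a + e
      countT : count T ≡ b + e
      size : a + b + c ≡ m

  exponentsOf : ∀ D′ (S T : Fin m → Bool) → Exponents D′ S T
  exponentsOf {zero} D′ S T = exponents 0 0 0 0 refl (sum-zero _) (sum-zero _) refl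
  exponentsOf {suc m} D′ S T = go (S zero) (T zero) refl refl (exponentsOf D′ (S ∘ suc) (T ∘ suc))
    where
    go : ∀ s t → S zero ≡ s → T zero ≡ t → Exponents D′ (S ∘ suc) (T ∘ suc) → Exponents D′ S T
    go true true es et (exponents a b c e p cs ct sz) = exponents a b (suc c) (suc e)
      (trans (cong₂ _*_ (cong₂ (factor D′) es et) p) (lem (suc (suc D′) ^ a) (D′ ^ b) (suc D′) (suc D′ ^ c)))
      (trans (sum-suc _) (trans (cong₂ _+_ (cong 𝟙 es) cs) (sym (+-suc a e))))
      (trans (sum-suc _) (trans (cong₂ _+_ (cong 𝟙 et) ct) (sym (+-suc b e))))
      (trans (+-suc (a + b) c) (cong suc sz))
      where
      lem : ∀ x y z v → z * (x * y * v) ≡ x * y * (z * v)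
      lem = solve-∀
    go true false es et (exponents a b c e p cs ct sz) = exponents (suc a) b c e
      (trans (cong₂ _*_ (cong₂ (factor D′) es et) p) (lem (suc (suc D′)) (suc (suc D′) ^ a) (D′ ^ b) (suc D′ ^ c)))
      (trans (sum-suc _) (cong₂ _+_ (cong 𝟙 es) cs))
      (trans (sum-suc _) (cong₂ _+_ (cong 𝟙 et) ct))
      (cong suc sz)
      where
      lem : ∀ z x y v → z * (x * y * v) ≡ z * x * y * v
      lem = solve-∀
    go false true es et (exponents a b c e p cs ct sz) = exponents a (suc b) c e
      (trans (cong₂ _*_ (cong₂ (factor D′) es et) p) (lem D′ (suc (suc D′) ^ a) (D′ ^ b) (suc D′ ^ c)))
      (trans (sum-suc _) (cong₂ _+_ (cong 𝟙 es) cs))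
      (trans (sum-suc _) (cong₂ _+_ (cong 𝟙 et) ct))
      (trans (cong (_+ c) (+-suc a b)) (cong suc sz))
      where
      lem : ∀ z x y v → z * (x * y * v) ≡ x * (z * y) * v
      lem = solve-∀
    go false false es et (exponents a b c e p cs ct sz) = exponents a b (suc c) e
      (trans (cong₂ _*_ (cong₂ (factor D′) es et) p) (lem (suc (suc D′) ^ a) (D′ ^ b) (suc D′) (suc D′ ^ c)))
      (trans (sum-suc _) (cong₂ _+_ (cong 𝟙 es) cs))
      (trans (sum-suc _) (cong₂ _+_ (cong 𝟙 et) ct))
      (trans (+-suc (a + b) c) (cong suc sz))
      where
      lem : ∀ x y z v → z * (x * y * v) ≡ x * y * (z * v)
      lem = solve-∀

  -- With D = 4θ: (1 + 1/D)^(8θy) ≥ 2^(2y), while (1 - 1/D²)^b ≥ 2^(-y) for b ≤ 8θ²y.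
  unbalanced : ∀ θ′ y N a b c δ → let θ = suc θ′ ; D′ = 3 + 4 * θ′ in
    δ ≡ 8 * θ * y → b ≤ 8 * θ * θ * y → b + δ ≤ a →
    suc (suc D′) ^ a * D′ ^ b * suc D′ ^ c ≤ N * suc D′ ^ (a + b + c) → 2 ^ y ≤ N
  unbalanced θ′ y N a b c δ δ≡ b≤ le pot = *-cancelˡ-≤ (2 ^ y) ⦃ m^n≢0 2 y ⦄
      (*-cancelʳ-≤ (2 ^ y * 2 ^ y) (2 ^ y * N) (D ^ (a + b)) ⦃ m^n≢0 D (a + b) ⦄ main)
    where
    open ≤-Reasoning
    θ = suc θ′
    D′ = 3 + 4 * θ′
    D = suc D′
    r = a ∸ (b + δ)
    a≡ : b + δ + r ≡ a
    a≡ = m+[n∸m]≡n le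
    -- `suc Y` is D², and D² - 1 = (D + 1)(D - 1), so `decay` at `Y` estimates `b` pairs of opposite
    -- factors.
    Y = D′ + D′ * D
    cancelled : suc D ^ a * D′ ^ b ≤ N * D ^ (a + b)
    cancelled = *-cancelʳ-≤ _ _ (D ^ c) ⦃ m^n≢0 D c ⦄ (≤-trans pot (≤-reflexive
      (trans (cong (N *_) (^-distribˡ-+-* D (a + b) c)) (sym (*-assoc N (D ^ (a + b)) (D ^ c))))))
    gr : 2 ^ (2 * y) * D ^ δ ≤ suc D ^ δ
    gr = growth D′ (2 * y) δ (≤-reflexive (trans (lem θ′ y) (sym δ≡)))
      where
      lem : ∀ t y → suc (3 + 4 * t) * (2 * y) ≡ 8 * suc t * y
      lem = solve-∀
    dc : (D * D) ^ b ≤ 2 ^ y * Y ^ b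
    dc = decay Y (8 * θ * θ) y b (≤-reflexive (lem θ′)) b≤
      where
      lem : ∀ t → 8 * suc t * suc t + 8 * suc t * suc t ≡ suc (3 + 4 * t + (3 + 4 * t) * suc (3 + 4 * t))
      lem = solve-∀
    Y≡ : Y ≡ suc D * D′
    Y≡ = lem D′
      where
      lem : ∀ d → d + d * suc d ≡ suc (suc d) * d
      lem = solve-∀
    D^a+b : D ^ (a + b) ≡ D ^ δ * D ^ r * (D * D) ^ b
    D^a+b = trans (cong (λ x → D ^ (x + b)) (sym a≡)) (trans (cong (D ^_) (lem b δ r))
      (trans (^-distribˡ-+-* D (δ + r) (b + b)) (cong₂ _*_ (^-distribˡ-+-* D δ r)
        (trans (^-distribˡ-+-* D b b) (sym (^-distribʳ-* b D D))))))
      where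
      lem : ∀ b δ r → b + δ + r + b ≡ δ + r + (b + b)
      lem = solve-∀
    sD^a : suc D ^ a ≡ suc D ^ b * suc D ^ δ * suc D ^ r
    sD^a = trans (cong (suc D ^_) (sym a≡)) (trans (^-distribˡ-+-* (suc D) (b + δ) r)
      (cong (_* suc D ^ r) (^-distribˡ-+-* (suc D) b δ)))
    main : 2 ^ y * 2 ^ y * D ^ (a + b) ≤ 2 ^ y * N * D ^ (a + b)
    main = begin
      2 ^ y * 2 ^ y * D ^ (a + b) ≡⟨ cong₂ _*_ (trans (sym (^-distribˡ-+-* 2 y y)) (cong (λ z → 2 ^ (y + z)) (sym (+-identityʳ y)))) D^a+b ⟩
      2 ^ (2 * y) * (D ^ δ * D ^ r * (D * D) ^ b) ≡⟨ lem₁ (2 ^ (2 * y)) (D ^ δ) (D ^ r) ((D * D) ^ b) ⟩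
      2 ^ (2 * y) * D ^ δ * D ^ r * (D * D) ^ b ≤⟨ *-mono-≤ (*-mono-≤ gr (^-monoˡ-≤ r (n≤1+n D))) dc ⟩
      suc D ^ δ * suc D ^ r * (2 ^ y * Y ^ b) ≡⟨ cong (λ z → suc D ^ δ * suc D ^ r * (2 ^ y * z)) (trans (cong (_^ b) Y≡) (^-distribʳ-* b (suc D) D′)) ⟩
      suc D ^ δ * suc D ^ r * (2 ^ y * (suc D ^ b * D′ ^ b)) ≡⟨ lem₂ (suc D ^ δ) (suc D ^ r) (2 ^ y) (suc D ^ b) (D′ ^ b) ⟩
      2 ^ y * (suc D ^ b * suc D ^ δ * suc D ^ r * D′ ^ b) ≡⟨ cong (λ z → 2 ^ y * (z * D′ ^ b)) (sym sD^a) ⟩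
      2 ^ y * (suc D ^ a * D′ ^ b) ≤⟨ *-monoʳ-≤ (2 ^ y) cancelled ⟩
      2 ^ y * (N * D ^ (a + b)) ≡⟨ sym (*-assoc (2 ^ y) N (D ^ (a + b))) ⟩
      2 ^ y * N * D ^ (a + b) ∎
      where
      lem₁ : ∀ p x y z → p * (x * y * z) ≡ p * x * y * z
      lem₁ = solve-∀
      lem₂ : ∀ x r p b d → x * r * (p * (b * d)) ≡ p * (b * x * r * d)
      lem₂ = solve-∀

-- The potential of one test is at most the total from `signs`; a deviation above 8θy would let
-- `unbalanced` turn this into 2^y ≤ N. The bound is one-sided, and `halve` obtains the other side
-- by listing each test again with the roles exchanged.
discrepancy : ∀ θ′ y {N} (X Y : Fin N → Fin m → Bool) → let θ = suc θ′ in
  m ≤ 8 * θ * θ * y → N < 2 ^ y →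
  ∃ λ (ε : Fin m → Bool) → ∀ τ →
    count (λ i → pick (ε i) (X τ i) (Y τ i)) ≤ count (λ i → pick (ε i) (Y τ i) (X τ i)) + 8 * θ * y
discrepancy {m} θ′ y {N} X Y m≤ N< = let (ε , h) = signs (3 + 4 * θ′) X Y in ε , conclude ε h
  where
  δ = 8 * suc θ′ * y
  conclude : ∀ ε → sum (λ τ → potential (3 + 4 * θ′) ε (X τ) (Y τ)) ≤ N * suc (3 + 4 * θ′) ^ m → ∀ τ →
    count (λ i → pick (ε i) (X τ i) (Y τ i)) ≤ count (λ i → pick (ε i) (Y τ i) (X τ i)) + δ
  conclude ε h τ = go (exponentsOf (3 + 4 * θ′) (λ i → pick (ε i) (X τ i) (Y τ i)) (λ i → pick (ε i) (Y τ i) (X τ i)))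
    where
    go : Exponents (3 + 4 * θ′) (λ i → pick (ε i) (X τ i) (Y τ i)) (λ i → pick (ε i) (Y τ i) (X τ i)) → _
    go (exponents a b c e p cs ct sz) = ≮⇒≥ λ lt → <⇒≱ N< (unbalanced θ′ y N a b c δ refl
      (≤-trans (≤-trans (≤-trans (m≤n+m b a) (m≤m+n (a + b) c)) (≤-reflexive sz)) m≤)
      (<⇒≤ (+-cancelʳ-< e (b + δ) a (subst₂ _<_ (trans (cong (_+ δ) ct) (lem b e δ)) cs lt)))
      (subst₂ (λ x z → x ≤ N * suc (3 + 4 * θ′) ^ z) p (sym sz)
        (≤-trans (term≤sum (λ τ → potential (3 + 4 * θ′) ε (X τ) (Y τ)) τ) h)))
      where
      lem : ∀ b e δ → b + e + δ ≡ b + δ + e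
      lem = solve-∀

sum-++ : ∀ m {n} (f : Fin (m + n) → ℕ) → sum f ≡ sum (λ i → f (i ↑ˡ n)) + sum (λ j → f (m ↑ʳ j))
sum-++ zero f = sym (cong (_+ sum f) (sum-zero _))
sum-++ (suc m) {n} f = trans (sum-suc f) (trans (cong (f zero +_) (sum-++ m (f ∘ suc)))
  (trans (sym (+-assoc (f zero) _ _)) (cong (_+ sum (λ j → f (suc m ↑ʳ j))) (sym (sum-suc (λ i → f (i ↑ˡ n)))))))

-- Doubling by addition, so that `Fin (dbl (suc j) u)` is definitionally of the form `Fin (m + m)`
-- that `halve` expects.
dbl : ℕ → ℕ → ℕ
dbl zero u = u
dbl (suc j) u = dbl j u + dbl j u

dbl≡ : ∀ j u → dbl j u ≡ 2 ^ j * u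
dbl≡ zero u = sym (*-identityˡ u)
dbl≡ (suc j) u = trans (cong₂ _+_ (dbl≡ j u) (dbl≡ j u)) (lem (2 ^ j) u)
  where
  lem : ∀ p u → p * u + p * u ≡ 2 * p * u
  lem = solve-∀

-- The surplus that a set must have so that `j` halvings, each with discrepancy δ, still leave a
-- nonnegative one.
slack : ℕ → ℕ → ℕ
slack δ zero = 0
slack δ (suc j) = 2 * (slack δ j + δ)

slack≤ : ∀ δ j → slack δ j ≤ 4 ^ j * δ
slack≤ δ zero = z≤n
slack≤ δ (suc j) = ≤-trans (*-monoʳ-≤ 2 (m≤m+n (slack δ j + δ) δ)) (go j)
  where
  -- The two extra δ make the bound reproduce itself: s + 2δ exactly doubles under s ↦ 2(s + δ).
  tight : ∀ j → slack δ j + δ + δ ≤ 2 * (4 ^ j * δ)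
  tight zero = ≤-reflexive (l δ)
    where
    l : ∀ d → d + d ≡ 2 * (1 * d)
    l = solve-∀
  tight (suc j) = ≤-trans (≤-reflexive (l₁ (slack δ j) δ)) (≤-trans (*-monoʳ-≤ 2 (m≤m+n (slack δ j + δ + δ) (slack δ j + δ + δ)))
    (≤-trans (*-monoʳ-≤ 2 (+-mono-≤ (tight j) (tight j))) (≤-reflexive (l₂ (4 ^ j) δ))))
    where
    l₁ : ∀ s d → 2 * (s + d) + d + d ≡ 2 * (s + d + d)
    l₁ = solve-∀
    l₂ : ∀ p d → 2 * (2 * (p * d) + 2 * (p * d)) ≡ 2 * (4 * p * d)
    l₂ = solve-∀
  go : ∀ j → 2 * (slack δ j + δ + δ) ≤ 4 ^ suc j * δ
  go j = ≤-trans (*-monoʳ-≤ 2 (tight j)) (≤-reflexive (l (4 ^ j) δ))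
    where
    l : ∀ p d → 2 * (2 * (p * d)) ≡ 4 * p * d
    l = solve-∀

-- `s` is twice the surplus over half of the set; the doubling avoids fractions.
Fair : (Fin N → Fin n → Bool) → (Fin m → Fin n) → ℕ → Set
Fair {m = m} S U s = ∀ τ → m + s ≤ 2 * count (λ q → S τ (U q))

Injective₁ : (Fin m → Fin n) → Set
Injective₁ U = ∀ i j → U i ≡ U j → i ≡ j

record Halves (S : Fin N → Fin n → Bool) (U : Fin (m + m) → Fin n) (s : ℕ) : Set where
  field
    half : Bool → Fin m → Fin n
    half-fair : ∀ b → Fair S (half b) s
    half-injective : ∀ b i b′ i′ → half b i ≡ half b′ i′ → (b ≡ b′) × (i ≡ i′)
    half-⊆ : ∀ b i → ∃ λ x → half b i ≡ U x

↑ˡ≢↑ʳ : (i : Fin m) (j : Fin k) → i ↑ˡ k ≢ m ↑ʳ j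
↑ˡ≢↑ʳ {m} {k} i j e = case trans (sym (splitAt-↑ˡ m i k)) (trans (cong (splitAt m) e) (splitAt-↑ʳ m k j)) of λ ()

-- The elements with indices i and m + i form a pair, one of which goes to each half. The tests are
-- doubled to N + N, the second copy with the members of all pairs exchanged, so that `discrepancy`
-- bounds both differences.
halve : ∀ θ′ y (S : Fin N → Fin n → Bool) (U : Fin (m + m) → Fin n) (s : ℕ) → let δ = 8 * suc θ′ * y in
  m ≤ 8 * suc θ′ * suc θ′ * y → N + N < 2 ^ y →
  Injective₁ U → Fair S U (2 * (s + δ)) → Halves S U s
halve {N} {n} {m} θ′ y S U s m≤ N< inj fair = build (discrepancy θ′ y X Y m≤ N<)
  where
  δ = 8 * suc θ′ * y
  L R : Fin m → Fin n
  L i = U (i ↑ˡ m)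
  R i = U (m ↑ʳ i)
  X Y : Fin (N + N) → Fin m → Bool
  X τ i = [ (λ τ → S τ (L i)) , (λ τ → S τ (R i)) ]′ (splitAt N τ)
  Y τ i = [ (λ τ → S τ (R i)) , (λ τ → S τ (L i)) ]′ (splitAt N τ)
  build : (∃ λ (ε : Fin m → Bool) → ∀ τ →
    count (λ i → pick (ε i) (X τ i) (Y τ i)) ≤ count (λ i → pick (ε i) (Y τ i) (X τ i)) + δ) → Halves S U s
  build (ε , d) = record { half = half ; half-fair = half-fair ; half-injective = half-injective ; half-⊆ = half-⊆ }
    where
    half : Bool → Fin m → Fin n
    half true i = pick (ε i) (L i) (R i)
    half false i = pick (ε i) (R i) (L i)
    c : Bool → Fin N → ℕ
    c b τ = count (λ i → S τ (half b i))
    le₁ : ∀ τ → c true τ ≤ c false τ + δ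
    le₁ τ = subst₂ (λ a b → a ≤ b + δ)
      (sum-cong-≗ λ i → cong 𝟙 (trans (cong₂ (pick (ε i)) (cong [ _ , _ ]′ (splitAt-↑ˡ N τ N)) (cong [ _ , _ ]′ (splitAt-↑ˡ N τ N))) (sym (pick-flip (ε i) (L i) (R i) (S τ)))))
      (sum-cong-≗ λ i → cong 𝟙 (trans (cong₂ (pick (ε i)) (cong [ _ , _ ]′ (splitAt-↑ˡ N τ N)) (cong [ _ , _ ]′ (splitAt-↑ˡ N τ N))) (sym (pick-flip (ε i) (R i) (L i) (S τ)))))
      (d (τ ↑ˡ N))
    le₂ : ∀ τ → c false τ ≤ c true τ + δ
    le₂ τ = subst₂ (λ a b → a ≤ b + δ)
      (sum-cong-≗ λ i → cong 𝟙 (trans (cong₂ (pick (ε i)) (cong [ _ , _ ]′ (splitAt-↑ʳ N N τ)) (cong [ _ , _ ]′ (splitAt-↑ʳ N N τ))) (sym (pick-flip (ε i) (R i) (L i) (S τ)))))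
      (sum-cong-≗ λ i → cong 𝟙 (trans (cong₂ (pick (ε i)) (cong [ _ , _ ]′ (splitAt-↑ʳ N N τ)) (cong [ _ , _ ]′ (splitAt-↑ʳ N N τ))) (sym (pick-flip (ε i) (L i) (R i) (S τ)))))
      (d (N ↑ʳ τ))
    total : ∀ τ → count (λ q → S τ (U q)) ≡ c true τ + c false τ
    total τ = trans (sum-++ m (λ q → 𝟙 (S τ (U q))))
      (trans (sym (∑-distrib-+ (λ i → 𝟙 (S τ (L i))) (λ i → 𝟙 (S τ (R i)))))
      (trans (sum-cong-≗ (λ i → p (ε i) (L i) (R i)))
             (∑-distrib-+ (λ i → 𝟙 (S τ (half true i))) (λ i → 𝟙 (S τ (half false i))))))
      where
      p : ∀ b x y → 𝟙 (S τ x) + 𝟙 (S τ y) ≡ 𝟙 (S τ (pick b x y)) + 𝟙 (S τ (pick b y x))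
      p true x y = refl
      p false x y = +-comm (𝟙 (S τ x)) (𝟙 (S τ y))
    from : ∀ τ a b → c true τ + c false τ ≡ a + b → b ≤ a + δ → m + s ≤ 2 * a
    from τ a b e le = *-cancelˡ-≤ 2 (+-cancelʳ-≤ (2 * δ) (2 * (m + s)) (2 * (2 * a)) (begin
      2 * (m + s) + 2 * δ ≡⟨ lem₁ m s δ ⟩
      m + m + 2 * (s + δ) ≤⟨ fair τ ⟩
      2 * count (λ q → S τ (U q)) ≡⟨ cong (2 *_) (trans (total τ) e) ⟩
      2 * (a + b) ≤⟨ *-monoʳ-≤ 2 (+-monoʳ-≤ a le) ⟩
      2 * (a + (a + δ)) ≡⟨ lem₂ a δ ⟩
      2 * (2 * a) + 2 * δ ∎))
      where
      open ≤-Reasoning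
      lem₁ : ∀ m s d → 2 * (m + s) + 2 * d ≡ m + m + 2 * (s + d)
      lem₁ = solve-∀
      lem₂ : ∀ a d → 2 * (a + (a + d)) ≡ 2 * (2 * a) + 2 * d
      lem₂ = solve-∀
    half-fair : ∀ b → Fair S (half b) s
    half-fair true τ = from τ (c true τ) (c false τ) refl (le₂ τ)
    half-fair false τ = from τ (c false τ) (c true τ) (+-comm (c true τ) (c false τ)) (le₁ τ)
    index : Bool → Fin m → Fin (m + m)
    index true i = pick (ε i) (i ↑ˡ m) (m ↑ʳ i)
    index false i = pick (ε i) (m ↑ʳ i) (i ↑ˡ m)
    half≡ : ∀ b i → half b i ≡ U (index b i)
    half≡ true i = sym (pick-flip′ (ε i))
      where
      pick-flip′ : ∀ c → U (pick c (i ↑ˡ m) (m ↑ʳ i)) ≡ pick c (L i) (R i)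
      pick-flip′ true = refl
      pick-flip′ false = refl
    half≡ false i = sym (pick-flip′ (ε i))
      where
      pick-flip′ : ∀ c → U (pick c (m ↑ʳ i) (i ↑ˡ m)) ≡ pick c (R i) (L i)
      pick-flip′ true = refl
      pick-flip′ false = refl
    side : Bool → Fin m → Bool
    side true i = ε i
    side false i = not (ε i)
    index≡ : ∀ b i → index b i ≡ pick (side b i) (i ↑ˡ m) (m ↑ʳ i)
    index≡ true i = refl
    index≡ false i = flip (ε i)
      where
      flip : ∀ c {a b : Fin (m + m)} → pick c b a ≡ pick (not c) a b
      flip true = refl
      flip false = refl
    same : ∀ b c i j → pick b (i ↑ˡ m) (m ↑ʳ i) ≡ pick c (j ↑ˡ m) (m ↑ʳ j) → (b ≡ c) × (i ≡ j)
    same true true i j e = refl , ↑ˡ-injective m i j e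
    same false false i j e = refl , ↑ʳ-injective m i j e
    same true false i j e = ⊥-elim (↑ˡ≢↑ʳ i j e)
    same false true i j e = ⊥-elim (↑ˡ≢↑ʳ j i (sym e))
    side-injective : ∀ b b′ i → side b i ≡ side b′ i → b ≡ b′
    side-injective true true i e = refl
    side-injective false false i e = refl
    side-injective true false i e = ⊥-elim (not-¬ refl e)
    side-injective false true i e = ⊥-elim (not-¬ refl (sym e))
    half-injective : ∀ b i b′ i′ → half b i ≡ half b′ i′ → (b ≡ b′) × (i ≡ i′)
    half-injective b i b′ i′ e = go (same _ _ i i′ (trans (sym (index≡ b i)) (trans
        (inj _ _ (trans (sym (half≡ b i)) (trans e (half≡ b′ i′)))) (index≡ b′ i′))))
      where
      go : (side b i ≡ side b′ i′) × (i ≡ i′) → (b ≡ b′) × (i ≡ i′)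
      go (e , refl) = side-injective b b′ i e , refl
    half-⊆ : ∀ b i → ∃ λ x → half b i ≡ U x
    half-⊆ b i = index b i , half≡ b i

record Parts (S : Fin N → Fin n → Bool) (U : Fin m → Fin n) (k u : ℕ) : Set where
  field
    part : Fin k → Fin u → Fin n
    part-fair : ∀ c → Fair S (part c) 0
    part-injective : ∀ c q c′ q′ → part c q ≡ part c′ q′ → (c ≡ c′) × (q ≡ q′)
    part-⊆ : ∀ c q → ∃ λ x → part c q ≡ U x

-- One `y` and one δ serve all levels: `discrepancy` asks only for an upper bound on the number of
-- pairs, which stays valid as the sets shrink.
splitParts : ∀ θ′ y j u (S : Fin N → Fin n → Bool) (U : Fin (dbl j u) → Fin n) →
  dbl j u ≤ 8 * suc θ′ * suc θ′ * y → N + N < 2 ^ y →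
  Injective₁ U → Fair S U (slack (8 * suc θ′ * y) j) → Parts S U (2 ^ j) u
splitParts θ′ y zero u S U m≤ N< inj fair = record
  { part = λ _ → U ; part-fair = λ _ → fair
  ; part-injective = λ { zero q zero q′ e → refl , inj q q′ e } ; part-⊆ = λ _ q → q , refl }
splitParts {N} {n} θ′ y (suc j) u S U m≤ N< inj fair =
  glue (halve θ′ y S U (slack (8 * suc θ′ * y) j) half≤ N< inj fair)
  where
  half≤ : dbl j u ≤ 8 * suc θ′ * suc θ′ * y
  half≤ = ≤-trans (m≤m+n _ _) m≤
  K = 2 ^ j
  bit : Fin 2 → Bool
  bit zero = true
  bit (suc zero) = false
  bit-injective : ∀ a b → bit a ≡ bit b → a ≡ b
  bit-injective zero zero e = refl
  bit-injective (suc zero) (suc zero) e = refl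
  bit-injective zero (suc zero) ()
  bit-injective (suc zero) zero ()
  glue : Halves S U (slack (8 * suc θ′ * y) j) → Parts S U (2 * K) u
  glue H = record { part = λ c → part₂ (remQuot {2} K c)
                  ; part-fair = λ c → Parts.part-fair (rec (bit (proj₁ (remQuot {2} K c)))) (proj₂ (remQuot {2} K c))
                  ; part-injective = injective ; part-⊆ = λ c q → subset (remQuot {2} K c) q }
    where
    open Halves H
    rec : ∀ b → Parts S (half b) K u
    rec b = splitParts θ′ y j u S (half b) half≤ N< (λ i i′ e → proj₂ (half-injective b i b i′ e)) (half-fair b)
    part₂ : Fin 2 × Fin K → Fin u → Fin n
    part₂ (b , c) = Parts.part (rec (bit b)) c
    subset : ∀ p q → ∃ λ x → part₂ p q ≡ U x
    subset (b , c) q = let (x , e) = Parts.part-⊆ (rec (bit b)) c q ; (z , e′) = half-⊆ (bit b) x in z , trans e e′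
    injective₂ : ∀ p q p′ q′ → part₂ p q ≡ part₂ p′ q′ → (p ≡ p′) × (q ≡ q′)
    injective₂ (b , c) q (b′ , c′) q′ e = go (bit-injective b b′ (proj₁ (half-injective (bit b) x (bit b′) x′ (trans (sym ex) (trans e ex′))))) 
      where
      x = proj₁ (Parts.part-⊆ (rec (bit b)) c q)
      ex = proj₂ (Parts.part-⊆ (rec (bit b)) c q)
      x′ = proj₁ (Parts.part-⊆ (rec (bit b′)) c′ q′)
      ex′ = proj₂ (Parts.part-⊆ (rec (bit b′)) c′ q′)
      go : b ≡ b′ → ((b , c) ≡ (b′ , c′)) × (q ≡ q′)
      go refl = let (e₁ , e₂) = Parts.part-injective (rec (bit b)) c q c′ q′ e in cong (b ,_) e₁ , e₂
    injective : ∀ c q c′ q′ → part₂ (remQuot {2} K c) q ≡ part₂ (remQuot {2} K c′) q′ → (c ≡ c′) × (q ≡ q′)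
    injective c q c′ q′ e = let (e₁ , e₂) = injective₂ (remQuot {2} K c) q (remQuot {2} K c′) q′ e in
      trans (sym (combine-remQuot {2} K c)) (trans (cong (λ p → combine (proj₁ p) (proj₂ p)) e₁) (combine-remQuot {2} K c′)) , e₂

-- Absorbers

record Enumeration (P : Fin n → Bool) : Set where
  field
    enum : Fin (count P) → Fin n
    enum-∈ : ∀ q → P (enum q) ≡ true
    enum-injective : Injective₁ enum
    enum-surjective : ∀ x → P x ≡ true → ∃ λ q → enum q ≡ x

enumerate : (P : Fin n → Bool) → Enumeration P
enumerate P = record { enum = λ q → proj₁ (s q) ; enum-∈ = λ q → proj₁ (proj₂ (s q))
  ; enum-injective = λ q q′ e → toℕ-injective (trans (sym (proj₂ (proj₂ (s q)))) (trans (cong (rankIn P) e) (proj₂ (proj₂ (s q′)))))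
  ; enum-surjective = λ x Px → fromℕ< (rankIn<count P x Px) , rankIn-injective P _ x (proj₁ (proj₂ (s _))) Px
      (trans (proj₂ (proj₂ (s _))) (toℕ-fromℕ< (rankIn<count P x Px))) }
  where
  s : ∀ q → ∃ λ x → (P x ≡ true) × (rankIn P x ≡ toℕ q)
  s q = select P (toℕ q) (toℕ<n q)

-- Averaging over `y`: each test of positive weight accepts a 1/e share of all `y`, so some `y`
-- keeps a 1/e share of the weight. A test accepting this `y` is returned as well, as a certificate
-- that `y` is unoccupied and adjacent to what it must be adjacent to.
weightedPick : ∀ {n′} (e : ℕ) (w : Fin N → ℕ) (acc : Fin N → Fin (suc n′) → Bool) → 0 < sum w →
  (∀ τ → 0 < w τ → suc n′ ≤ e * count (acc τ)) →
  ∃ λ y → (∃ λ τ → acc τ y ≡ true) × (sum w ≤ e * sum (λ τ → w τ * 𝟙 (acc τ y)))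
weightedPick {N} {n′} e w acc w>0 h = finish (average-max F)
  where
  F : Fin (suc n′) → ℕ
  F y = sum (λ τ → w τ * 𝟙 (acc τ y))
  total : suc n′ * sum w ≤ e * sum F
  total = begin
    suc n′ * sum w ≡⟨ sym (sum-*ˡ (suc n′) w) ⟩
    sum (λ τ → suc n′ * w τ) ≤⟨ sum-mono (λ τ → each τ (w τ) refl) ⟩
    sum (λ τ → e * (w τ * count (acc τ))) ≡⟨ sum-*ˡ e (λ τ → w τ * count (acc τ)) ⟩
    e * sum (λ τ → w τ * count (acc τ)) ≡⟨ cong (e *_) (sum-cong-≗ λ τ → sym (sum-*ˡ (w τ) (λ y → 𝟙 (acc τ y)))) ⟩
    e * sum (λ τ → sum (λ y → w τ * 𝟙 (acc τ y))) ≡⟨ cong (e *_) (∑-comm (λ τ y → w τ * 𝟙 (acc τ y))) ⟩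
    e * sum F ∎
    where
    open ≤-Reasoning
    each : ∀ τ x → w τ ≡ x → suc n′ * x ≤ e * (x * count (acc τ))
    each τ zero _ = ≤-trans (≤-reflexive (*-zeroʳ (suc n′))) z≤n
    each τ (suc x) eq = ≤-trans (*-monoˡ-≤ (suc x) (h τ (subst (0 <_) (sym eq) (s≤s z≤n))))
      (≤-reflexive (lem e (count (acc τ)) (suc x)))
      where
      lem : ∀ e c x → e * c * x ≡ e * (x * c)
      lem = solve-∀
  finish : (∃ λ y → sum F ≤ suc n′ * F y) → _
  finish (y , avg) = y , found (sum>0⇒∃ _ F>0) , le
    where
    le : sum w ≤ e * F y
    le = *-cancelˡ-≤ (suc n′) (≤-trans total (≤-trans (*-monoʳ-≤ e avg) (≤-reflexive (lem e (suc n′) (F y)))))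
      where
      lem : ∀ e n f → e * (n * f) ≡ n * (e * f)
      lem = solve-∀
    F>0 : 0 < F y
    F>0 = n≢0⇒n>0 λ z → <⇒≱ w>0 (≤-trans le (≤-reflexive (trans (cong (e *_) z) (*-zeroʳ e))))
    found : (∃ λ τ → 0 < w τ * 𝟙 (acc τ y)) → ∃ λ τ → acc τ y ≡ true
    found (τ , p) = τ , ¬false⇒true λ eq → <-irrefl (sym (trans (cong (λ b → w τ * 𝟙 b) eq) (*-zeroʳ (w τ)))) p
      where
      ¬false⇒true : ∀ {b} → ¬ (b ≡ false) → b ≡ true
      ¬false⇒true {true} _ = refl
      ¬false⇒true {false} q = ⊥-elim (q refl)

count-update : (P Q : Fin n → Bool) (i : Fin n) (b : Bool) → P i ≡ false → Q i ≡ b →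
  (∀ j → j ≢ i → Q j ≡ P j) → count Q ≡ count P + 𝟙 b
count-update P Q i b Pi Qi other = trans (sum-cong-≗ eq) (trans (∑-distrib-+ (λ j → 𝟙 (P j)) (λ j → 𝟙 b * 𝟙 (i == j)))
  (cong (count P +_) (trans (sum-*ˡ (𝟙 b) (λ j → 𝟙 (i == j))) (trans (cong (𝟙 b *_) (count-single i)) (*-identityʳ (𝟙 b))))))
  where
  eq : ∀ j → 𝟙 (Q j) ≡ 𝟙 (P j) + 𝟙 b * 𝟙 (i == j)
  eq j with i ≟ j
  ... | yes refl = trans (cong 𝟙 Qi) (sym (cong₂ _+_ (cong 𝟙 Pi) (trans (cong (λ c → 𝟙 b * 𝟙 c) (==-refl i)) (*-identityʳ (𝟙 b)))))
  ... | no i≢j = trans (cong 𝟙 (other j (i≢j ∘ sym))) (sym (trans (cong (λ c → 𝟙 (P j) + 𝟙 b * 𝟙 c) (≢⇒==false i≢j))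
        (trans (cong (𝟙 (P j) +_) (*-zeroʳ (𝟙 b))) (+-identityʳ (𝟙 (P j))))))

module Host {n′ : ℕ} (E : Bool → Fin (suc n′) → Fin (suc n′) → Bool) (g e : ℕ)
  (deg : ∀ s a → suc n′ + 2 * g ≤ 2 * count (E s a)) (n≤eg : suc n′ ≤ e * g) where

  V : Set
  V = Fin (suc n′)

  fits : Permutation′ (suc n′) → (V → Bool) → Bool → V → Bool → V → V → Bool
  fits f P s a s′ a′ y = (E s a y ∧ E s′ a′ y) ∧ not (P (f ⟨$⟩ˡ y))

  -- Two neighbourhoods of size at least n/2 + g meet in at least 2g vertices, of which images of P
  -- occupy at most g.
  fits-many : ∀ f P s a s′ a′ → count P ≤ g → g ≤ count (fits f P s a s′ a′)
  fits-many f P s a s′ a′ small = +-cancelʳ-≤ g g _ (begin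
    g + g ≡⟨ cong (g +_) (sym (+-identityʳ g)) ⟩
    2 * g ≤⟨ common (count (E s a)) (count (E s′ a′)) _ (deg s a) (deg s′ a′) (count-∧+n (E s a) (E s′ a′)) ⟩
    count (λ y → E s a y ∧ E s′ a′ y) ≤⟨ count-∧not (λ y → E s a y ∧ E s′ a′ y) (λ y → P (f ⟨$⟩ˡ y)) ⟩
    count (fits f P s a s′ a′) + count (λ y → P (f ⟨$⟩ˡ y)) ≤⟨ +-monoʳ-≤ _ (≤-trans (≤-reflexive (count-permute (Data.Fin.Permutation.flip f) P)) small) ⟩
    count (fits f P s a s′ a′) + g ∎)
    where
    open ≤-Reasoning
    common : ∀ a b c → suc n′ + 2 * g ≤ 2 * a → suc n′ + 2 * g ≤ 2 * b → a + b ≤ suc n′ + c → 2 * g ≤ c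
    common a b c p q r = *-cancelˡ-≤ 2 (+-cancelˡ-≤ (2 * suc n′) (2 * (2 * g)) (2 * c) (begin
      2 * suc n′ + 2 * (2 * g) ≡⟨ lem (suc n′) g ⟩
      (suc n′ + 2 * g) + (suc n′ + 2 * g) ≤⟨ +-mono-≤ p q ⟩
      2 * a + 2 * b ≡⟨ sym (*-distribˡ-+ 2 a b) ⟩
      2 * (a + b) ≤⟨ *-monoʳ-≤ 2 r ⟩
      2 * (suc n′ + c) ≡⟨ *-distribˡ-+ 2 (suc n′) c ⟩
      2 * suc n′ + 2 * c ∎))
      where
      lem : ∀ n g → 2 * n + 2 * (2 * g) ≡ (n + 2 * g) + (n + 2 * g)
      lem = solve-∀

  fits-split : ∀ f P s a s′ a′ {y} → fits f P s a s′ a′ y ≡ true →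
    (E s a y ≡ true) × (E s′ a′ y ≡ true) × (P (f ⟨$⟩ˡ y) ≡ false)
  fits-split f P s a s′ a′ {y} p with ∧-split {E s a y ∧ E s′ a′ y} p
  ... | q , r with ∧-split {E s a y} q
  ... | q₁ , q₂ = q₁ , q₂ , not-true r

  unused : ∀ (f : Permutation′ (suc n′)) (P : V → Bool) {y x} → P (f ⟨$⟩ˡ y) ≡ false → P x ≡ true → f ⟨$⟩ʳ x ≢ y
  unused f P out Px e = true≢false Px (trans (cong P (trans (sym (inverseˡ f)) (cong (f ⟨$⟩ˡ_) e))) out)

  record Test : Set where
    constructor test
    field
      s s′ : Bool
      a a′ w : V

  -- The star at t with leaves vs absorbs the test: f t fits between a and a′, and w can replace f t.
  Covers : ∀ {c} → Permutation′ (suc n′) → V → (Fin c → V) → (Fin c → Bool) → Test → ℕ → Set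
  Covers {c} f t vs sg (test s s′ a a′ w) k = (E s a (f ⟨$⟩ʳ t) ≡ true) × (E s′ a′ (f ⟨$⟩ʳ t) ≡ true) ×
    (∀ (q : Fin c) → toℕ q < k → E (sg q) w (f ⟨$⟩ʳ vs q) ≡ true)

  module OneStar {N} (tests : Fin N → Test) (w : Fin N → ℕ) (w>0 : 0 < sum w)
    (S : V → Bool) (S≤g : count S ≤ g)
    {c} (t : V) (vs : Fin c → V) (sg : Fin c → Bool) (vs-injective : Injective₁ vs) (t∉vs : ∀ q → vs q ≢ t)
    (t∈S : S t ≡ true) (vs∈S : ∀ q → S (vs q) ≡ true)
    (f₀ : Permutation′ (suc n′)) (P₀ : V → Bool) (P₀⊆S : ∀ x → P₀ x ≡ true → S x ≡ true)
    (t∉P₀ : P₀ t ≡ false) (vs∉P₀ : ∀ q → P₀ (vs q) ≡ false) where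

    record State (k : ℕ) : Set where
      field
        f : Permutation′ (suc n′)
        P : V → Bool
        alive : Fin N → Bool
        agree : ∀ x → P₀ x ≡ true → f ⟨$⟩ʳ x ≡ f₀ ⟨$⟩ʳ x
        P-elim : ∀ x → P x ≡ true → (P₀ x ≡ true) ⊎ (x ≡ t) ⊎ (∃ λ q → (toℕ q < k) × (x ≡ vs q))
        P-base : ∀ x → P₀ x ≡ true → P x ≡ true
        P-centre : P t ≡ true
        P-leaf : ∀ q → toℕ q < k → P (vs q) ≡ true
        edges : ∀ q → toℕ q < k → E (sg q) (f ⟨$⟩ʳ t) (f ⟨$⟩ʳ vs q) ≡ true
        covers : ∀ τ → alive τ ≡ true → Covers f t vs sg (tests τ) k
        -- The choice of the centre and of each of the `k` leaves costs a factor e.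
        weight : sum w ≤ e ^ suc k * sum (λ τ → w τ * 𝟙 (alive τ))

    private
      e*count : ∀ f P → (∀ x → P x ≡ true → S x ≡ true) → ∀ s a s′ a′ → suc n′ ≤ e * count (fits f P s a s′ a′)
      e*count f P P⊆S s a s′ a′ = ≤-trans n≤eg (*-monoʳ-≤ e (fits-many f P s a s′ a′ (≤-trans (count-mono P⊆S) S≤g)))

      start : State 0
      start = go (weightedPick e w (λ τ → let open Test (tests τ) in fits f₀ P₀ s a s′ a′) w>0
                   (λ τ _ → e*count f₀ P₀ P₀⊆S _ _ _ _))
        where
        acc : Fin N → V → Bool
        acc τ = let open Test (tests τ) in fits f₀ P₀ s a s′ a′
        go : (∃ λ y → (∃ λ τ → acc τ y ≡ true) × (sum w ≤ e * sum (λ τ → w τ * 𝟙 (acc τ y)))) → State 0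
        go (y , (τ₀ , ok) , le) = record
          { f = f ; P = λ x → P₀ x ∨ (x == t) ; alive = λ τ → acc τ y
          ; agree = agree
          ; P-elim = λ x h → [ inj₁ , (λ h′ → inj₂ (inj₁ (==⇒≡ h′))) ]′ (∨-split {P₀ x} h)
          ; P-base = λ x → ∨-inl
          ; P-centre = ∨-inr {P₀ t} (==-refl t)
          ; P-leaf = λ _ ()
          ; edges = λ _ ()
          ; covers = λ τ h → let (p , q , _) = fits-split f₀ P₀ (Test.s (tests τ)) (Test.a (tests τ)) (Test.s′ (tests τ)) (Test.a′ (tests τ)) h in
              trans (cong (E _ _) (assign-at t y f₀)) p , trans (cong (E _ _) (assign-at t y f₀)) q , λ _ ()
          ; weight = ≤-trans le (≤-reflexive (cong (_* sum (λ τ → w τ * 𝟙 (acc τ y))) (sym (*-identityʳ e)))) }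
          where
          f = assign t y f₀
          out : P₀ (f₀ ⟨$⟩ˡ y) ≡ false
          out = proj₂ (proj₂ (fits-split f₀ P₀ (Test.s (tests τ₀)) (Test.a (tests τ₀)) (Test.s′ (tests τ₀)) (Test.a′ (tests τ₀)) ok))
          agree : ∀ x → P₀ x ≡ true → f ⟨$⟩ʳ x ≡ f₀ ⟨$⟩ʳ x
          agree x Px = assign-other t y f₀ (λ { refl → true≢false Px t∉P₀ }) (unused f₀ P₀ out Px)

      step : ∀ (i : Fin c) → State (toℕ i) → State (suc (toℕ i))
      step i st = go (weightedPick e w₁ acc w₁>0 (λ τ _ → e*count f P P⊆S _ _ _ _))
        where
        open State st
        w₁ : Fin N → ℕ
        w₁ τ = w τ * 𝟙 (alive τ)
        w₁>0 : 0 < sum w₁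
        w₁>0 = n≢0⇒n>0 λ z → <⇒≱ w>0 (≤-trans weight (≤-reflexive (trans (cong (e ^ suc (toℕ i) *_) z) (*-zeroʳ (e ^ suc (toℕ i))))))
        P⊆S : ∀ x → P x ≡ true → S x ≡ true
        P⊆S x h = [ P₀⊆S x , [ (λ { refl → t∈S }) , (λ { (q , _ , refl) → vs∈S q }) ]′ ]′ (P-elim x h)
        -- The image of a leaf must be adjacent to the image of the centre now and, with the same
        -- orientation, to `w` after an exchange.
        acc : Fin N → V → Bool
        acc τ = fits f P (sg i) (f ⟨$⟩ʳ t) (sg i) (Test.w (tests τ))
        v = vs i
        v∉P : P v ≡ false
        v∉P = ¬true⇒false λ h → [ (λ h → true≢false h (vs∉P₀ i)) , [ t∉vs i ,
          (λ { (q , q< , e) → <-irrefl (cong toℕ (sym (vs-injective _ _ e))) q< }) ]′ ]′ (P-elim v h)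
        go : (∃ λ y → (∃ λ τ → acc τ y ≡ true) × (sum w₁ ≤ e * sum (λ τ → w₁ τ * 𝟙 (acc τ y)))) → State (suc (toℕ i))
        go (y , (τ₀ , ok) , le) = record
          { f = f₁ ; P = λ x → P x ∨ (x == v) ; alive = λ τ → alive τ ∧ acc τ y
          ; agree = λ x h → trans (agree₁ x (P-base x h)) (agree x h)
          ; P-elim = λ x h → [ (λ h → [ inj₁ , [ inj₂ ∘ inj₁ , (λ { (q , q< , e) → inj₂ (inj₂ (q , m≤n⇒m≤1+n q< , e)) }) ]′ ]′ (P-elim x h))
                             , (λ h → inj₂ (inj₂ (i , ≤-refl , ==⇒≡ h))) ]′ (∨-split {P x} h)
          ; P-base = λ x h → ∨-inl (P-base x h)
          ; P-centre = ∨-inl P-centre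
          ; P-leaf = λ q q< → [ (λ q< → ∨-inl (P-leaf q q<)) , (λ q≡i → ∨-inr {P (vs q)} (subst (λ j → (vs j == v) ≡ true) (sym (toℕ-injective q≡i)) (==-refl v))) ]′ (m≤n⇒m<n∨m≡n (≤-pred q<))
          ; edges = λ q q< → [ (λ q< → trans (cong₂ (E (sg q)) f₁t (agree₁ (vs q) (P-leaf q q<))) (edges q q<))
                             , (λ q≡i → subst (λ j → E (sg j) (f₁ ⟨$⟩ʳ t) (f₁ ⟨$⟩ʳ vs j) ≡ true) (sym (toℕ-injective q≡i))
                                  (trans (cong₂ (E (sg i)) f₁t (assign-at v y f)) edge)) ]′ (m≤n⇒m<n∨m≡n (≤-pred q<))
          ; covers = covers₁
          ; weight = ≤-trans weight (≤-trans (*-monoʳ-≤ (e ^ suc (toℕ i)) (≤-trans le (≤-reflexive (cong (e *_)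
              (sum-cong-≗ λ τ → trans (*-assoc (w τ) (𝟙 (alive τ)) _) (cong (w τ *_) (𝟙-* (alive τ) (acc τ y))))))))
              (≤-reflexive (lem (e ^ suc (toℕ i)) e (sum (λ τ → w τ * 𝟙 (alive τ ∧ acc τ y)))))) }
          where
          lem : ∀ p e s → p * (e * s) ≡ e * p * s
          lem = solve-∀
          f₁ = assign v y f
          split₀ = fits-split f P (sg i) (f ⟨$⟩ʳ t) (sg i) (Test.w (tests τ₀)) ok
          edge : E (sg i) (f ⟨$⟩ʳ t) y ≡ true
          edge = proj₁ split₀
          agree₁ : ∀ x → P x ≡ true → f₁ ⟨$⟩ʳ x ≡ f ⟨$⟩ʳ x
          agree₁ x Px = assign-other v y f (λ { refl → true≢false Px v∉P }) (unused f P (proj₂ (proj₂ split₀)) Px)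
          f₁t : f₁ ⟨$⟩ʳ t ≡ f ⟨$⟩ʳ t
          f₁t = agree₁ t P-centre
          covers₁ : ∀ τ → alive τ ∧ acc τ y ≡ true → Covers f₁ t vs sg (tests τ) (suc (toℕ i))
          covers₁ τ h = let (al , ac) = ∧-split {alive τ} h
                            (p₁ , p₂ , p₃) = covers τ al
                            (_ , wy , _) = fits-split f P (sg i) (f ⟨$⟩ʳ t) (sg i) (Test.w (tests τ)) ac in
            trans (cong (E _ _) f₁t) p₁ , trans (cong (E _ _) f₁t) p₂ , λ q q< →
              [ (λ q< → trans (cong (E (sg q) _) (agree₁ (vs q) (P-leaf q q<))) (p₃ q q<))
              , (λ q≡i → subst (λ j → E (sg j) (Test.w (tests τ)) (f₁ ⟨$⟩ʳ vs j) ≡ true) (sym (toℕ-injective q≡i))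
                   (trans (cong (E (sg i) _) (assign-at v y f)) wy)) ]′ (m≤n⇒m<n∨m≡n (≤-pred q<))

    opaque
      star : State c
      star = finLoop State start step

module Stars {n′ : ℕ} (E : Bool → Fin (suc n′) → Fin (suc n′) → Bool) (g e : ℕ)
  (deg : ∀ s a → suc n′ + 2 * g ≤ 2 * count (E s a)) (n≤eg : suc n′ ≤ e * g)
  {N} (tests : Fin N → Host.Test E g e deg n≤eg) (τ₀ : Fin N)
  (S : Fin (suc n′) → Bool) (S≤g : count S ≤ g)
  (D X : ℕ) (X≡ : suc X ≡ e ^ suc D + e ^ suc D)
  {s} (ts : Fin s → Fin (suc n′)) (cn : Fin s → ℕ) (cn≤D : ∀ q → cn q ≤ D)
  (leaf : ∀ q → Fin (cn q) → Fin (suc n′)) (sg : ∀ q → Fin (cn q) → Bool)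
  (leaf-injective : ∀ q → Injective₁ (leaf q)) (centre≢leaf : ∀ q r → leaf q r ≢ ts q)
  (ts∈S : ∀ q → S (ts q) ≡ true) (leaf∈S : ∀ q r → S (leaf q r) ≡ true) where

  open Host E g e deg n≤eg

  Member : Fin s → V → Set
  Member q x = (x ≡ ts q) ⊎ (∃ λ r → x ≡ leaf q r)

  module _ (disjoint : ∀ q q′ x → Member q x → Member q′ x → q ≡ q′) where

    member∈S : ∀ q x → Member q x → S x ≡ true
    member∈S q x (inj₁ refl) = ts∈S q
    member∈S q x (inj₂ (r , refl)) = leaf∈S q r

    hits : (Fin s → Fin N → Bool) → Fin N → ℕ
    hits good τ = count (λ q → good q τ)

    -- A test doubles its weight whenever a star misses it, so `weight` reads off its number of
    -- hits. Each star covers at least a 1/B share of the weight, B = e^(D+1), so the total grows by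
    -- a factor of at most 2 - 1/B = X/B.
    record AllStars (k : ℕ) : Set where
      field
        f : Permutation′ (suc n′)
        P : V → Bool
        good : Fin s → Fin N → Bool
        w : Fin N → ℕ
        P-elim : ∀ x → P x ≡ true → ∃ λ q → (toℕ q < k) × Member q x
        P-intro : ∀ x q → toℕ q < k → Member q x → P x ≡ true
        edges : ∀ q r → toℕ q < k → E (sg q r) (f ⟨$⟩ʳ ts q) (f ⟨$⟩ʳ leaf q r) ≡ true
        covers : ∀ q τ → toℕ q < k → good q τ ≡ true → Covers f (ts q) (leaf q) (sg q) (tests τ) (cn q)
        fresh : ∀ q τ → k ≤ toℕ q → good q τ ≡ false
        weight : ∀ τ → w τ * 2 ^ hits good τ ≡ 2 ^ k
        total : (e ^ suc D) ^ k * sum w ≤ X ^ k * N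

    private
      start : AllStars 0
      start = record
        { f = Data.Fin.Permutation.id ; P = λ _ → false ; good = λ _ _ → false ; w = λ _ → 1
        ; P-elim = λ _ () ; P-intro = λ _ _ () ; edges = λ _ _ () ; covers = λ _ _ ()
        ; fresh = λ _ _ _ → refl
        ; weight = λ τ → cong (λ h → 1 * 2 ^ h) (count-false (λ (_ : Fin s) → false) (λ _ → refl))
        ; total = ≤-reflexive (cong (1 *_) (trans (sum-const N 1) (*-identityʳ N))) }

      e≥1 : 1 ≤ e
      e≥1 = n≢0⇒n>0 λ { refl → case n≤eg of λ () }

      step : ∀ (i : Fin s) → AllStars (toℕ i) → AllStars (suc (toℕ i))
      step i st = go (St.star)
        where
        open AllStars st
        w>0 : 0 < sum w
        w>0 = ≤-trans (n≢0⇒n>0 λ z → <-irrefl (trans (cong (_* 2 ^ hits good τ₀) (sym z)) (weight τ₀)) (m^n>0 2 (toℕ i)))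
                (term≤sum w τ₀)
        new : ∀ x → Member i x → P x ≡ false
        new x mx = ¬true⇒false λ h → let (q , q< , mq) = P-elim x h in <-irrefl (cong toℕ (disjoint q i x mq mx)) q<
        P⊆S : ∀ x → P x ≡ true → S x ≡ true
        P⊆S x h = let (q , _ , mq) = P-elim x h in member∈S q x mq
        module St = OneStar tests w w>0 S S≤g (ts i) (leaf i) (sg i) (leaf-injective i) (centre≢leaf i) (ts∈S i) (leaf∈S i)
          f P P⊆S (new _ (inj₁ refl)) (λ r → new _ (inj₂ (r , refl)))
        go : St.State (cn i) → AllStars (suc (toℕ i))
        go st′ = record
          { f = f₁ ; P = St.State.P st′ ; good = good₁ ; w = w₁
          ; P-elim = λ x h → [ (λ h → let (q , q< , mq) = P-elim x h in q , m≤n⇒m≤1+n q< , mq)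
                             , [ (λ x≡ → i , ≤-refl , inj₁ x≡) , (λ { (r , _ , x≡) → i , ≤-refl , inj₂ (r , x≡) }) ]′ ]′ (St.State.P-elim st′ x h)
          ; P-intro = λ x q q< mq → old-or-new q q< (λ q< → St.State.P-base st′ x (P-intro x q q< mq))
              (λ { refl → [ (λ { refl → St.State.P-centre st′ }) , (λ { (r , refl) → St.State.P-leaf st′ r (toℕ<n r) }) ]′ mq })
          ; edges = λ q r q< → old-or-new q q<
              (λ q< → trans (cong₂ (E (sg q r)) (keep (ts q) (P-intro _ q q< (inj₁ refl))) (keep (leaf q r) (P-intro _ q q< (inj₂ (r , refl))))) (edges q r q<))
              (λ { refl → St.State.edges st′ r (toℕ<n r) })
          ; covers = λ q τ q< → old-or-new q q< (λ q< h → carry q q< (tests τ) (covers q τ q< (trans (sym (good-old q τ (<⇒≢ q< ∘ cong toℕ))) h)))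
              (λ { refl h → St.State.covers st′ τ (trans (sym (good-new τ)) h) })
          ; fresh = λ q τ i<q → trans (good-old q τ (λ { refl → <-irrefl refl i<q })) (fresh q τ (<⇒≤ i<q))
          ; weight = weight₁
          ; total = total₁ }
          where
          f₁ = St.State.f st′
          alive = St.State.alive st′
          keep : ∀ x → P x ≡ true → f₁ ⟨$⟩ʳ x ≡ f ⟨$⟩ʳ x
          keep = St.State.agree st′
          old-or-new : ∀ {A : Set} (q : Fin s) → toℕ q < suc (toℕ i) → (toℕ q < toℕ i → A) → (q ≡ i → A) → A
          old-or-new q q< a b = [ a , b ∘ toℕ-injective ]′ (m≤n⇒m<n∨m≡n (≤-pred q<))
          good₁ : Fin s → Fin N → Bool
          good₁ q τ = if q == i then alive τ else good q τ
          good-new : ∀ τ → good₁ i τ ≡ alive τ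
          good-new τ = cong (λ b → if b then alive τ else good i τ) (==-refl i)
          good-old : ∀ q τ → q ≢ i → good₁ q τ ≡ good q τ
          good-old q τ q≢i = cong (λ b → if b then alive τ else good q τ) (≢⇒==false q≢i)
          carry : ∀ q → toℕ q < toℕ i → ∀ τ → Covers f (ts q) (leaf q) (sg q) τ (cn q) → Covers f₁ (ts q) (leaf q) (sg q) τ (cn q)
          carry q q< τ (p₁ , p₂ , p₃) = let kt = keep (ts q) (P-intro _ q q< (inj₁ refl)) in
            trans (cong (E _ _) kt) p₁ , trans (cong (E _ _) kt) p₂ ,
            λ r r< → trans (cong (E _ _) (keep (leaf q r) (P-intro _ q q< (inj₂ (r , refl))))) (p₃ r r<)
          w₁ : Fin N → ℕ
          w₁ τ = if alive τ then w τ else 2 * w τ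
          hits₁ : ∀ τ → hits good₁ τ ≡ hits good τ + 𝟙 (alive τ)
          hits₁ τ = count-update (λ q → good q τ) (λ q → good₁ q τ) i (alive τ) (fresh i τ ≤-refl) (good-new τ) (λ q q≢i → good-old q τ q≢i)
          weight₁ : ∀ τ → w₁ τ * 2 ^ hits good₁ τ ≡ 2 ^ suc (toℕ i)
          weight₁ τ = trans (cong (λ h → w₁ τ * 2 ^ h) (hits₁ τ)) (trans (by (alive τ) (w τ) (hits good τ)) (cong (2 *_) (weight τ)))
            where
            by : ∀ b w h → (if b then w else 2 * w) * 2 ^ (h + 𝟙 b) ≡ 2 * (w * 2 ^ h)
            by true w h = trans (cong (λ z → w * 2 ^ z) (+-comm h 1)) (lem w (2 ^ h))
              where
              lem : ∀ w p → w * (2 * p) ≡ 2 * (w * p)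
              lem = solve-∀
            by false w h = trans (cong (λ z → 2 * w * 2 ^ z) (+-identityʳ h)) (*-assoc 2 w (2 ^ h))
          B = e ^ suc D
          survivors = sum (λ τ → w τ * 𝟙 (alive τ))
          balance : sum w₁ + survivors ≡ 2 * sum w
          balance = trans (sym (∑-distrib-+ w₁ (λ τ → w τ * 𝟙 (alive τ)))) (trans (sum-cong-≗ (λ τ → by (alive τ) (w τ))) (sum-*ˡ 2 w))
            where
            by : ∀ b w → (if b then w else 2 * w) + w * 𝟙 b ≡ 2 * w
            by true w = cong (w +_) (*-comm w 1)
            by false w = trans (cong (2 * w +_) (*-zeroʳ w)) (+-identityʳ (2 * w))
          lost : sum w ≤ B * survivors
          lost = ≤-trans (St.State.weight st′) (*-monoˡ-≤ survivors (^-monoʳ-≤ e ⦃ >-nonZero e≥1 ⦄ (s≤s (cn≤D i))))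
          decrease : B * sum w₁ ≤ X * sum w
          decrease = +-cancelʳ-≤ (sum w) (B * sum w₁) (X * sum w) (begin
            B * sum w₁ + sum w ≤⟨ +-monoʳ-≤ (B * sum w₁) lost ⟩
            B * sum w₁ + B * survivors ≡⟨ sym (*-distribˡ-+ B (sum w₁) survivors) ⟩
            B * (sum w₁ + survivors) ≡⟨ cong (B *_) balance ⟩
            B * (2 * sum w) ≡⟨ lem B (sum w) ⟩
            (B + B) * sum w ≡⟨ cong (_* sum w) (sym X≡) ⟩
            suc X * sum w ≡⟨ +-comm (sum w) (X * sum w) ⟩
            X * sum w + sum w ∎)
            where
            open ≤-Reasoning
            lem : ∀ b w → b * (2 * w) ≡ (b + b) * w
            lem = solve-∀
          total₁ : B ^ suc (toℕ i) * sum w₁ ≤ X ^ suc (toℕ i) * N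
          total₁ = begin
            B * B ^ toℕ i * sum w₁ ≡⟨ lem B (B ^ toℕ i) (sum w₁) ⟩
            B ^ toℕ i * (B * sum w₁) ≤⟨ *-monoʳ-≤ (B ^ toℕ i) decrease ⟩
            B ^ toℕ i * (X * sum w) ≡⟨ lem′ (B ^ toℕ i) X (sum w) ⟩
            X * (B ^ toℕ i * sum w) ≤⟨ *-monoʳ-≤ X total ⟩
            X * (X ^ toℕ i * N) ≡⟨ sym (*-assoc X (X ^ toℕ i) N) ⟩
            X * X ^ toℕ i * N ∎
            where
            open ≤-Reasoning
            lem : ∀ b p w → b * p * w ≡ p * (b * w)
            lem = solve-∀
            lem′ : ∀ b p w → b * (p * w) ≡ p * (b * w)
            lem′ = solve-∀

    opaque
      allStars : AllStars s
      allStars = finLoop AllStars start step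

    -- With s stars and H hits, the weight 2^s/2^H is at most the total (X/B)^s N. As 2B = X + 1,
    -- this reads (1 + 1/X)^s ≤ 2^H N, and `growth` makes the left side at least 2^p.
    hits-many : ∀ p τ → X * p ≤ s → 2 ^ p ≤ 2 ^ hits (AllStars.good allStars) τ * N
    hits-many p τ Xp≤s = go X Xp≤s X≡ (AllStars.total allStars)
      where
      open ≤-Reasoning
      open AllStars allStars using (w; good; weight)
      B = e ^ suc D
      H = hits good τ
      B≥1 : 1 ≤ B
      B≥1 = m^n>0 e ⦃ >-nonZero e≥1 ⦄ (suc D)
      lem : ∀ w h b → w * h * b ≡ h * (b * w)
      lem = solve-∀
      lem′ : ∀ h x n → h * (x * n) ≡ h * n * x
      lem′ = solve-∀
      go : ∀ X → X * p ≤ s → suc X ≡ B + B → B ^ s * sum w ≤ X ^ s * N → 2 ^ p ≤ 2 ^ H * N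
      go zero _ eq _ = ⊥-elim (<-irrefl eq (+-mono-≤ B≥1 B≥1))
      go (suc X′) Xp≤s eq tot = *-cancelʳ-≤ (2 ^ p) (2 ^ H * N) (suc X′ ^ s) ⦃ m^n≢0 (suc X′) s ⦄ (begin
        2 ^ p * suc X′ ^ s ≤⟨ growth X′ p s Xp≤s ⟩
        suc (suc X′) ^ s ≡⟨ cong (_^ s) (trans eq (cong (B +_) (sym (+-identityʳ B)))) ⟩
        (2 * B) ^ s ≡⟨ ^-distribʳ-* s 2 B ⟩
        2 ^ s * B ^ s ≡⟨ cong (_* B ^ s) (sym (weight τ)) ⟩
        w τ * 2 ^ H * B ^ s ≡⟨ lem (w τ) (2 ^ H) (B ^ s) ⟩
        2 ^ H * (B ^ s * w τ) ≤⟨ *-monoʳ-≤ (2 ^ H) (*-monoʳ-≤ (B ^ s) (term≤sum w τ)) ⟩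
        2 ^ H * (B ^ s * sum w) ≤⟨ *-monoʳ-≤ (2 ^ H) tot ⟩
        2 ^ H * (suc X′ ^ s * N) ≡⟨ lem′ (2 ^ H) (suc X′ ^ s) N ⟩
        2 ^ H * N * suc X′ ^ s ∎)

-- Rooted trees and the decomposition to be embedded

-- Rooted oriented trees on Fin (suc n′): edge j joins suc j to its parent par j, which
-- has a smaller index; dir j tells whether the edge points away from the root.

record RTree (n′ Δ : ℕ) : Set where
  field
    par : Fin n′ → Fin (suc n′)
    dir : Fin n′ → Bool
    par≤ : ∀ j → toℕ (par j) ≤ toℕ j
    children≤ : ∀ v → count (λ j → par j == v) ≤ Δ

module Tree {n′ Δ : ℕ} (T : RTree n′ Δ) where
  open RTree T public

  par≢suc : ∀ j → par j ≢ suc j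
  par≢suc j e = <-irrefl (cong toℕ e) (s≤s (par≤ j))

  child : Fin (suc n′) → Fin (suc n′) → Bool
  child t zero = false
  child t (suc j) = par j == t

  nb : Fin (suc n′) → Fin (suc n′) → Bool
  nb t i = child t i ∨ child i t

  -- The orientation of the edge `t i` seen from `t`. An `i` that is not a child of `t` is taken for
  -- its parent; values at non-neighbours are arbitrary.
  sign : Fin (suc n′) → Fin (suc n′) → Bool
  sign t zero = towards t
    where
    towards : Fin (suc n′) → Bool
    towards zero = true
    towards (suc j) = not (dir j)
  sign t (suc j) = if par j == t then dir j else towards t
    where
    towards : Fin (suc n′) → Bool
    towards zero = true
    towards (suc j) = not (dir j)

  nb-down : ∀ j → nb (par j) (suc j) ≡ true
  nb-down j = ∨-inl (==-refl (par j))

  nb-up : ∀ j → nb (suc j) (par j) ≡ true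
  nb-up j = ∨-inr {child (suc j) (par j)} (==-refl (par j))

  sign-down : ∀ j → sign (par j) (suc j) ≡ dir j
  sign-down j rewrite ==-refl (par j) = refl

  sign-up : ∀ j → sign (suc j) (par j) ≡ not (dir j)
  sign-up j = go (par j) refl
    where
    go : ∀ p → par j ≡ p → sign (suc j) p ≡ not (dir j)
    go zero e = refl
    go (suc i) e = cong (λ b → if b then dir i else not (dir j)) (≢⇒==false λ e′ →
      <-irrefl refl (≤-trans (≤-trans (≤-reflexive (sym (cong toℕ e′))) (par≤ i)) (≤-trans (n≤1+n (toℕ i)) (≤-trans (≤-reflexive (sym (cong toℕ e))) (par≤ j)))))

  nb-elim : ∀ t i → nb t i ≡ true → (∃ λ j → (i ≡ suc j) × (par j ≡ t)) ⊎ (∃ λ j → (t ≡ suc j) × (par j ≡ i))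
  nb-elim t i h = [ (λ h → inj₁ (from t i h)) , (λ h → inj₂ (from i t h)) ]′ (∨-split {child t i} h)
    where
    from : ∀ t i → child t i ≡ true → ∃ λ j → (i ≡ suc j) × (par j ≡ t)
    from t (suc j) h = j , refl , ==⇒≡ h

  nb-irrefl : ∀ t → nb t t ≡ true → ⊥
  nb-irrefl t h = [ (λ { (j , refl , e) → par≢suc j e }) , (λ { (j , refl , e) → par≢suc j e }) ]′ (nb-elim t t h)

  count-child : ∀ t → count (child t) ≤ Δ
  count-child t = ≤-trans (≤-reflexive (sum-suc _)) (children≤ t)

  count-parents : ∀ t → count (λ i → child i t) ≤ 1
  count-parents zero = ≤-trans (≤-reflexive (count-false (λ (_ : Fin (suc n′)) → false) (λ _ → refl))) z≤n
  count-parents (suc j) = count-≤1 _ (λ i i′ p q → trans (sym (==⇒≡ p)) (==⇒≡ q))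

  count-nb : ∀ t → count (nb t) ≤ Δ + 1
  count-nb t = ≤-trans (count-∨ (child t) (λ i → child i t)) (+-mono-≤ (count-child t) (count-parents t))

  topOf : (Fin (suc n′) → Bool) → Fin (suc n′) → Bool
  topOf L zero = true
  topOf L (suc j) = L (par j)

-- The interface between tree and host. `one-child` and `S-child` ensure that a vertex placed late
-- has at most two placed neighbours that matter, its parent and one child. `S-edge` says that the
-- stars span only their own edges. `cls x q` is the vertex corresponding to `x` in the `q`-th
-- component of its group.
record Decomposition {n′ Δ : ℕ} (T : RTree n′ Δ) (u : ℕ) : Set where
  open Tree T
  field
    L A Cen : Fin (suc n′) → Bool
    A⇒¬L : ∀ x → A x ≡ true → L x ≡ false
    one-child : ∀ i j → par i ≡ par j → L (par i) ≡ true → L (suc i) ≡ false → L (suc j) ≡ false → i ≡ j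
    A-edge : ∀ j → L (par j) ≡ false → L (suc j) ≡ false → A (par j) ≡ A (suc j)
    Cen⇒A : ∀ t → Cen t ≡ true → A t ≡ true
    Cen-nb⇒A : ∀ t x → Cen t ≡ true → nb t x ≡ true → A x ≡ true

  InStar : Fin (suc n′) → Fin (suc n′) → Set
  InStar t x = (x ≡ t) ⊎ (nb t x ≡ true)

  S : Fin (suc n′) → Bool
  S x = Cen x ∨ ∃ᵇ (λ t → Cen t ∧ nb t x)

  top? : Fin (suc n′) → Bool
  top? = topOf L

  B : Fin (suc n′) → Set
  B x = (L x ≡ false) × (A x ≡ false)

  field
    star-disjoint : ∀ t t′ x → Cen t ≡ true → Cen t′ ≡ true → InStar t x → InStar t′ x → t ≡ t′
    S-edge : ∀ j → S (par j) ≡ true → S (suc j) ≡ true → (Cen (par j) ≡ true) ⊎ (Cen (suc j) ≡ true)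
    S-child : ∀ i j → par i ≡ par j → S (par i) ≡ false → S (suc i) ≡ true → S (suc j) ≡ true → i ≡ j
    cls : Fin (suc n′) → Fin u → Fin (suc n′)
    cls-self : ∀ x → B x → ∃ λ q → cls x q ≡ x
    cls-injective : ∀ x → B x → Injective₁ (cls x)
    cls-B : ∀ x q → B x → B (cls x q)
    cls-cls : ∀ x q q′ → B x → cls (cls x q) q′ ≡ cls x q′
    cls-top : ∀ x q → B x → top? (cls x q) ≡ top? x
    cls-edge : ∀ j q → B (suc j) → L (par j) ≡ false →
      ∃ λ j′ → (cls (suc j) q ≡ suc j′) × (dir j′ ≡ dir j) × (par j′ ≡ cls (par j) q)

  S-elim : ∀ x → S x ≡ true → ∃ λ t → (Cen t ≡ true) × InStar t x
  S-elim x h = [ (λ c → x , c , inj₁ refl)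
               , (λ e → let (t , p) = ∃ᵇ-elim _ e ; (c , b) = ∧-split p in t , c , inj₂ b) ]′ (∨-split {Cen x} h)

  S-intro : ∀ t x → Cen t ≡ true → InStar t x → S x ≡ true
  S-intro t x c (inj₁ refl) = ∨-inl c
  S-intro t x c (inj₂ b) = ∨-inr {Cen x} (∃ᵇ-intro _ t (∧-join c b))

  S⇒A : ∀ x → S x ≡ true → A x ≡ true
  S⇒A x h = go (S-elim x h)
    where
    go : (∃ λ t → (Cen t ≡ true) × InStar t x) → A x ≡ true
    go (t , c , inj₁ refl) = Cen⇒A t c
    go (t , c , inj₂ b) = Cen-nb⇒A t x c b

-- Placing stars, reserved components and classes, then absorbing

module Embedding {n′ Δ u : ℕ} (E : Bool → Fin (suc n′) → Fin (suc n′) → Bool)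
  (E-sym : ∀ s a b → E s a b ≡ E (not s) b a)
  (T : RTree n′ Δ) (Dc : Decomposition T u) where

  open Tree T
  open Decomposition Dc

  Sat : Permutation′ (suc n′) → Fin n′ → Set
  Sat f j = E (dir j) (f ⟨$⟩ʳ par j) (f ⟨$⟩ʳ suc j) ≡ true

  sat-via-parent : ∀ (f : Permutation′ (suc n′)) j → E (sign (par j) (suc j)) (f ⟨$⟩ʳ par j) (f ⟨$⟩ʳ suc j) ≡ true → Sat f j
  sat-via-parent f j h = trans (cong (λ s → E s _ _) (sym (sign-down j))) h

  sat-via-child : ∀ (f : Permutation′ (suc n′)) j → E (sign (suc j) (par j)) (f ⟨$⟩ʳ suc j) (f ⟨$⟩ʳ par j) ≡ true → Sat f j
  sat-via-child f j h = trans (E-sym (dir j) _ _) (trans (cong (λ s → E s _ _) (sym (sign-up j))) h)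

  -- Whatever placed neighbours `i` has, they are presented as exactly two conditions, (s, a) and
  -- (s′, a′), so that `fits` and the tests need no case distinction; an absent neighbour gets an
  -- arbitrary condition.
  record Constraints (f : Permutation′ (suc n′)) (P : Fin (suc n′) → Bool) (i : Fin (suc n′)) : Set where
    field
      s s′ : Bool
      a a′ : Fin (suc n′)
      above : ∀ y → E s a y ≡ true → ∀ j → suc j ≡ i → E (dir j) (f ⟨$⟩ʳ par j) y ≡ true
      below : ∀ y → E s′ a′ y ≡ true → ∀ j → par j ≡ i → P (suc j) ≡ true → E (dir j) y (f ⟨$⟩ʳ suc j) ≡ true

  constraints : ∀ f P i → (∀ j j′ → par j ≡ i → par j′ ≡ i → P (suc j) ≡ true → P (suc j′) ≡ true → j ≡ j′) → Constraints f P i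
  constraints f P i unique = record { s = proj₁ up ; a = proj₁ (proj₂ up) ; above = proj₂ (proj₂ up)
                                    ; s′ = proj₁ down ; a′ = proj₁ (proj₂ down) ; below = proj₂ (proj₂ down) }
    where
    Above : Fin (suc n′) → Set
    Above i = Σ Bool λ s → Σ (Fin (suc n′)) λ a → ∀ y → E s a y ≡ true → ∀ j → suc j ≡ i → E (dir j) (f ⟨$⟩ʳ par j) y ≡ true
    upFrom : ∀ i → Above i
    upFrom zero = true , zero , λ _ _ _ ()
    upFrom (suc j) = dir j , f ⟨$⟩ʳ par j , λ { y h .j refl → h }
    up : Above i
    up = upFrom i
    Below : Set
    Below = Σ Bool λ s → Σ (Fin (suc n′)) λ a → ∀ y → E s a y ≡ true → ∀ j → par j ≡ i → P (suc j) ≡ true → E (dir j) y (f ⟨$⟩ʳ suc j) ≡ true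
    downFrom : Dec (∃ λ j → (par j ≡ i) × (P (suc j) ≡ true)) → Below
    downFrom (yes (j , e , p)) = not (dir j) , f ⟨$⟩ʳ suc j , λ y h j′ e′ p′ →
      subst (λ j → E (dir j) y (f ⟨$⟩ʳ suc j) ≡ true) (unique j j′ e e′ p p′) (trans (E-sym (dir j) y _) h)
    downFrom (no ¬p) = true , zero , λ y _ j e p → ⊥-elim (¬p (j , e , p))
    down : Below
    down = downFrom (any? λ j → (par j ≟ i) ×-dec (P (suc j) Data.Bool.≟ true))

assignAll : (vs ys : Fin m → Fin n) → Injective₁ vs → Injective₁ ys → (f : Permutation′ n) (P : Fin n → Bool) →
  (∀ q → P (vs q) ≡ false) → (∀ x q → P x ≡ true → f ⟨$⟩ʳ x ≢ ys q) →
  ∃ λ (f′ : Permutation′ n) → (∀ x → P x ≡ true → f′ ⟨$⟩ʳ x ≡ f ⟨$⟩ʳ x) × (∀ q → f′ ⟨$⟩ʳ vs q ≡ ys q)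
assignAll {m} {n} vs ys vs-inj ys-inj f P out free =
  let (f′ , ag , at) = finLoop Inv (f , (λ _ _ → refl) , λ _ ()) step in f′ , ag , λ q → at q (toℕ<n q)
  where
  Inv : ℕ → Set
  Inv k = ∃ λ (f′ : Permutation′ n) → (∀ x → P x ≡ true → f′ ⟨$⟩ʳ x ≡ f ⟨$⟩ʳ x) × (∀ q → toℕ q < k → f′ ⟨$⟩ʳ vs q ≡ ys q)
  step : ∀ i → Inv (toℕ i) → Inv (suc (toℕ i))
  step i (f′ , ag , at) = assign (vs i) (ys i) f′
    , (λ x Px → trans (assign-other (vs i) (ys i) f′ (λ e → true≢false Px (trans (cong P e) (out i)))
                  (λ e → free x i Px (trans (sym (ag x Px)) e))) (ag x Px))
    , λ q q< → [ (λ q< → trans (assign-other (vs i) (ys i) f′ (λ e → <-irrefl (cong toℕ (vs-inj _ _ e)) q<)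
                  (λ e → <-irrefl (cong toℕ (ys-inj _ _ (trans (sym (at q q<)) e))) q<)) (at q q<))
               , (λ q≡i → subst (λ j → assign (vs i) (ys i) f′ ⟨$⟩ʳ vs j ≡ ys j) (sym (toℕ-injective q≡i)) (assign-at (vs i) (ys i) f′))
               ]′ (m≤n⇒m<n∨m≡n (≤-pred q<))

module Extension {n′ Δ u : ℕ} (E : Bool → Fin (suc n′) → Fin (suc n′) → Bool)
  (E-sym : ∀ s a b → E s a b ≡ E (not s) b a) (g e : ℕ)
  (deg : ∀ s a → suc n′ + 2 * g ≤ 2 * count (E s a)) (n≤eg : suc n′ ≤ e * g)
  (T : RTree n′ Δ) (Dc : Decomposition T u) where

  open Host E g e deg n≤eg
  open Embedding E E-sym T Dc
  open Tree T
  open Decomposition Dc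

  place : ∀ (f : Permutation′ (suc n′)) (P : V → Bool) i → P i ≡ false → (c : Constraints f P i) → ∀ y →
    E (Constraints.s c) (Constraints.a c) y ≡ true → E (Constraints.s′ c) (Constraints.a′ c) y ≡ true →
    (∀ x → P x ≡ true → f ⟨$⟩ʳ x ≢ y) → (∀ j → P (par j) ≡ true → P (suc j) ≡ true → Sat f j) →
    ∀ j → (P (par j) ≡ true) ⊎ (par j ≡ i) → (P (suc j) ≡ true) ⊎ (suc j ≡ i) → Sat (assign i y f) j
  place f P i out c y ok ok′ free edges = go
    where
    f′ = assign i y f
    keep : ∀ x → P x ≡ true → f′ ⟨$⟩ʳ x ≡ f ⟨$⟩ʳ x
    keep x Px = assign-other i y f (λ e → true≢false Px (trans (cong P e) out)) (free x Px)
    at : f′ ⟨$⟩ʳ i ≡ y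
    at = assign-at i y f
    go : ∀ j → (P (par j) ≡ true) ⊎ (par j ≡ i) → (P (suc j) ≡ true) ⊎ (suc j ≡ i) → Sat f′ j
    go j (inj₁ p) (inj₁ q) = trans (cong₂ (E (dir j)) (keep _ p) (keep _ q)) (edges j p q)
    go j (inj₁ p) (inj₂ q) = trans (cong₂ (E (dir j)) (keep _ p) (trans (cong (f′ ⟨$⟩ʳ_) q) at)) (Constraints.above c y ok j q)
    go j (inj₂ p) (inj₁ q) = trans (cong₂ (E (dir j)) (trans (cong (f′ ⟨$⟩ʳ_) p) at) (keep _ q)) (Constraints.below c y ok′ j p q)
    go j (inj₂ p) (inj₂ q) = ⊥-elim (par≢suc j (trans p (sym q)))

  -- Indices grow away from the root, so when `i` is reached its parent in A is placed, and a placed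
  -- child can only be a star vertex; `S-child` allows one such child.
  fillA : 1 ≤ g → count A ≤ g → (f₀ : Permutation′ (suc n′)) →
    (∀ j → S (par j) ≡ true → S (suc j) ≡ true → Sat f₀ j) →
    ∃ λ (f : Permutation′ (suc n′)) → (∀ x → S x ≡ true → f ⟨$⟩ʳ x ≡ f₀ ⟨$⟩ʳ x) ×
      (∀ j → A (par j) ≡ true → A (suc j) ≡ true → Sat f j)
  fillA g≥1 A≤g f₀ S-sat = finish (finLoop Inv start step)
    where
    P : ℕ → V → Bool
    P k x = S x ∨ (A x ∧ does (toℕ x <? k))
    Inv : ℕ → Set
    Inv k = ∃ λ (f : Permutation′ (suc n′)) → (∀ x → S x ≡ true → f ⟨$⟩ʳ x ≡ f₀ ⟨$⟩ʳ x) ×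
      (∀ j → P k (par j) ≡ true → P k (suc j) ≡ true → Sat f j)
    P-elim : ∀ k x → P k x ≡ true → (S x ≡ true) ⊎ ((A x ≡ true) × (toℕ x < k))
    P-elim k x h = [ inj₁ , (λ h → let (a , b) = ∧-split {A x} h in inj₂ (a , ≡true⇒ (toℕ x <? k) b)) ]′ (∨-split {S x} h)
    P-late : ∀ k x → A x ≡ true → toℕ x < k → P k x ≡ true
    P-late k x a lt = ∨-inr {S x} (∧-join a (dec-true (toℕ x <? k) lt))
    P⇒A : ∀ k x → P k x ≡ true → A x ≡ true
    P⇒A k x h = [ S⇒A x , proj₁ ]′ (P-elim k x h)
    start : Inv 0
    start = f₀ , (λ _ _ → refl) , λ j p q → S-sat j (base _ p) (base _ q)
      where
      base : ∀ x → P 0 x ≡ true → S x ≡ true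
      base x h = [ (λ s → s) , (λ { (_ , ()) }) ]′ (P-elim 0 x h)
    finish : Inv (suc n′) → _
    finish (f , ag , edges) = f , ag , λ j p q → edges j (P-late _ _ p (toℕ<n (par j))) (P-late _ _ q (toℕ<n (suc j)))
    step : ∀ i → Inv (toℕ i) → Inv (suc (toℕ i))
    step i (f , ag , edges) = [ (λ s → skip (inj₁ s)) , (λ ¬s → [ here ¬s , (λ ¬a → skip (inj₂ ¬a)) ]′ (bool-cases (A i))) ]′ (bool-cases (S i))
      where
      κ = toℕ i
      grow : ∀ x → P (suc κ) x ≡ true → (P κ x ≡ true) ⊎ ((x ≡ i) × (A i ≡ true))
      grow x h = [ (λ s → inj₁ (∨-inl s)) , (λ { (a , lt) → [ (λ lt → inj₁ (P-late κ x a lt))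
         , (λ eq → inj₂ (toℕ-injective eq , subst (λ z → A z ≡ true) (toℕ-injective eq) a)) ]′ (m≤n⇒m<n∨m≡n (≤-pred lt)) }) ]′ (P-elim (suc κ) x h)
      skip : (S i ≡ true) ⊎ (A i ≡ false) → Inv (suc κ)
      skip w = f , ag , λ j p q → edges j (back _ p) (back _ q)
        where
        back : ∀ x → P (suc κ) x ≡ true → P κ x ≡ true
        back x h = [ (λ h → h) , (λ { (refl , a) → [ ∨-inl , (λ ¬a → ⊥-elim (true≢false a ¬a)) ]′ w }) ]′ (grow x h)
      here : S i ≡ false → A i ≡ true → Inv (suc κ)
      here ¬s a = go (count-pos _ (≤-trans g≥1 (fits-many f (P κ) _ _ _ _ (≤-trans (count-mono (P⇒A κ)) A≤g))))
        where
        out : P κ i ≡ false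
        out = ¬true⇒false λ h → [ (λ s → true≢false s ¬s) , (λ { (_ , lt) → <-irrefl refl lt }) ]′ (P-elim κ i h)
        starChild : ∀ j → par j ≡ i → P κ (suc j) ≡ true → S (suc j) ≡ true
        starChild j refl h = [ (λ s → s) , (λ { (_ , lt) → ⊥-elim (<-irrefl refl (<-≤-trans lt (m≤n⇒m≤1+n (par≤ j)))) }) ]′ (P-elim κ (suc j) h)
        c : Constraints f (P κ) i
        c = constraints f (P κ) i λ j j′ p p′ h h′ →
          S-child j j′ (trans p (sym p′)) (trans (cong S p) ¬s) (starChild j p h) (starChild j′ p′ h′)
        open Constraints c using (s; s′) renaming (a to b; a′ to b′)
        go : (∃ λ y → fits f (P κ) s b s′ b′ y ≡ true) → Inv (suc κ)
        go (y , ok) = assign i y f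
          , (λ x Sx → trans (assign-other i y f (λ { refl → true≢false Sx ¬s }) (free x (∨-inl Sx))) (ag x Sx))
          , λ j p q → place f (P κ) i out c y (proj₁ split₀) (proj₁ (proj₂ split₀)) free edges j (old _ p) (old _ q)
          where
          split₀ = fits-split f (P κ) s b s′ b′ ok
          free : ∀ x → P κ x ≡ true → f ⟨$⟩ʳ x ≢ y
          free x = unused f (P κ) (proj₂ (proj₂ split₀))
          old : ∀ x → P (suc κ) x ≡ true → (P κ x ≡ true) ⊎ (x ≡ i)
          old x h = [ inj₁ , inj₂ ∘ proj₁ ]′ (grow x h)

module Classes {n′ Δ u : ℕ} (E : Bool → Fin (suc n′) → Fin (suc n′) → Bool)
  (E-sym : ∀ s a b → E s a b ≡ E (not s) b a)
  (T : RTree n′ Δ) (Dc : Decomposition T u)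
  {K} (part : Fin K → Fin u → Fin (suc n′))
  (fair : ∀ c s z → u ≤ 2 * count (λ q → E s z (part c q)))
  (part-injective : ∀ c q c′ q′ → part c q ≡ part c′ q′ → (c ≡ c′) × (q ≡ q′))
  (f₀ : Permutation′ (suc n′))
  (avoid : ∀ x c q → Decomposition.A Dc x ≡ true → f₀ ⟨$⟩ʳ x ≢ part c q)
  (A-sat : ∀ j → Decomposition.A Dc (RTree.par T j) ≡ true → Decomposition.A Dc (suc j) ≡ true → Embedding.Sat E E-sym T Dc f₀ j)
  (size : suc n′ < count (Decomposition.A Dc) + K * u + u) where

  open Embedding E E-sym T Dc
  open Tree T
  open Decomposition Dc

  -- `c` is the number of parts used, and `free` keeps the later parts unoccupied. `quality` feeds
  -- the next layer: the images of a placed class are, up to order, a fair part.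
  record Placed (k : ℕ) : Set where
    field
      f : Permutation′ (suc n′)
      P : Fin (suc n′) → Bool
      c : ℕ
      agree : ∀ x → A x ≡ true → f ⟨$⟩ʳ x ≡ f₀ ⟨$⟩ʳ x
      A⊆P : ∀ x → A x ≡ true → P x ≡ true
      P-elim : ∀ x → P x ≡ true → (A x ≡ true) ⊎ B x
      done : ∀ x → toℕ x < k → B x → P x ≡ true
      P-cls : ∀ x q → P x ≡ true → B x → P (cls x q) ≡ true
      P-par : ∀ j → P (suc j) ≡ true → L (par j) ≡ false → P (par j) ≡ true
      free : ∀ x c′ q → P x ≡ true → c ≤ toℕ c′ → f ⟨$⟩ʳ x ≢ part c′ q
      quality : ∀ x → P x ≡ true → B x → ∀ s z → u ≤ 2 * count (λ q → E s z (f ⟨$⟩ʳ cls x q))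
      room : count A + c * u ≤ count P
      edges : ∀ j → P (par j) ≡ true → P (suc j) ≡ true → Sat f j

  private
    start : Placed 0
    start = record
      { f = f₀ ; P = A ; c = 0 ; agree = λ _ _ → refl ; A⊆P = λ _ h → h ; P-elim = λ _ → inj₁
      ; done = λ _ () ; P-cls = λ x q a b → ⊥-elim (true≢false a (proj₂ b))
      ; P-par = λ j a l → trans (A-edge j l (A⇒¬L (suc j) a)) a
      ; free = λ x c q a _ → avoid x c q a
      ; quality = λ x a b → ⊥-elim (true≢false a (proj₂ b))
      ; room = ≤-reflexive (+-identityʳ (count A)) ; edges = A-sat }

    module Step (i : Fin (suc n′)) (st : Placed (toℕ i)) (Bi : B i) (out : Placed.P st i ≡ false) where
      open Placed st

      vs : Fin u → Fin (suc n′)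
      vs = cls i

      B-vs : ∀ q → B (vs q)
      B-vs q = cls-B i q Bi

      vs∉P : ∀ q → P (vs q) ≡ false
      vs∉P q = ¬true⇒false λ h → let (q₀ , e) = cls-self i Bi in
        true≢false (subst (λ x → P x ≡ true) (trans (cls-cls i q q₀ Bi) e) (P-cls (vs q) q₀ h (B-vs q))) out

      inClass : Fin (suc n′) → Bool
      inClass x = ∃ᵇ (λ q → vs q == x)

      P₁ : Fin (suc n′) → Bool
      P₁ x = P x ∨ inClass x

      P₁-elim : ∀ x → P₁ x ≡ true → (P x ≡ true) ⊎ (∃ λ q → vs q ≡ x)
      P₁-elim x h = [ inj₁ , (λ h → let (q , e) = ∃ᵇ-elim _ h in inj₂ (q , ==⇒≡ e)) ]′ (∨-split {P x} h)

      P₁-vs : ∀ q → P₁ (vs q) ≡ true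
      P₁-vs q = ∨-inr {P (vs q)} (∃ᵇ-intro _ q (==-refl (vs q)))

      room₁ : count A + suc c * u ≤ count P₁
      room₁ = ≤-trans (≤-reflexive (lem (count A) c u)) (≤-trans (+-monoˡ-≤ u room)
        (count-image vs (cls-injective i Bi) P P₁ vs∉P (λ _ → ∨-inl) P₁-vs))
        where
        lem : ∀ a c u → a + suc c * u ≡ a + c * u + u
        lem = solve-∀

      c<K : c < K
      c<K = ≰⇒> λ K≤c → <-irrefl refl (<-≤-trans size (≤-trans (≤-trans
        (+-monoˡ-≤ u (+-monoʳ-≤ (count A) (*-monoˡ-≤ u K≤c))) (≤-reflexive (sym (lem (count A) c u))))
        (≤-trans room₁ (count≤n P₁))))
        where
        lem : ∀ a c u → a + suc c * u ≡ a + c * u + u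
        lem = solve-∀

      new : Fin K
      new = fromℕ< c<K

      toℕ-new : toℕ new ≡ c
      toℕ-new = toℕ-fromℕ< c<K

      Joined : Permutation′ u → Set
      Joined π = ∀ j → suc j ≡ i → L (par j) ≡ false → ∀ q → E (dir j) (f ⟨$⟩ʳ cls (par j) q) (part new (π ⟨$⟩ʳ q)) ≡ true

      parentB : ∀ j → suc j ≡ i → L (par j) ≡ false → B (par j)
      parentB j refl l = l , trans (A-edge j l (proj₁ Bi)) (proj₂ Bi)

      parentP : ∀ j → suc j ≡ i → L (par j) ≡ false → P (par j) ≡ true
      parentP j refl l = done (par j) (s≤s (par≤ j)) (parentB j refl l)

      join : ∃ Joined
      join = go i refl
        where
        go : ∀ x → x ≡ i → ∃ Joined
        go zero e = Data.Fin.Permutation.id , λ { j refl → case e of λ () }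
        go (suc j) e = [ (λ l → Data.Fin.Permutation.id , λ j′ e′ l′ → ⊥-elim (true≢false (trans (cong (L ∘ par) (suc-injective (trans e′ (sym e)))) l) l′))
                       , (λ l → let (π , ok) = perfectMatching R (λ q → fair new (dir j) _) (column l) in
                           π , λ j′ e′ _ q → subst (λ j → E (dir j) (f ⟨$⟩ʳ cls (par j) q) (part new (π ⟨$⟩ʳ q)) ≡ true)
                             (suc-injective (trans e (sym e′))) (ok q)) ]′ (bool-cases (L (par j)))
          where
          -- Rows have degree at least u/2 by fairness of the new part, columns by `quality` of the
          -- class of the parent.
          R : Fin u → Fin u → Bool
          R q x = E (dir j) (f ⟨$⟩ʳ cls (par j) q) (part new x)
          column : L (par j) ≡ false → ∀ x → u ≤ 2 * count (λ q → R q x)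
          column l x = ≤-trans (quality (par j) (parentP j e l) (parentB j e l) (not (dir j)) (part new x))
            (≤-reflexive (cong (2 *_) (sum-cong-≗ λ q → cong 𝟙 (sym (E-sym (dir j) _ _)))))

      extend : (∃ Joined) → Placed (suc (toℕ i))
      extend (π , joined) = go (assignAll vs (λ q → part new (π ⟨$⟩ʳ q)) (cls-injective i Bi)
            (λ q q′ e → ⟨$⟩-injective π (proj₂ (part-injective _ _ _ _ e))) f P vs∉P
            (λ x q Px → free x new (π ⟨$⟩ʳ q) Px (≤-reflexive (sym toℕ-new))))
        where
        go : (∃ λ (f′ : Permutation′ (suc n′)) → (∀ x → P x ≡ true → f′ ⟨$⟩ʳ x ≡ f ⟨$⟩ʳ x) ×
               (∀ q → f′ ⟨$⟩ʳ vs q ≡ part new (π ⟨$⟩ʳ q))) → Placed (suc (toℕ i))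
        go (f₁ , keep , at) = record
          { f = f₁ ; P = P₁ ; c = suc c
          ; agree = λ x a → trans (keep x (A⊆P x a)) (agree x a)
          ; A⊆P = λ x a → ∨-inl (A⊆P x a)
          ; P-elim = λ x h → [ P-elim x , (λ { (q , refl) → inj₂ (B-vs q) }) ]′ (P₁-elim x h)
          ; done = λ x lt b → [ (λ lt → ∨-inl (done x lt b))
                              , (λ eq → subst (λ x → P₁ x ≡ true) (trans (proj₂ (cls-self i Bi)) (sym (toℕ-injective eq))) (P₁-vs _)) ]′ (m≤n⇒m<n∨m≡n (≤-pred lt))
          ; P-cls = λ x q h b → [ (λ h → ∨-inl (P-cls x q h b))
                                , (λ { (q′ , refl) → subst (λ x → P₁ x ≡ true) (sym (cls-cls i q′ q Bi)) (P₁-vs q) }) ]′ (P₁-elim x h)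
          ; P-par = λ j h l → [ (λ h → ∨-inl (P-par j h l)) , (λ { (q , e) → ∨-inl (class-par j q e l) }) ]′ (P₁-elim (suc j) h)
          ; free = λ x c′ q h c<c′ → [ (λ h e → free x c′ q h (<⇒≤ c<c′) (trans (sym (keep x h)) e))
                                     , (λ { (q′ , refl) e → <-irrefl (trans (sym toℕ-new) (cong toℕ (proj₁ (part-injective _ _ _ _ (trans (sym (at q′)) e))))) c<c′ }) ]′ (P₁-elim x h)
          ; quality = λ x h b s z → [ (λ h → ≤-trans (quality x h b s z) (≤-reflexive (cong (2 *_) (sum-cong-≗ λ q →
                                          cong (λ y → 𝟙 (E s z y)) (sym (keep _ (P-cls x q h b)))))))
                                    , (λ { (q , refl) → new-quality q s z }) ]′ (P₁-elim x h)
          ; room = room₁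
          ; edges = λ j p q → edges₁ j (P₁-elim _ p) (P₁-elim _ q) }
          where
          new-quality : ∀ q s z → u ≤ 2 * count (λ q′ → E s z (f₁ ⟨$⟩ʳ cls (vs q) q′))
          new-quality q s z = ≤-trans (fair new s z) (≤-reflexive (cong (2 *_) (trans
            (sym (count-permute π (λ q′ → E s z (part new q′))))
            (sum-cong-≗ λ q′ → cong (λ y → 𝟙 (E s z y)) (sym (trans (cong (f₁ ⟨$⟩ʳ_) (cls-cls i q q′ Bi)) (at q′)))))))
          -- By `cls-top` all copies are tops or none is, so a copy with a parent outside L gives
          -- such a parent to `i`.
          toTop : ∀ j q → vs q ≡ suc j → L (par j) ≡ false → ∃ λ j₀ → (suc j₀ ≡ i) × (L (par j₀) ≡ false)
          toTop j q e l = from i refl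
            where
            from : ∀ x → x ≡ i → ∃ λ j₀ → (suc j₀ ≡ i) × (L (par j₀) ≡ false)
            from zero refl = ⊥-elim (true≢false (cls-top i q Bi) (trans (cong (topOf L) e) l))
            from (suc j₀) refl = j₀ , refl , trans (sym (cls-top i q Bi)) (trans (cong (topOf L) e) l)
          class-par′ : ∀ j q → vs q ≡ suc j → L (par j) ≡ false → ∃ λ j₀ → (suc j₀ ≡ i) × (L (par j₀) ≡ false) × (dir j ≡ dir j₀) × (par j ≡ cls (par j₀) q)
          class-par′ j q e l = via (toTop j q e l)
            where
            via : (∃ λ j₀ → (suc j₀ ≡ i) × (L (par j₀) ≡ false)) → _
            via (j₀ , refl , l₀) = let (j′ , e′ , d , p) = cls-edge j₀ q Bi l₀ ; j≡ = suc-injective (trans (sym e) e′) in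
              j₀ , refl , l₀ , trans (cong dir j≡) d , trans (cong par j≡) p
          class-par : ∀ j q → vs q ≡ suc j → L (par j) ≡ false → P (par j) ≡ true
          class-par j q e l = let (j₀ , e₀ , l₀ , _ , p) = class-par′ j q e l in
            subst (λ x → P x ≡ true) (sym p) (P-cls (par j₀) q (parentP j₀ e₀ l₀) (parentB j₀ e₀ l₀))
          ¬L-of : ∀ x → (P x ≡ true) ⊎ (∃ λ q → vs q ≡ x) → L x ≡ false
          ¬L-of x (inj₁ h) = [ A⇒¬L x , proj₁ ]′ (P-elim x h)
          ¬L-of x (inj₂ (q , refl)) = proj₁ (B-vs q)
          edges₁ : ∀ j → (P (par j) ≡ true) ⊎ (∃ λ q → vs q ≡ par j) → (P (suc j) ≡ true) ⊎ (∃ λ q → vs q ≡ suc j) → Sat f₁ j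
          edges₁ j (inj₁ p) (inj₁ q) = trans (cong₂ (E (dir j)) (keep _ p) (keep _ q)) (edges j p q)
          edges₁ j p (inj₂ (q , e)) = let (j₀ , e₀ , l₀ , d , pe) = class-par′ j q e (¬L-of _ p) in
            trans (cong₂ (E (dir j)) (trans (cong (f₁ ⟨$⟩ʳ_) pe) (keep _ (P-cls (par j₀) q (parentP j₀ e₀ l₀) (parentB j₀ e₀ l₀))))
                    (trans (cong (f₁ ⟨$⟩ʳ_) (sym e)) (at q)))
              (trans (cong (λ d → E d (f ⟨$⟩ʳ cls (par j₀) q) (part new (π ⟨$⟩ʳ q))) d) (joined j₀ e₀ l₀ q))
          -- A new parent above an old child cannot occur: by `P-par` the placed set is closed under
          -- parents outside L.
          edges₁ j (inj₂ (q , e)) (inj₁ p) = ⊥-elim (true≢false (P-par j p (¬L-of _ (inj₂ (q , e))))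
            (subst (λ x → P x ≡ false) e (vs∉P q)))

      next : Placed (suc (toℕ i))
      next = extend join

    step : ∀ i → Placed (toℕ i) → Placed (suc (toℕ i))
    step i st = [ (λ { (Bi , out) → Step.next i st Bi out }) , skip ]′ needed
      where
      open Placed st
      Skip : Set
      Skip = B i → P i ≡ true
      needed : (B i × (P i ≡ false)) ⊎ Skip
      needed with L i Data.Bool.≟ false | A i Data.Bool.≟ false | P i Data.Bool.≟ false
      ... | yes l | yes a | yes p = inj₁ ((l , a) , p)
      ... | no ¬l | _ | _ = inj₂ λ b → ⊥-elim (¬l (proj₁ b))
      ... | yes _ | no ¬a | _ = inj₂ λ b → ⊥-elim (¬a (proj₂ b))
      ... | yes _ | yes _ | no ¬p = inj₂ λ _ → [ (λ t → t) , (λ f → ⊥-elim (¬p f)) ]′ (bool-cases (P i))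
      skip : Skip → Placed (suc (toℕ i))
      skip h = record
        { f = f ; P = P ; c = c ; agree = agree ; A⊆P = A⊆P ; P-elim = P-elim
        ; done = λ x lt b → [ (λ lt → done x lt b) , (λ eq → subst (λ x → B x → P x ≡ true) (sym (toℕ-injective eq)) h b) ]′ (m≤n⇒m<n∨m≡n (≤-pred lt))
        ; P-cls = P-cls ; P-par = P-par ; free = free ; quality = quality ; room = room ; edges = edges }

  placeClasses : ∃ λ (f : Permutation′ (suc n′)) → (∀ x → A x ≡ true → f ⟨$⟩ʳ x ≡ f₀ ⟨$⟩ʳ x) ×
    (∀ j → L (par j) ≡ false → L (suc j) ≡ false → Sat f j)
  placeClasses = let open Placed (finLoop Placed start step) in f , agree , λ j l l′ → edges j (all P A⊆P done l) (all P A⊆P done l′)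
    where
    all : ∀ P → (∀ x → A x ≡ true → P x ≡ true) → (∀ x → toℕ x < suc n′ → B x → P x ≡ true) → ∀ {x} → L x ≡ false → P x ≡ true
    all P A⊆P done {x} l = [ A⊆P x , (λ a → done x (toℕ<n x) (l , a)) ]′ (bool-cases (A x))

module Absorption {n′ Δ u : ℕ} (E : Bool → Fin (suc n′) → Fin (suc n′) → Bool)
  (E-sym : ∀ s a b → E s a b ≡ E (not s) b a) (g e : ℕ)
  (deg : ∀ s a → suc n′ + 2 * g ≤ 2 * count (E s a)) (n≤eg : suc n′ ≤ e * g)
  (T : RTree n′ Δ) (Dc : Decomposition T u)
  {N} (tests : Fin N → Host.Test E g e deg n≤eg) (index : Host.Test E g e deg n≤eg → Fin N)
  (tests-index : ∀ τ → tests (index τ) ≡ τ)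
  {σ} (ts : Fin σ → Fin (suc n′)) (ts-injective : Injective₁ ts) (ts∈Cen : ∀ q → Decomposition.Cen Dc (ts q) ≡ true)
  (f₀ : Permutation′ (suc n′)) (good : Fin σ → Fin N → Bool) where

  open Host E g e deg n≤eg
  open Embedding E E-sym T Dc
  open Tree T
  open Decomposition Dc

  CoversAll : Permutation′ (suc n′) → V → Test → Set
  CoversAll f t (test s s′ a a′ w) = (E s a (f ⟨$⟩ʳ t) ≡ true) × (E s′ a′ (f ⟨$⟩ʳ t) ≡ true) ×
    (∀ x → nb t x ≡ true → E (sign t x) w (f ⟨$⟩ʳ x) ≡ true)

  module _ (good-covers : ∀ q τ → good q τ ≡ true → CoversAll f₀ (ts q) (tests τ))
    (many : ∀ τ → count L < count (λ q → good q τ))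
    (sat₀ : ∀ j → L (par j) ≡ false → L (suc j) ≡ false → Sat f₀ j) where

    private
      P : ℕ → V → Bool
      P k x = not (L x) ∨ does (toℕ x <? k)

      P-elim : ∀ k x → P k x ≡ true → (L x ≡ false) ⊎ (toℕ x < k)
      P-elim k x h = [ inj₁ ∘ not-true , inj₂ ∘ ≡true⇒ (toℕ x <? k) ]′ (∨-split {not (L x)} h)

      P-¬L : ∀ k x → L x ≡ false → P k x ≡ true
      P-¬L k x h = ∨-inl (not-false h)

      P-< : ∀ k x → toℕ x < k → P k x ≡ true
      P-< k x lt = ∨-inr {not (L x)} (dec-true (toℕ x <? k) lt)

      before : ℕ → ℕ
      before k = count (λ x → L x ∧ does (toℕ x <? k))

      record Absorbed (k : ℕ) : Set where
        field
          f : Permutation′ (suc n′)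
          used : Fin σ → Bool
          used≤ : count used ≤ before k
          unused-fixed : ∀ x → L x ≡ false → (∀ q → used q ≡ true → x ≢ ts q) → f ⟨$⟩ʳ x ≡ f₀ ⟨$⟩ʳ x
          edges : ∀ j → P k (par j) ≡ true → P k (suc j) ≡ true → Sat f j

      start : Absorbed 0
      start = record { f = f₀ ; used = λ _ → false
        ; used≤ = ≤-trans (≤-reflexive (count-false (λ (_ : Fin σ) → false) (λ _ → refl))) z≤n
        ; unused-fixed = λ _ _ _ → refl ; edges = λ j p q → sat₀ j (base _ p) (base _ q) }
        where
        base : ∀ x → P 0 x ≡ true → L x ≡ false
        base x h = [ (λ l → l) , (λ ()) ]′ (P-elim 0 x h)

      step : ∀ i → Absorbed (toℕ i) → Absorbed (suc (toℕ i))
      step i st = [ absorb , skip ]′ (bool-cases (L i))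
        where
        open Absorbed st
        κ = toℕ i
        grow : ∀ x → P (suc κ) x ≡ true → (P κ x ≡ true) ⊎ (x ≡ i)
        grow x h = [ (λ l → inj₁ (P-¬L κ x l)) , (λ lt → [ (λ lt → inj₁ (P-< κ x lt)) , inj₂ ∘ toℕ-injective ]′ (m≤n⇒m<n∨m≡n (≤-pred lt))) ]′ (P-elim (suc κ) x h)
        before-mono : before κ ≤ before (suc κ)
        before-mono = count-mono λ x h → let (a , b) = ∧-split {L x} h in ∧-join a (dec-true (toℕ x <? suc κ) (m≤n⇒m≤1+n (≡true⇒ (toℕ x <? κ) b)))
        skip : L i ≡ false → Absorbed (suc κ)
        skip l = record { f = f ; used = used ; used≤ = ≤-trans used≤ before-mono ; unused-fixed = unused-fixed
          ; edges = λ j p q → edges j (back _ p) (back _ q) }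
          where
          back : ∀ x → P (suc κ) x ≡ true → P κ x ≡ true
          back x h = [ (λ h → h) , (λ { refl → P-¬L κ x l }) ]′ (grow x h)
        absorb : L i ≡ true → Absorbed (suc κ)
        absorb Li = go (count-pos (λ q → good q τ ∧ not (used q)) (+-cancelʳ-< (count L) 0 _ (<-≤-trans (many τ)
             (≤-trans (count-∧not (λ q → good q τ) used) (+-monoʳ-≤ _ (≤-trans used≤ (count-mono λ x h → proj₁ (∧-split h))))))))
          where
          out : P κ i ≡ false
          out = ¬true⇒false λ h → [ true≢false Li , <-irrefl refl ]′ (P-elim κ i h)
          ¬L-child : ∀ j → par j ≡ i → P κ (suc j) ≡ true → L (suc j) ≡ false
          ¬L-child j refl h = [ (λ l → l) , (λ lt → ⊥-elim (<-irrefl refl (<-≤-trans lt (m≤n⇒m≤1+n (par≤ j))))) ]′ (P-elim κ (suc j) h)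
          c : Constraints f (P κ) i
          c = constraints f (P κ) i λ j j′ p p′ h h′ →
            one-child j j′ (trans p (sym p′)) (trans (cong L p) Li) (¬L-child j p h) (¬L-child j′ p′ h′)
          open Constraints c using (s; s′; above; below) renaming (a to b; a′ to b′)
          w : V
          w = f ⟨$⟩ʳ i
          τ : Fin N
          -- Earlier exchanges may have moved `i` and its neighbours anywhere; the tests run over
          -- all tuples, so the present images still form one of them.
          τ = index (test s s′ b b′ w)
          go : (∃ λ q → good q τ ∧ not (used q) ≡ true) → Absorbed (suc κ)
          go (q , h) = record { f = f₁ ; used = used₁ ; used≤ = used₁≤ ; unused-fixed = fixed₁ ; edges = λ j p r → edges₁ j (grow _ p) (grow _ r) }
            where
            good-q : good q τ ≡ true
            good-q = proj₁ (∧-split {good q τ} h)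
            free-q : used q ≡ false
            free-q = not-true (proj₂ (∧-split {good q τ} h))
            t : V
            t = ts q
            At : A t ≡ true
            At = Cen⇒A t (ts∈Cen q)
            ¬Lt : L t ≡ false
            ¬Lt = A⇒¬L t At
            leaf-¬L : ∀ x → nb t x ≡ true → L x ≡ false
            leaf-¬L x b = A⇒¬L x (Cen-nb⇒A t x (ts∈Cen q) b)
            leaf≢centre : ∀ x → nb t x ≡ true → ∀ q′ → x ≢ ts q′
            leaf≢centre x b q′ e = nb-irrefl t (trans (cong (nb t) (trans (star-disjoint t (ts q′) x (ts∈Cen q) (ts∈Cen q′) (inj₂ b) (inj₁ e)) (sym e))) b)
            leaf-fixed : ∀ x → nb t x ≡ true → f ⟨$⟩ʳ x ≡ f₀ ⟨$⟩ʳ x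
            leaf-fixed x b = unused-fixed x (leaf-¬L x b) (λ q′ _ → leaf≢centre x b q′)
            t-fixed : f ⟨$⟩ʳ t ≡ f₀ ⟨$⟩ʳ t
            t-fixed = unused-fixed t ¬Lt λ q′ u e → true≢false u (trans (cong used (sym (ts-injective q q′ e))) free-q)
            cov : CoversAll f₀ t (test s s′ b b′ w)
            cov = subst (CoversAll f₀ t) (tests-index (test s s′ b b′ w)) (good-covers q τ good-q)
            ok : E s b (f ⟨$⟩ʳ t) ≡ true
            ok = trans (cong (E s b) t-fixed) (proj₁ cov)
            ok′ : E s′ b′ (f ⟨$⟩ʳ t) ≡ true
            ok′ = trans (cong (E s′ b′) t-fixed) (proj₁ (proj₂ cov))
            leaf-ok : ∀ x → nb t x ≡ true → E (sign t x) w (f ⟨$⟩ʳ x) ≡ true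
            leaf-ok x h = trans (cong (E (sign t x) w) (leaf-fixed x h)) (proj₂ (proj₂ cov) x h)
            f₁ = swapAt i t f
            at-i : f₁ ⟨$⟩ʳ i ≡ f ⟨$⟩ʳ t
            at-i = swapAt-left i t f
            at-t : f₁ ⟨$⟩ʳ t ≡ w
            at-t = swapAt-right i t f
            at-other : ∀ {x} → x ≢ i → x ≢ t → f₁ ⟨$⟩ʳ x ≡ f ⟨$⟩ʳ x
            at-other = swapAt-other i t f
            leaf≢i : ∀ x → nb t x ≡ true → x ≢ i
            leaf≢i x h refl = true≢false Li (leaf-¬L x h)
            at-leaf : ∀ x → nb t x ≡ true → f₁ ⟨$⟩ʳ x ≡ f ⟨$⟩ʳ x
            at-leaf x h = at-other (leaf≢i x h) (leaf≢centre x h q)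
            used₁ : Fin σ → Bool
            used₁ q′ = used q′ ∨ (q == q′)
            used₁≤ : count used₁ ≤ before (suc κ)
            used₁≤ = ≤-trans (count-∨ used (q ==_)) (≤-trans (+-mono-≤ used≤ (≤-reflexive (count-single q)))
              (count-image {u = 1} (λ _ → i) (λ { zero zero _ → refl }) (λ x → L x ∧ does (toℕ x <? κ)) (λ x → L x ∧ does (toℕ x <? suc κ))
                (λ _ → ¬true⇒false λ h → <-irrefl refl (≡true⇒ (κ <? κ) (proj₂ (∧-split {L i} h))))
                (λ x h → let (a , b) = ∧-split {L x} h in ∧-join a (dec-true (toℕ x <? suc κ) (m≤n⇒m≤1+n (≡true⇒ (toℕ x <? κ) b))))
                (λ _ → ∧-join Li (dec-true (κ <? suc κ) ≤-refl))))
            fixed₁ : ∀ x → L x ≡ false → (∀ q′ → used₁ q′ ≡ true → x ≢ ts q′) → f₁ ⟨$⟩ʳ x ≡ f₀ ⟨$⟩ʳ x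
            fixed₁ x l h = trans (at-other (λ { refl → true≢false Li l }) (h q (∨-inr {used q} (==-refl q))))
              (unused-fixed x l (λ q′ u → h q′ (∨-inl u)))
            P≢i : ∀ x → P κ x ≡ true → x ≢ i
            P≢i x p refl = true≢false p out
            -- The vertices `i` and `t` are not adjacent, because the neighbours of `t` lie in A and
            -- hence outside L.
            edges₁ : ∀ j → (P κ (par j) ≡ true) ⊎ (par j ≡ i) → (P κ (suc j) ≡ true) ⊎ (suc j ≡ i) → Sat f₁ j
            edges₁ j (inj₂ p) (inj₂ r) = ⊥-elim (par≢suc j (trans p (sym r)))
            edges₁ j (inj₂ p) (inj₁ r) = trans (cong₂ (E (dir j)) (trans (cong (f₁ ⟨$⟩ʳ_) p) at-i)
                (at-other (P≢i _ r) (λ e → leaf≢i (par j) (subst (λ x → nb x (par j) ≡ true) e (nb-up j)) p)))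
              (below (f ⟨$⟩ʳ t) ok′ j p r)
            edges₁ j (inj₁ p) (inj₂ r) = trans (cong₂ (E (dir j))
                (at-other (P≢i _ p) (λ e → leaf≢i (suc j) (subst (λ x → nb x (suc j) ≡ true) e (nb-down j)) r))
                (trans (cong (f₁ ⟨$⟩ʳ_) r) at-i))
              (above (f ⟨$⟩ʳ t) ok j r)
            edges₁ j (inj₁ p) (inj₁ r) = cases (par j ≟ t) (suc j ≟ t)
              where
              cases : Dec (par j ≡ t) → Dec (suc j ≡ t) → Sat f₁ j
              cases (yes e) _ = sat-via-parent f₁ j (subst (λ x → E (sign x (suc j)) (f₁ ⟨$⟩ʳ x) (f₁ ⟨$⟩ʳ suc j) ≡ true) (sym e)
                (trans (cong₂ (E (sign t (suc j))) at-t (at-leaf (suc j) nbt)) (leaf-ok (suc j) nbt)))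
                where
                nbt : nb t (suc j) ≡ true
                nbt = subst (λ x → nb x (suc j) ≡ true) e (nb-down j)
              cases (no _) (yes e) = sat-via-child f₁ j (subst (λ x → E (sign x (par j)) (f₁ ⟨$⟩ʳ x) (f₁ ⟨$⟩ʳ par j) ≡ true) (sym e)
                (trans (cong₂ (E (sign t (par j))) at-t (at-leaf (par j) nbt)) (leaf-ok (par j) nbt)))
                where
                nbt : nb t (par j) ≡ true
                nbt = subst (λ x → nb x (par j) ≡ true) e (nb-up j)
              cases (no ¬a) (no ¬b) = trans (cong₂ (E (dir j)) (at-other (P≢i _ p) ¬a) (at-other (P≢i _ r) ¬b)) (edges j p r)

    absorbAll : ∃ λ (f : Permutation′ (suc n′)) → ∀ j → Sat f j
    absorbAll = let open Absorbed (finLoop Absorbed start step) in f , λ j → edges j (P-< _ _ (toℕ<n (par j))) (P-< _ _ (toℕ<n (suc j)))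

-- Assembling the embedding from a decomposition

boolOf : Fin 2 → Bool
boolOf zero = false
boolOf (suc zero) = true

finOf : Bool → Fin 2
finOf false = zero
finOf true = suc zero

boolOf-finOf : ∀ b → boolOf (finOf b) ≡ b
boolOf-finOf false = refl
boolOf-finOf true = refl

opaque
  pair : Fin m → Fin n → Fin (m * n)
  pair = combine

  unpair : Fin (m * n) → Fin m × Fin n
  unpair {m} {n} = remQuot {m} n

  unpair-pair : (i : Fin m) (j : Fin n) → unpair (pair i j) ≡ (i , j)
  unpair-pair = remQuot-combine

-- Only n - m elements lie outside the image of U.
count-restrict : (U : Fin m → Fin n) → Injective₁ U → (Q : Fin n → Bool) → count Q + m ≤ count (Q ∘ U) + n
count-restrict {m} {n} U inj Q = begin
  count Q + m ≤⟨ +-monoˡ-≤ m (count-∧not Q (not ∘ I)) ⟩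
  count (λ y → Q y ∧ not (not (I y))) + count (not ∘ I) + m ≡⟨ +-assoc (count (λ y → Q y ∧ not (not (I y)))) (count (not ∘ I)) m ⟩
  count (λ y → Q y ∧ not (not (I y))) + (count (not ∘ I) + m) ≤⟨ +-mono-≤ inside outside ⟩
  count (Q ∘ U) + n ∎
  where
  open ≤-Reasoning
  I : Fin n → Bool
  I y = ∃ᵇ (λ q → U q == y)
  outside : count (not ∘ I) + m ≤ n
  outside = ≤-trans (count-image U inj (not ∘ I) (λ _ → true) (λ q → cong not (∃ᵇ-intro _ q (==-refl (U q)))) (λ _ _ → refl) (λ _ → refl)) (count≤n _)
  inside : count (λ y → Q y ∧ not (not (I y))) ≤ count (Q ∘ U)
  inside = begin
    count (λ y → Q y ∧ not (not (I y))) ≤⟨ sum-mono each ⟩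
    sum (λ y → sum (λ q → 𝟙 (Q (U q)) * 𝟙 (U q == y))) ≡⟨ ∑-comm (λ y q → 𝟙 (Q (U q)) * 𝟙 (U q == y)) ⟩
    sum (λ q → sum (λ y → 𝟙 (Q (U q)) * 𝟙 (U q == y))) ≡⟨ sum-cong-≗ (λ q → trans (sum-*ˡ (𝟙 (Q (U q))) (λ y → 𝟙 (U q == y)))
          (trans (cong (𝟙 (Q (U q)) *_) (count-single (U q))) (*-identityʳ _))) ⟩
    count (Q ∘ U) ∎
    where
    each : ∀ y → 𝟙 (Q y ∧ not (not (I y))) ≤ sum (λ q → 𝟙 (Q (U q)) * 𝟙 (U q == y))
    each y = by (Q y ∧ not (not (I y))) refl
      where
      by : ∀ b → Q y ∧ not (not (I y)) ≡ b → 𝟙 b ≤ sum (λ q → 𝟙 (Q (U q)) * 𝟙 (U q == y))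
      by false _ = z≤n
      by true h = let (Qy , Iy) = ∧-split {Q y} h ; (q , e) = ∃ᵇ-elim _ (not-not Iy) in
        ≤-trans (≤-reflexive (sym (cong₂ (λ a b → 𝟙 a * 𝟙 b) (trans (cong Q (==⇒≡ e)) Qy) e)))
          (term≤sum (λ q → 𝟙 (Q (U q)) * 𝟙 (U q == y)) q)
        where
        not-not : ∀ {b} → not (not b) ≡ true → b ≡ true
        not-not {true} _ = refl

-- A test consists of two orientations and three vertices.
testCount : ℕ → ℕ
testCount n = 2 * (2 * (n * (n * n)))

-- `X` and `p` make every test absorbed by more stars than L has vertices. `θ′`, `y` and `j` govern
-- the repeated halving, and the inequality with `slack` makes the vertices left over by A fair
-- enough for it. The last two inequalities say that the parts fit beside A and that fewer than `u`
-- vertices escape both.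
embed : ∀ {n′ Δ u} (E : Bool → Fin (suc n′) → Fin (suc n′) → Bool) (E-sym : ∀ s a b → E s a b ≡ E (not s) b a)
  (g e : ℕ) (deg : ∀ s a → suc n′ + 2 * g ≤ 2 * count (E s a)) (n≤eg : suc n′ ≤ e * g)
  (T : RTree n′ Δ) (Dc : Decomposition T u) → let open Decomposition Dc in
  1 ≤ g → count A ≤ g →
  ∀ X p → suc X ≡ e ^ suc (Δ + 1) + e ^ suc (Δ + 1) → X * p ≤ count Cen →
  2 ^ count L * testCount (suc n′) < 2 ^ p →
  ∀ θ′ y j → dbl j u ≤ 8 * suc θ′ * suc θ′ * y → 2 * suc n′ + 2 * suc n′ < 2 ^ y →
  suc n′ + slack (8 * suc θ′ * y) j ≤ 2 * g + dbl j u →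
  count A + dbl j u ≤ suc n′ → suc n′ < count A + 2 ^ j * u + u →
  ∃ λ (f : Permutation′ (suc n′)) → ∀ j → Embedding.Sat E E-sym T Dc f j
embed {n′} {Δ} {u} E E-sym g e deg n≤eg T Dc g≥1 A≤g X p X≡ Xp≤ many θ′ y j d≤ y≥ slack≤g A+d≤ n< = absorbed
  where
  open Host E g e deg n≤eg
  open Embedding E E-sym T Dc
  open Tree T
  open Decomposition Dc
  module X₀ = Extension E E-sym g e deg n≤eg T Dc
  nn = suc n′

  tests : Fin (testCount nn) → Test
  tests τ = let (s , τ₁) = unpair {2} {2 * (nn * (nn * nn))} τ ; (s′ , τ₂) = unpair {2} {nn * (nn * nn)} τ₁
                (a , τ₃) = unpair {nn} {nn * nn} τ₂ ; (a′ , w) = unpair {nn} {nn} τ₃ in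
    test (boolOf s) (boolOf s′) a a′ w

  index : Test → Fin (testCount nn)
  index (test s s′ a a′ w) = pair (finOf s) (pair (finOf s′) (pair a (pair a′ w)))

  tests-index : ∀ τ → tests (index τ) ≡ τ
  tests-index (test s s′ a a′ w)
    rewrite unpair-pair (finOf s) (pair (finOf s′) (pair a (pair a′ w)))
          | unpair-pair (finOf s′) (pair a (pair a′ w))
          | unpair-pair a (pair a′ w) | unpair-pair a′ w
          | boolOf-finOf s | boolOf-finOf s′ = refl

  open Enumeration (enumerate Cen) using () renaming (enum to ts; enum-∈ to ts∈Cen; enum-injective to ts-injective; enum-surjective to ts-surjective)

  module Nb q = Enumeration (enumerate (nb (ts q)))

  module St = Stars E g e deg n≤eg tests (index (test true true zero zero zero)) S (≤-trans (count-mono S⇒A) A≤g)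
    (Δ + 1) X X≡ ts (λ q → count (nb (ts q))) (λ q → count-nb (ts q)) Nb.enum (λ q r → sign (ts q) (Nb.enum q r))
    Nb.enum-injective (λ q r e → nb-irrefl (ts q) (subst (λ x → nb (ts q) x ≡ true) e (Nb.enum-∈ q r)))
    (λ q → S-intro (ts q) (ts q) (ts∈Cen q) (inj₁ refl)) (λ q r → S-intro (ts q) _ (ts∈Cen q) (inj₂ (Nb.enum-∈ q r)))

  inStar : ∀ q x → St.Member q x → InStar (ts q) x
  inStar q x (inj₁ e) = inj₁ e
  inStar q x (inj₂ (r , refl)) = inj₂ (Nb.enum-∈ q r)

  disjoint : ∀ q q′ x → St.Member q x → St.Member q′ x → q ≡ q′
  disjoint q q′ x mq mq′ = ts-injective q q′ (star-disjoint _ _ x (ts∈Cen q) (ts∈Cen q′) (inStar q x mq) (inStar q′ x mq′))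

  stars : St.AllStars disjoint (count Cen)
  stars = St.allStars disjoint

  module A₀ = St.AllStars stars

  S-sat : ∀ j → S (par j) ≡ true → S (suc j) ≡ true → Sat A₀.f j
  S-sat j p q = [ down , up ]′ (S-edge j p q)
    where
    starEdge : ∀ t x → Cen t ≡ true → nb t x ≡ true → E (sign t x) (A₀.f ⟨$⟩ʳ t) (A₀.f ⟨$⟩ʳ x) ≡ true
    starEdge t x c b = go (ts-surjective t c)
      where
      go : (∃ λ q → ts q ≡ t) → E (sign t x) (A₀.f ⟨$⟩ʳ t) (A₀.f ⟨$⟩ʳ x) ≡ true
      go (q , refl) = let (r , e) = Nb.enum-surjective q x b in
        subst (λ x → E (sign t x) (A₀.f ⟨$⟩ʳ t) (A₀.f ⟨$⟩ʳ x) ≡ true) e (A₀.edges q r (toℕ<n q))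
    down : Cen (par j) ≡ true → Sat A₀.f j
    down c = sat-via-parent A₀.f j (starEdge (par j) (suc j) c (nb-down j))
    up : Cen (suc j) ≡ true → Sat A₀.f j
    up c = sat-via-child A₀.f j (starEdge (suc j) (par j) c (nb-up j))

  filled : ∃ λ (f : Permutation′ (suc n′)) → (∀ x → S x ≡ true → f ⟨$⟩ʳ x ≡ A₀.f ⟨$⟩ʳ x) ×
      (∀ j → A (par j) ≡ true → A (suc j) ≡ true → Sat f j)
  filled = X₀.fillA g≥1 A≤g A₀.f S-sat

  f₁ : Permutation′ (suc n′)
  f₁ = proj₁ filled

  rest : V → Bool
  rest y = not (A (f₁ ⟨$⟩ˡ y))

  module Rest = Enumeration (enumerate rest)

  d≤rest : dbl j u ≤ count rest
  d≤rest = +-cancelˡ-≤ (count A) _ _ (≤-trans A+d≤ (≤-reflexive (sym (trans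
    (cong (_+ count rest) (sym (count-permute (Data.Fin.Permutation.flip f₁) A))) (count-not (λ y → A (f₁ ⟨$⟩ˡ y)))))))

  U : Fin (dbl j u) → V
  U x = Rest.enum (Data.Fin.inject≤ x d≤rest)

  U-injective : Injective₁ U
  U-injective x x′ e = inject≤-injective d≤rest d≤rest x x′ (Rest.enum-injective _ _ e)

  sets : Fin (2 * nn) → V → Bool
  sets τ = let (s , z) = unpair {2} {nn} τ in E (boolOf s) z

  -- Restriction to d of the n vertices costs a neighbourhood at most n - d elements, so n/2 + g -
  -- (n - d) remain, which is at least half of d plus the slack by `slack≤g`.
  U-fair : Fair sets U (slack (8 * suc θ′ * y) j)
  U-fair τ = bound (count (sets τ)) (count (λ q → sets τ (U q))) (deg _ _) (count-restrict U U-injective (sets τ))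
    where
    d = dbl j u
    sl = slack (8 * suc θ′ * y) j
    bound : ∀ a b → nn + 2 * g ≤ 2 * a → a + d ≤ b + nn → d + sl ≤ 2 * b
    bound a b h₁ h₂ = +-cancelʳ-≤ (2 * nn + d) (d + sl) (2 * b) (begin
      d + sl + (2 * nn + d) ≡⟨ lem d sl nn ⟩
      (nn + sl) + (nn + 2 * d) ≤⟨ +-monoˡ-≤ (nn + 2 * d) slack≤g ⟩
      (2 * g + d) + (nn + 2 * d) ≡⟨ lem′ g d nn ⟩
      (nn + 2 * g) + 2 * d + d ≤⟨ +-monoˡ-≤ d (+-monoˡ-≤ (2 * d) h₁) ⟩
      2 * a + 2 * d + d ≡⟨ cong (_+ d) (sym (*-distribˡ-+ 2 a d)) ⟩
      2 * (a + d) + d ≤⟨ +-monoˡ-≤ d (*-monoʳ-≤ 2 h₂) ⟩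
      2 * (b + nn) + d ≡⟨ lem″ b nn d ⟩
      2 * b + (2 * nn + d) ∎)
      where
      open ≤-Reasoning
      lem : ∀ d s n → d + s + (2 * n + d) ≡ (n + s) + (n + 2 * d)
      lem = solve-∀
      lem′ : ∀ g d n → (2 * g + d) + (n + 2 * d) ≡ (n + 2 * g) + 2 * d + d
      lem′ = solve-∀
      lem″ : ∀ b n d → 2 * (b + n) + d ≡ 2 * b + (2 * n + d)
      lem″ = solve-∀

  parts : Parts sets U (2 ^ j) u
  parts = splitParts θ′ y j u sets U d≤ y≥ U-injective U-fair

  open Parts parts

  fair : ∀ c s z → u ≤ 2 * count (λ q → E s z (part c q))
  fair c s z = ≤-trans (≤-reflexive (sym (+-identityʳ u))) (≤-trans (part-fair c (pair (finOf s) z))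
    (≤-reflexive (trans (cong (2 *_) (sum-cong-≗ λ q → cong (λ p → 𝟙 (E (boolOf (proj₁ p)) (proj₂ p) (part c q))) (unpair-pair (finOf s) z)))
      (cong (λ s → 2 * count (λ q → E s z (part c q))) (boolOf-finOf s)))))

  avoid : ∀ x c q → A x ≡ true → f₁ ⟨$⟩ʳ x ≢ part c q
  avoid x c q a e = let (z , e′) = part-⊆ c q in
    true≢false a (trans (cong A (trans (sym (inverseˡ f₁)) (cong (f₁ ⟨$⟩ˡ_) (trans e e′)))) (not-true (Rest.enum-∈ (Data.Fin.inject≤ z d≤rest))))

  placed : ∃ λ (f : Permutation′ (suc n′)) → (∀ x → A x ≡ true → f ⟨$⟩ʳ x ≡ f₁ ⟨$⟩ʳ x) ×
    (∀ j → L (par j) ≡ false → L (suc j) ≡ false → Sat f j)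
  placed = Classes.placeClasses E E-sym T Dc part fair part-injective f₁ avoid (proj₂ (proj₂ filled)) n<

  f₂ : Permutation′ (suc n′)
  f₂ = proj₁ placed

  f₂≡ : ∀ x → S x ≡ true → f₂ ⟨$⟩ʳ x ≡ A₀.f ⟨$⟩ʳ x
  f₂≡ x Sx = trans (proj₁ (proj₂ placed) x (S⇒A x Sx)) (proj₁ (proj₂ filled) x Sx)

  module Ab = Absorption E E-sym g e deg n≤eg T Dc tests index tests-index ts ts-injective ts∈Cen f₂ A₀.good

  covers : ∀ q τ → A₀.good q τ ≡ true → Ab.CoversAll f₂ (ts q) (tests τ)
  covers q τ h = let (c₁ , c₂ , c₃) = A₀.covers q τ (toℕ<n q) h ; centre = f₂≡ (ts q) (S-intro _ _ (ts∈Cen q) (inj₁ refl)) in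
    trans (cong (E _ _) centre) c₁ , trans (cong (E _ _) centre) c₂ , λ x b → let (r , e) = Nb.enum-surjective q x b in
      trans (cong (E _ _) (f₂≡ x (S-intro _ _ (ts∈Cen q) (inj₂ b))))
        (subst (λ x → E (sign (ts q) x) (Test.w (tests τ)) (A₀.f ⟨$⟩ʳ x) ≡ true) e (c₃ r (toℕ<n r)))

  enough : ∀ τ → count L < count (λ q → A₀.good q τ)
  enough τ = ≰⇒> λ H≤L → <-irrefl refl (<-≤-trans many (≤-trans (St.hits-many disjoint p τ Xp≤)
    (*-monoˡ-≤ (testCount nn) (^-monoʳ-≤ 2 H≤L))))

  absorbed : ∃ λ (f : Permutation′ (suc n′)) → ∀ j → Sat f j
  absorbed = Ab.absorbAll covers enough (proj₂ (proj₂ placed))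

-- Choosing words avoided by few paths

module Fold {n′ Δ : ℕ} (T : RTree n′ Δ) where
  open Tree T

  induction : (Q : Fin (suc n′) → Set) → Q zero → (∀ j → Q (par j) → Q (suc j)) → ∀ x → Q x
  induction Q base step x = go (toℕ x) x ≤-refl
    where
    go : ∀ k x → toℕ x ≤ k → Q x
    go k zero _ = base
    go (suc k) (suc j) (s≤s le) = step j (go k (par j) (≤-trans (par≤ j) le))

  private
    -- Recursion along `par` is not structural, so it runs on fuel; `fold` supplies enough of it
    -- never to reach the default value.
    foldUpTo : {X : Set} → X → (Fin n′ → X → X) → ℕ → Fin (suc n′) → X
    foldUpTo x₀ step k zero = x₀
    foldUpTo x₀ step zero (suc j) = x₀
    foldUpTo x₀ step (suc k) (suc j) = step j (foldUpTo x₀ step k (par j))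

    irrelevant : {X : Set} (x₀ : X) (step : Fin n′ → X → X) → ∀ k k′ x → toℕ x ≤ k → toℕ x ≤ k′ →
      foldUpTo x₀ step k x ≡ foldUpTo x₀ step k′ x
    irrelevant x₀ step k k′ zero _ _ = refl
    irrelevant x₀ step (suc k) (suc k′) (suc j) (s≤s p) (s≤s q) =
      cong (step j) (irrelevant x₀ step k k′ (par j) (≤-trans (par≤ j) p) (≤-trans (par≤ j) q))

  opaque
    fold : {X : Set} → X → (Fin n′ → X → X) → Fin (suc n′) → X
    fold x₀ step = foldUpTo x₀ step n′

    fold-zero : {X : Set} (x₀ : X) (step : Fin n′ → X → X) → fold x₀ step zero ≡ x₀
    fold-zero x₀ step = refl

    fold-suc : {X : Set} (x₀ : X) (step : Fin n′ → X → X) (j : Fin n′) → fold x₀ step (suc j) ≡ step j (fold x₀ step (par j))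
    fold-suc x₀ step j = irrelevant x₀ step n′ (suc n′) (suc j) (toℕ<n j) (m≤n⇒m≤1+n (toℕ<n j))

avoids : {Δ : ℕ} → (ℕ → Fin Δ) → List (Fin Δ) → Bool
avoids c [] = true
avoids c (p ∷ ps) = not (p == c 0) ∧ avoids (c ∘ suc) ps

avoids-snoc : ∀ {Δ} (c : ℕ → Fin Δ) ps p → avoids c (ps ∷ʳ p) ≡ avoids c ps ∧ not (p == c (length ps))
avoids-snoc c [] p = ∧-comm (not (p == c 0)) true
avoids-snoc c (x ∷ ps) p = trans (cong (not (x == c 0) ∧_) (avoids-snoc (c ∘ suc) ps p)) (sym (∧-assoc (not (x == c 0)) _ _))

-- The number of words of length d over an alphabet of size suc Δ avoided by a path of length l.
words : ℕ → ℕ → ℕ → ℕ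
words Δ d l = Δ ^ l * suc Δ ^ (d ∸ l)

count-≢ : ∀ {Δ} (p : Fin (suc Δ)) → count (λ c → not (p == c)) ≡ Δ
count-≢ {Δ} p = suc-inj (trans (cong (_+ count (λ c → not (p == c))) (sym (count-single p))) (count-not (p ==_)))
  where
  suc-inj : ∀ {a b : ℕ} → suc a ≡ suc b → a ≡ b
  suc-inj refl = refl

-- The method of conditional expectations: `G c` is the scaled expected weight of the paths that
-- avoid a word starting with `c`, and a letter of at most average value is taken.
chooseWord : ∀ {Δ} d (w : Fin n → ℕ) (ps : Fin n → List (Fin (suc Δ))) → (∀ x → length (ps x) ≤ d) →
  ∃ λ (c : ℕ → Fin (suc Δ)) → suc Δ ^ d * sum (λ x → w x * 𝟙 (avoids c (ps x))) ≤ sum (λ x → w x * words Δ d (length (ps x)))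
chooseWord {Δ = Δ} zero w ps len = (λ _ → zero) , ≤-reflexive (trans (*-identityˡ _) (sum-cong-≗ λ x → cong (w x *_) (empty (ps x) (len x))))
  where
  empty : ∀ ps → length ps ≤ 0 → 𝟙 (avoids (λ _ → zero) ps) ≡ words Δ 0 (length ps)
  empty [] _ = refl
chooseWord {n} {Δ} (suc d) w ps len = go (average-min G)
  where
  keep : List (Fin (suc Δ)) → Fin (suc Δ) → Bool
  keep [] c = true
  keep (p ∷ _) c = not (p == c)
  rest : List (Fin (suc Δ)) → List (Fin (suc Δ))
  rest [] = []
  rest (_ ∷ ps) = ps
  rest-length : ∀ ps → length ps ≤ suc d → length (rest ps) ≤ d
  rest-length [] _ = z≤n
  rest-length (_ ∷ ps) (s≤s h) = h
  value : Fin n → ℕ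
  value x = words Δ d (length (rest (ps x)))
  G : Fin (suc Δ) → ℕ
  G c = sum (λ x → w x * 𝟙 (keep (ps x) c) * value x)
  keep-count : ∀ ps → count (keep ps) * words Δ d (length (rest ps)) ≡ words Δ (suc d) (length ps)
  keep-count [] = trans (cong (_* words Δ d 0) (trans (sum-const (suc Δ) 1) (*-identityʳ (suc Δ)))) (lem (suc Δ) (suc Δ ^ d))
    where
    lem : ∀ a b → a * (1 * b) ≡ 1 * (a * b)
    lem = solve-∀
  keep-count (p ∷ ps) = trans (cong (_* words Δ d (length ps)) (count-≢ p)) (sym (*-assoc Δ (Δ ^ length ps) (suc Δ ^ (d ∸ length ps))))
  total : sum G ≡ sum (λ x → w x * words Δ (suc d) (length (ps x)))
  total = trans (∑-comm (λ c x → w x * 𝟙 (keep (ps x) c) * value x)) (sum-cong-≗ λ x →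
    trans (sum-*ʳ (value x) (λ c → w x * 𝟙 (keep (ps x) c))) (trans (cong (_* value x) (sum-*ˡ (w x) (λ c → 𝟙 (keep (ps x) c))))
      (trans (*-assoc (w x) _ (value x)) (cong (w x *_) (keep-count (ps x))))))
  go : (∃ λ c → suc Δ * G c ≤ sum G) → _
  go (c₀ , le) = extend (chooseWord d (λ x → w x * 𝟙 (keep (ps x) c₀)) (λ x → rest (ps x)) (λ x → rest-length (ps x) (len x)))
    where
    extend : (∃ λ (c : ℕ → Fin (suc Δ)) → suc Δ ^ d * sum (λ x → w x * 𝟙 (keep (ps x) c₀) * 𝟙 (avoids c (rest (ps x)))) ≤ G c₀) →
      ∃ λ (c : ℕ → Fin (suc Δ)) → suc Δ ^ suc d * sum (λ x → w x * 𝟙 (avoids c (ps x))) ≤ sum (λ x → w x * words Δ (suc d) (length (ps x)))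
    extend (c , le′) = c₁ , (begin
      suc Δ * suc Δ ^ d * sum (λ x → w x * 𝟙 (avoids c₁ (ps x))) ≡⟨ *-assoc (suc Δ) (suc Δ ^ d) _ ⟩
      suc Δ * (suc Δ ^ d * sum (λ x → w x * 𝟙 (avoids c₁ (ps x)))) ≡⟨ cong (λ z → suc Δ * (suc Δ ^ d * z)) (sum-cong-≗ λ x → trans (cong (w x *_) (by (ps x))) (sym (*-assoc (w x) _ _))) ⟩
      suc Δ * (suc Δ ^ d * sum (λ x → w x * 𝟙 (keep (ps x) c₀) * 𝟙 (avoids c (rest (ps x))))) ≤⟨ *-monoʳ-≤ (suc Δ) le′ ⟩
      suc Δ * G c₀ ≤⟨ le ⟩
      sum G ≡⟨ total ⟩
      sum (λ x → w x * words Δ (suc d) (length (ps x))) ∎)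
      where
      open ≤-Reasoning
      c₁ : ℕ → Fin (suc Δ)
      c₁ zero = c₀
      c₁ (suc i) = c i
      by : ∀ ps → 𝟙 (avoids c₁ ps) ≡ 𝟙 (keep ps c₀) * 𝟙 (avoids c (rest ps))
      by [] = refl
      by (p ∷ ps) = sym (𝟙-* (not (p == c₀)) (avoids c ps))

rotate : ℕ → ℕ → ℕ
rotate d o = if does (o Data.Nat.≟ d) then 0 else suc o

rotate-end : ∀ {d o} → o ≡ d → rotate d o ≡ 0
rotate-end {d} {o} e = cong (λ b → if b then 0 else suc o) (dec-true (o Data.Nat.≟ d) e)

rotate-step : ∀ {d o} → o ≢ d → rotate d o ≡ suc o
rotate-step {d} {o} e = cong (λ b → if b then 0 else suc o) (dec-false (o Data.Nat.≟ d) e)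

sum-last : ∀ d (g : ℕ → ℕ) → sum {suc d} (λ r → g (toℕ r)) ≡ sum {d} (λ r → g (toℕ r)) + g d
sum-last zero g = trans (sum-suc _) (trans (cong (g 0 +_) (sum-zero _)) (trans (+-identityʳ (g 0)) (cong (_+ g 0) (sym (sum-zero (λ r → g (toℕ r)))))))
sum-last (suc d) g = trans (sum-suc _) (trans (cong (g 0 +_) (sum-last d (g ∘ suc)))
  (trans (sym (+-assoc (g 0) _ (g (suc d)))) (cong (_+ g (suc d)) (sym (sum-suc _)))))

sum-rotate : ∀ d (g : ℕ → ℕ) → sum {suc d} (λ r → g (rotate d (toℕ r))) ≡ sum {suc d} (λ r → g (toℕ r))
sum-rotate d g = trans (sum-last d (g ∘ rotate d)) (trans (cong₂ _+_ (sum-cong-≗ {d} λ r → cong g (rotate-step (<⇒≢ (toℕ<n r)))) (cong g (rotate-end refl)))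
  (trans (+-comm _ (g 0)) (sym (sum-suc (λ r → g (toℕ r))))))

-- A geometric sum with value (Δ + 1)^(d+1) - Δ^(d+1).
sum-words : ∀ Δ d → sum {suc d} (λ r → words Δ d (toℕ r)) ≤ suc Δ ^ suc d
sum-words Δ zero = ≤-trans (≤-reflexive (trans (sum-suc _) (cong (1 +_) (sum-zero _)))) (s≤s z≤n)
sum-words Δ (suc d) = begin
  sum {suc (suc d)} (λ r → words Δ (suc d) (toℕ r)) ≡⟨ sum-suc _ ⟩
  1 * suc Δ ^ suc d + sum {suc d} (λ r → words Δ (suc d) (suc (toℕ r))) ≡⟨ cong₂ _+_ (*-identityˡ _) (trans (sum-cong-≗ {suc d} λ r → *-assoc Δ (Δ ^ toℕ r) _) (sum-*ˡ {suc d} Δ (λ r → words Δ d (toℕ r)))) ⟩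
  suc Δ ^ suc d + Δ * sum {suc d} (λ r → words Δ d (toℕ r)) ≤⟨ +-monoʳ-≤ (suc Δ ^ suc d) (*-monoʳ-≤ Δ (sum-words Δ d)) ⟩
  suc Δ * suc Δ ^ suc d ∎
  where open ≤-Reasoning

-- L consists of the vertices whose path from the last vertex of offset 0 avoids the word c;
-- r is the offset of the root, and offsets are taken modulo suc d.
module Separator {n′ Δ : ℕ} (T : RTree n′ (suc Δ)) (d : ℕ) where
  open Tree T
  open Fold T

  rank : Fin n′ → ℕ
  rank j = rankIn (λ i → par i == par j) j

  rank< : ∀ j → rank j < suc Δ
  rank< j = <-≤-trans (rankIn<count (λ i → par i == par j) j (==-refl (par j))) (children≤ (par j))

  rk : Fin n′ → Fin (suc Δ)
  rk j = fromℕ< (rank< j)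

  rk-injective : ∀ i j → par i ≡ par j → rk i ≡ rk j → i ≡ j
  rk-injective i j e h = rankIn-injective (λ x → par x == par j) i j (trans (cong (_== par j) e) (==-refl (par j))) (==-refl (par j))
    (trans (cong (λ p → rankIn (λ x → par x == p) i) (sym e)) (trans (sym (toℕ-fromℕ< (rank< i))) (trans (cong toℕ h) (toℕ-fromℕ< (rank< j)))))

  extendPath : Fin n′ → List (Fin (suc Δ)) → List (Fin (suc Δ))
  extendPath j ps = if does (length ps Data.Nat.≟ d) then [] else ps ∷ʳ rk j

  -- A root of offset `r` has no true path of that length and gets a fictitious one; its letters may
  -- be arbitrary, as the average depends on lengths only.
  path : ℕ → Fin (suc n′) → List (Fin (suc Δ))
  path r = fold (replicate r zero) extendPath

  path-suc : ∀ r j → path r (suc j) ≡ extendPath j (path r (par j))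
  path-suc r j = fold-suc (replicate r zero) extendPath j

  extendPath-length : ∀ j ps → length (extendPath j ps) ≡ rotate d (length ps)
  extendPath-length j ps = by (does (length ps Data.Nat.≟ d))
    where
    by : ∀ b → length (if b then [] else ps ∷ʳ rk j) ≡ (if b then 0 else suc (length ps))
    by true = refl
    by false = trans (length-++ ps) (+-comm (length ps) 1)

  path-length-zero : ∀ r → length (path r zero) ≡ r
  path-length-zero r = trans (cong length (fold-zero (replicate r zero) extendPath)) (length-replicate r)

  path-length-suc : ∀ r j → length (path r (suc j)) ≡ rotate d (length (path r (par j)))
  path-length-suc r j = trans (cong length (path-suc r j)) (extendPath-length j (path r (par j)))

  path≤ : ∀ r → r ≤ d → ∀ x → length (path r x) ≤ d
  path≤ r r≤d = induction _ (≤-trans (≤-reflexive (path-length-zero r)) r≤d) λ j ih →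
    ≤-trans (≤-reflexive (path-length-suc r j)) (rotate≤ (length (path r (par j))) ih)
    where
    rotate≤ : ∀ o → o ≤ d → rotate d o ≤ d
    rotate≤ o o≤d = by (o Data.Nat.≟ d)
      where
      by : Dec (o ≡ d) → rotate d o ≤ d
      by (yes e) = ≤-trans (≤-reflexive (rotate-end e)) z≤n
      by (no ¬e) = ≤-trans (≤-reflexive (rotate-step ¬e)) (≤∧≢⇒< o≤d ¬e)

  -- Over all offsets of the root, every vertex takes every offset exactly once.
  sum-offsets : ∀ x (h : ℕ → ℕ) → sum {suc d} (λ r → h (length (path (toℕ r) x))) ≡ sum {suc d} (λ r → h (toℕ r))
  sum-offsets = induction _ (λ h → sum-cong-≗ {suc d} λ r → cong h (path-length-zero (toℕ r)))
    λ j ih h → trans (sum-cong-≗ {suc d} λ r → cong h (path-length-suc (toℕ r) j)) (trans (ih (h ∘ rotate d)) (sum-rotate d h))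

  -- A vertex of offset l avoids a share (Δ/(Δ+1))^l of the words. Over all root offsets it takes
  -- each l once, and these shares sum to at most Δ + 1; so some offset and word keep at most
  -- n(Δ+1)/(d+1) vertices.
  separator : ∃ λ r → ∃ λ (c : ℕ → Fin (suc Δ)) → (r ≤ d) × (suc d * count (λ x → avoids c (path r x)) ≤ suc n′ * suc Δ)
  separator = go (average-min {d} size)
    where
    chosen : ∀ (r : Fin (suc d)) → _
    chosen r = chooseWord {suc n′} {Δ} d (λ _ → 1) (path (toℕ r)) (path≤ (toℕ r) (≤-pred (toℕ<n r)))
    size : Fin (suc d) → ℕ
    size r = count (λ x → avoids (proj₁ (chosen r)) (path (toℕ r) x))
    size≤ : ∀ r → suc Δ ^ d * size r ≤ sum (λ x → words Δ d (length (path (toℕ r) x)))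
    size≤ r = subst₂ (λ a b → suc Δ ^ d * a ≤ b) (sum-cong-≗ λ x → *-identityˡ _) (sum-cong-≗ λ x → *-identityˡ _) (proj₂ (chosen r))
    total : suc Δ ^ d * sum size ≤ suc n′ * (suc Δ * suc Δ ^ d)
    total = begin
      suc Δ ^ d * sum size ≡⟨ sym (sum-*ˡ (suc Δ ^ d) size) ⟩
      sum (λ r → suc Δ ^ d * size r) ≤⟨ sum-mono size≤ ⟩
      sum {suc d} (λ r → sum (λ x → words Δ d (length (path (toℕ r) x)))) ≡⟨ ∑-comm {suc d} (λ r x → words Δ d (length (path (toℕ r) x))) ⟩
      sum (λ x → sum {suc d} (λ r → words Δ d (length (path (toℕ r) x)))) ≤⟨ sum-mono (λ x → ≤-trans (≤-reflexive (sum-offsets x (words Δ d))) (sum-words Δ d)) ⟩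
      sum {suc n′} (λ x → suc Δ ^ suc d) ≡⟨ sum-const (suc n′) (suc Δ ^ suc d) ⟩
      suc n′ * (suc Δ * suc Δ ^ d) ∎
      where open ≤-Reasoning
    go : (∃ λ r → suc d * size r ≤ sum size) → _
    go (r , le) = toℕ r , proj₁ (chosen r) , ≤-pred (toℕ<n r) ,
      ≤-trans le (*-cancelˡ-≤ (suc Δ ^ d) ⦃ m^n≢0 (suc Δ) d ⦄ (≤-trans total (≤-reflexive (lem (suc n′) (suc Δ) (suc Δ ^ d)))))
      where
      lem : ∀ a b c → a * (b * c) ≡ c * (a * b)
      lem = solve-∀

-- Components of the tree minus the separator

code≤ : ℕ → ℕ → ℕ
code≤ Δ zero = 0
code≤ Δ (suc l) = suc Δ + suc Δ * code≤ Δ l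

mixed-radix : ∀ {Δ} (p q : Fin (suc Δ)) a b → toℕ p + suc Δ * a ≡ toℕ q + suc Δ * b → (p ≡ q) × (a ≡ b)
mixed-radix {Δ} p q a b e = toℕ-injective p≡q , *-cancelˡ-≡ a b (suc Δ) (+-cancelˡ-≡ (toℕ p) _ _ (trans e (cong (_+ suc Δ * b) (sym p≡q))))
  where
  digit : ∀ (p : Fin (suc Δ)) a → (toℕ p + suc Δ * a) % suc Δ ≡ toℕ p
  digit p a = trans (cong (λ z → (toℕ p + z) % suc Δ) (*-comm (suc Δ) a)) (trans ([m+kn]%n≡m%n (toℕ p) a (suc Δ)) (m<n⇒m%n≡m (toℕ<n p)))
  p≡q : toℕ p ≡ toℕ q
  p≡q = trans (sym (digit p a)) (trans (cong (_% suc Δ) e) (digit q b))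

-- The components of T - L: a vertex is determined by the top of its component and by its address,
-- which lists (as digits) the ranks along the path from the top.
module Components {n′ Δ : ℕ} (T : RTree n′ (suc Δ)) (d : ℕ) (r : ℕ) (r≤d : r ≤ d) (c : ℕ → Fin (suc Δ)) where
  open Tree T
  open Fold T
  open Separator T d

  V : Set
  V = Fin (suc n′)

  opaque
    L : V → Bool
    L x = avoids c (path r x)

    L-def : ∀ x → L x ≡ avoids c (path r x)
    L-def x = refl

  -- The empty path avoids every word, so all vertices of offset 0 lie in L, and a vertex outside L
  -- has continued the path of its parent. If that path avoids the word, the step failed at the last
  -- letter, which fixes the rank of the child.
  L-step : ∀ j → L (suc j) ≡ false →
    (length (path r (suc j)) ≡ suc (length (path r (par j)))) ×
    (L (par j) ≡ true → rk j ≡ c (length (path r (par j))))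
  L-step j ¬Lj = by (length (path r (par j)) Data.Nat.≟ d)
    where
    ps = path r (par j)
    by : Dec (length ps ≡ d) → _
    by (yes e) = ⊥-elim (true≢false (trans (L-def (suc j)) (cong (avoids c) (trans (path-suc r j)
      (cong (λ b → if b then [] else ps ∷ʳ rk j) (dec-true (length ps Data.Nat.≟ d) e))))) ¬Lj)
    by (no ¬e) = trans (path-length-suc r j) (rotate-step ¬e) , λ Lp →
      [ (λ e → ==⇒≡ e) , (λ e → ⊥-elim (true≢false (trans (L-def (suc j)) (trans (cong (avoids c) unfold)
          (trans (avoids-snoc c ps (rk j)) (∧-join (trans (sym (L-def (par j))) Lp) (not-false e))))) ¬Lj)) ]′ (bool-cases (rk j == c (length ps)))
      where
      unfold : path r (suc j) ≡ ps ∷ʳ rk j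
      unfold = trans (path-suc r j) (cong (λ b → if b then [] else ps ∷ʳ rk j) (dec-false (length ps Data.Nat.≟ d) ¬e))

  one-child : ∀ i j → par i ≡ par j → L (par i) ≡ true → L (suc i) ≡ false → L (suc j) ≡ false → i ≡ j
  one-child i j e Lp ¬Li ¬Lj = rk-injective i j e (trans (proj₂ (L-step i ¬Li) Lp)
    (trans (cong (λ x → c (length (path r x))) e) (sym (proj₂ (L-step j ¬Lj) (trans (cong L (sym e)) Lp)))))

  private
    -- A vertex of L is its own top. An address is a numeral in bijective base Δ + 1 with digits
    -- rank + 1, so 0 belongs to tops only and numerals of different lengths differ.
    place : Fin n′ → V × ℕ → V × ℕ
    place j (t , a) = if L (suc j) ∨ L (par j) then (suc j , 0) else (t , suc (toℕ (rk j) + suc Δ * a))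

    position : V → V × ℕ
    position = fold (zero , 0) place

  opaque
    top : V → V
    top x = proj₁ (position x)

    ad : V → ℕ
    ad x = proj₂ (position x)

    top-zero : top zero ≡ zero
    top-zero = cong proj₁ (fold-zero (zero , 0) place)

    ad-zero : ad zero ≡ 0
    ad-zero = cong proj₂ (fold-zero (zero , 0) place)

    position-suc : ∀ j b → L (suc j) ∨ L (par j) ≡ b →
      (top (suc j) , ad (suc j)) ≡ (if b then (suc j , 0) else (top (par j) , suc (toℕ (rk j) + suc Δ * ad (par j))))
    position-suc j b e = trans (fold-suc (zero , 0) place j)
      (cong (λ b → if b then (suc j , 0) else (top (par j) , suc (toℕ (rk j) + suc Δ * ad (par j)))) e)

  top-top : ∀ j → (L (suc j) ≡ true) ⊎ (L (par j) ≡ true) → top (suc j) ≡ suc j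
  top-top j h = cong proj₁ (position-suc j true ([ ∨-inl , ∨-inr {L (suc j)} ]′ h))

  ad-top : ∀ j → (L (suc j) ≡ true) ⊎ (L (par j) ≡ true) → ad (suc j) ≡ 0
  ad-top j h = cong proj₂ (position-suc j true ([ ∨-inl , ∨-inr {L (suc j)} ]′ h))

  ∨-both-false : ∀ {a b} → a ≡ false → b ≡ false → a ∨ b ≡ false
  ∨-both-false refl refl = refl

  top-inner : ∀ j → L (suc j) ≡ false → L (par j) ≡ false → top (suc j) ≡ top (par j)
  top-inner j p q = cong proj₁ (position-suc j false (∨-both-false p q))

  ad-inner : ∀ j → L (suc j) ≡ false → L (par j) ≡ false → ad (suc j) ≡ suc (toℕ (rk j) + suc Δ * ad (par j))
  ad-inner j p q = cong proj₂ (position-suc j false (∨-both-false p q))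

  data View (j : Fin n′) : Set where
    isTop : (L (suc j) ≡ true) ⊎ (L (par j) ≡ true) → View j
    isInner : L (suc j) ≡ false → L (par j) ≡ false → View j

  view : ∀ j → View j
  view j = [ (λ p → isTop (inj₁ p)) , (λ p → [ (λ q → isTop (inj₂ q)) , isInner p ]′ (bool-cases (L (par j)))) ]′ (bool-cases (L (suc j)))

  address-injective : ∀ x y → top x ≡ top y → ad x ≡ ad y → x ≡ y
  address-injective = induction _ base step
    where
    ad0⇒top : ∀ y → ad y ≡ 0 → top y ≡ y
    ad0⇒top zero _ = top-zero
    ad0⇒top (suc j) e = by (view j)
      where
      by : View j → top (suc j) ≡ suc j
      by (isTop h) = top-top j h
      by (isInner p q) = case trans (sym e) (ad-inner j p q) of λ ()
    base : ∀ y → top zero ≡ top y → ad zero ≡ ad y → zero ≡ y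
    base y t a = trans (sym top-zero) (trans t (ad0⇒top y (trans (sym a) ad-zero)))
    step : ∀ i → (∀ y → top (par i) ≡ top y → ad (par i) ≡ ad y → par i ≡ y) → ∀ y → top (suc i) ≡ top y → ad (suc i) ≡ ad y → suc i ≡ y
    step i ih y t a = by (view i) y t a
      where
      by : View i → ∀ y → top (suc i) ≡ top y → ad (suc i) ≡ ad y → suc i ≡ y
      by (isTop h) y t a = trans (sym (top-top i h)) (trans t (ad0⇒top y (trans (sym a) (ad-top i h))))
      by (isInner p q) zero t a = case trans (sym (ad-inner i p q)) (trans a ad-zero) of λ ()
      by (isInner p q) (suc j) t a = both (view j)
        where
        both : View j → suc i ≡ suc j
        both (isTop h) = case trans (sym (ad-inner i p q)) (trans a (ad-top j h)) of λ ()
        both (isInner p′ q′) = let (e₁ , e₂) = mixed-radix (rk i) (rk j) _ _ (cong Data.Nat.pred (trans (sym (ad-inner i p q)) (trans a (ad-inner j p′ q′)))) in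
          cong suc (rk-injective i j (ih (par j) (trans (sym (top-inner i p q)) (trans t (top-inner j p′ q′))) e₂) e₁)

  code≤-mono : ∀ {l l′} → l ≤ l′ → code≤ Δ l ≤ code≤ Δ l′
  code≤-mono z≤n = z≤n
  code≤-mono (s≤s h) = +-monoʳ-≤ (suc Δ) (*-monoʳ-≤ (suc Δ) (code≤-mono h))

  -- The number of possible addresses, hence a bound on the size of a component.
  C : ℕ
  C = suc (code≤ Δ d)

  ad< : ∀ x → ad x < C
  ad< x = s≤s (≤-trans (bound x) (code≤-mono (path≤ r r≤d x)))
    where
    bound : ∀ x → ad x ≤ code≤ Δ (length (path r x))
    bound = induction _ (≤-trans (≤-reflexive ad-zero) z≤n) λ j ih → by j ih (view j)
      where
      by : ∀ j → ad (par j) ≤ code≤ Δ (length (path r (par j))) → View j → ad (suc j) ≤ code≤ Δ (length (path r (suc j)))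
      by j ih (isTop h) = ≤-trans (≤-reflexive (ad-top j h)) z≤n
      by j ih (isInner p q) = begin
        ad (suc j) ≡⟨ ad-inner j p q ⟩
        suc (toℕ (rk j)) + suc Δ * ad (par j) ≤⟨ +-mono-≤ (toℕ<n (rk j)) (*-monoʳ-≤ (suc Δ) ih) ⟩
        code≤ Δ (suc (length (path r (par j)))) ≡⟨ cong (code≤ Δ) (sym (proj₁ (L-step j p))) ⟩
        code≤ Δ (length (path r (suc j))) ∎
        where open ≤-Reasoning

  address : V → Fin C
  address x = fromℕ< (ad< x)

  toℕ-address : ∀ x → toℕ (address x) ≡ ad x
  toℕ-address x = toℕ-fromℕ< (ad< x)

  top-invariant : (Q : V → Set) → (∀ j → L (suc j) ≡ false → L (par j) ≡ false → Q (suc j) → Q (par j)) →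
    ∀ x → L x ≡ false → Q x → Q (top x)
  top-invariant Q h = induction _ (λ _ q → subst Q (sym top-zero) q) λ j ih l q → by j ih l q (view j)
    where
    by : ∀ j → (L (par j) ≡ false → Q (par j) → Q (top (par j))) → L (suc j) ≡ false → Q (suc j) → View j → Q (top (suc j))
    by j ih l q (isTop t) = subst Q (sym (top-top j t)) q
    by j ih l q (isInner p p′) = subst Q (sym (top-inner j p p′)) (ih p′ (h j p p′ q))

  L-top : ∀ x → L x ≡ false → L (top x) ≡ false
  L-top x l = top-invariant (λ x → L x ≡ false) (λ j _ p _ → p) x l l

  top-idem : ∀ x → L x ≡ false → top (top x) ≡ top x
  top-idem x l = top-invariant (λ y → top y ≡ top x) (λ j p q e → trans (sym (top-inner j p q)) e) x l refl

-- Reserved components and centres of stars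

crossing : (F : ℕ → ℕ) (C θ : ℕ) → F 0 ≡ 0 → (∀ b → F (suc b) ≤ F b + C) → ∀ n → θ ≤ F n → ∃ λ b → (θ ≤ F b) × (F b ≤ θ + C)
crossing F C θ z h zero le = 0 , le , ≤-trans (≤-reflexive z) z≤n
crossing F C θ z h (suc n) le with θ ≤? F n
... | yes p = crossing F C θ z h n p
... | no ¬p = suc n , le , ≤-trans (h n) (+-monoˡ-≤ C (<⇒≤ (≰⇒> ¬p)))

-- Depth modulo 4 excludes centres one, two or three levels apart: adjacent centres, a common leaf
-- on a vertical path, and an edge between leaves of two stars.
next4 : Fin 4 → Fin 4
next4 zero = suc zero
next4 (suc zero) = suc (suc zero)
next4 (suc (suc zero)) = suc (suc (suc zero))
next4 (suc (suc (suc zero))) = zero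

next4≢ : ∀ x → next4 x ≢ x
next4≢ zero ()
next4≢ (suc zero) ()
next4≢ (suc (suc zero)) ()
next4≢ (suc (suc (suc zero))) ()

next4²≢ : ∀ x → next4 (next4 x) ≢ x
next4²≢ zero ()
next4²≢ (suc zero) ()
next4²≢ (suc (suc zero)) ()
next4²≢ (suc (suc (suc zero))) ()

next4³≢ : ∀ x → next4 (next4 (next4 x)) ≢ x
next4³≢ zero ()
next4³≢ (suc zero) ()
next4³≢ (suc (suc zero)) ()
next4³≢ (suc (suc (suc zero))) ()

-- Centres all have the same depth modulo 4, the same rank, and parents of the same rank, so a
-- centre is determined by its grandparent; this keeps the stars disjoint and far apart.
module Centres {n′ Δ : ℕ} (T : RTree n′ (suc Δ)) (d : ℕ) (r : ℕ) (r≤d : r ≤ d) (c : ℕ → Fin (suc Δ)) where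
  open Tree T
  open Fold T
  open Separator T d
  open Components T d r r≤d c

  below : ℕ → V → Bool
  below b x = not (L x) ∧ does (toℕ (top x) <? b)

  -- Raising `b` by one adds at most one component, so at most C vertices, and the count cannot jump
  -- over the window from θ to θ + C.
  threshold : ∀ θ → θ ≤ count (not ∘ L) → ∃ λ b → (θ ≤ count (below b)) × (count (below b) ≤ θ + C)
  threshold θ le = crossing (count ∘ below) C θ (count-false (below 0) λ x → ¬true⇒false λ h → case ≡true⇒ (toℕ (top x) <? 0) (proj₂ (∧-split {not (L x)} h)) of λ ())
    grow (suc n′) (≤-trans le (count-mono λ x h → ∧-join h (dec-true (toℕ (top x) <? suc n′) (toℕ<n (top x)))))
    where
    level : ℕ → V → Bool
    level b x = does (toℕ (top x) Data.Nat.≟ b)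
    grow : ∀ b → count (below (suc b)) ≤ count (below b) + C
    grow b = ≤-trans (≤-trans (count-mono {Q = λ x → below b x ∨ level b x} sub) (count-∨ (below b) (level b)))
      (+-monoʳ-≤ (count (below b)) (count-injection (level b) address λ x y p q e → address-injective x y
        (toℕ-injective (trans (≡true⇒ (toℕ (top x) Data.Nat.≟ b) p) (sym (≡true⇒ (toℕ (top y) Data.Nat.≟ b) q))))
        (trans (sym (toℕ-address x)) (trans (cong toℕ e) (toℕ-address y)))))
      where
      sub : ∀ x → below (suc b) x ≡ true → below b x ∨ level b x ≡ true
      sub x h = let (l , t) = ∧-split {not (L x)} h in
        [ (λ lt → ∨-inl (∧-join l (dec-true (toℕ (top x) <? b) lt))) , (λ eq → ∨-inr {below b x} (dec-true (toℕ (top x) Data.Nat.≟ b) eq)) ]′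
          (m≤n⇒m<n∨m≡n (≤-pred (≡true⇒ (toℕ (top x) <? suc b) t)))

  opaque
    depth4 : V → Fin 4
    depth4 = fold zero (λ _ → next4)

    depth4-suc : ∀ j → depth4 (suc j) ≡ next4 (depth4 (par j))
    depth4-suc j = fold-suc zero (λ _ → next4) j

  rankOf : V → Fin (suc Δ)
  rankOf zero = zero
  rankOf (suc j) = rk j

  rankOfPar : V → Fin (suc Δ)
  rankOfPar zero = zero
  rankOfPar (suc j) = rankOf (par j)

  kinds : ℕ
  kinds = 4 * (suc Δ * suc Δ)

  kind : V → Fin kinds
  kind t = pair (depth4 t) (pair (rankOfPar t) (rankOf t))

  kind-injective : ∀ t t′ → kind t ≡ kind t′ → (depth4 t ≡ depth4 t′) × (rankOfPar t ≡ rankOfPar t′) × (rankOf t ≡ rankOf t′)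
  kind-injective t t′ e = let e₁ = trans (sym (unpair-pair _ _)) (trans (cong unpair e) (unpair-pair _ _))
                              e₂ = trans (sym (unpair-pair _ _)) (trans (cong unpair (cong proj₂ e₁)) (unpair-pair _ _)) in
    cong proj₁ e₁ , cong proj₁ e₂ , cong proj₂ e₂

  module _ (b : ℕ) where

    A : V → Bool
    A = below b

    A⇒¬L : ∀ x → A x ≡ true → L x ≡ false
    A⇒¬L x h = not-true (proj₁ (∧-split h))

    A-inner : ∀ j → L (par j) ≡ false → L (suc j) ≡ false → A (par j) ≡ A (suc j)
    A-inner j p q = cong₂ (λ l t → not l ∧ does (toℕ t <? b)) (trans p (sym q)) (sym (top-inner j q p))

    isolated : V → Bool
    isolated t = not (∃ᵇ (λ x → L x ∧ nb t x))

    nb-sym : ∀ t x → nb t x ≡ nb x t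
    nb-sym t x = ∨-comm (child t x) (child x t)

    -- Double counting: a vertex that is not isolated has a neighbour in L, and each vertex of L has
    -- at most Δ + 2 neighbours. Isolation of a centre is what puts its whole star into A.
    A≤ : count A ≤ count (λ t → A t ∧ isolated t) + count L * (suc Δ + 1)
    A≤ = ≤-trans (count-∧not A (λ t → ∃ᵇ (λ x → L x ∧ nb t x))) (+-monoʳ-≤ _ (begin
      count (λ t → ∃ᵇ (λ x → L x ∧ nb t x)) ≤⟨ sum-mono (λ t → by t _ refl) ⟩
      sum (λ t → sum (λ x → 𝟙 (L x) * 𝟙 (nb t x))) ≡⟨ ∑-comm (λ t x → 𝟙 (L x) * 𝟙 (nb t x)) ⟩
      sum (λ x → sum (λ t → 𝟙 (L x) * 𝟙 (nb t x))) ≡⟨ sum-cong-≗ (λ x → sum-*ˡ (𝟙 (L x)) (λ t → 𝟙 (nb t x))) ⟩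
      sum (λ x → 𝟙 (L x) * count (λ t → nb t x)) ≤⟨ sum-mono (λ x → *-monoʳ-≤ (𝟙 (L x)) (≤-trans (≤-reflexive (sum-cong-≗ λ t → cong 𝟙 (nb-sym t x))) (count-nb x))) ⟩
      sum (λ x → 𝟙 (L x) * (suc Δ + 1)) ≡⟨ sum-*ʳ (suc Δ + 1) (λ x → 𝟙 (L x)) ⟩
      count L * (suc Δ + 1) ∎))
      where
      open ≤-Reasoning
      by : ∀ t b → ∃ᵇ (λ x → L x ∧ nb t x) ≡ b → 𝟙 b ≤ sum (λ x → 𝟙 (L x) * 𝟙 (nb t x))
      by t false _ = z≤n
      by t true h = let (x , e) = ∃ᵇ-elim _ h in
        ≤-trans (≤-reflexive (sym (trans (𝟙-* (L x) (nb t x)) (cong 𝟙 e)))) (term≤sum (λ x → 𝟙 (L x) * 𝟙 (nb t x)) x)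

    commonKind : ∃ λ κ → count (λ t → A t ∧ isolated t) ≤ kinds * count (λ t → (A t ∧ isolated t) ∧ (kind t == κ))
    commonKind = let (κ , le) = average-max (λ κ → count (λ t → (A t ∧ isolated t) ∧ (kind t == κ))) in
      κ , ≤-trans (≤-reflexive (count-fibres kind (λ t → A t ∧ isolated t))) le

    module _ (κ : Fin kinds) where

      Cen : V → Bool
      Cen t = (A t ∧ isolated t) ∧ (kind t == κ)

      Cen⇒A : ∀ t → Cen t ≡ true → A t ≡ true
      Cen⇒A t h = proj₁ (∧-split {A t} (proj₁ (∧-split {A t ∧ isolated t} h)))

      Cen-kind : ∀ t → Cen t ≡ true → kind t ≡ κ
      Cen-kind t h = ==⇒≡ (proj₂ (∧-split {A t ∧ isolated t} h))

      Cen-nb⇒A : ∀ t x → Cen t ≡ true → nb t x ≡ true → A x ≡ true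
      Cen-nb⇒A t x h b = [ (λ { (j , refl , refl) → trans (sym (A-inner j ¬Lt ¬Lx)) (Cen⇒A t h) })
                         , (λ { (j , refl , refl) → trans (A-inner j ¬Lx ¬Lt) (Cen⇒A t h) }) ]′ (nb-elim t x b)
        where
        ¬Lt : L t ≡ false
        ¬Lt = A⇒¬L t (Cen⇒A t h)
        ¬Lx : L x ≡ false
        ¬Lx = ¬true⇒false λ l → true≢false (∃ᵇ-intro (λ x → L x ∧ nb t x) x (∧-join l b))
          (not-true (proj₂ (∧-split {A t} (proj₁ (∧-split {A t ∧ isolated t} h)))))

      InStar : V → V → Set
      InStar t x = (x ≡ t) ⊎ (nb t x ≡ true)

      S : V → Bool
      S x = Cen x ∨ ∃ᵇ (λ t → Cen t ∧ nb t x)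

      S-elim : ∀ x → S x ≡ true → ∃ λ t → (Cen t ≡ true) × InStar t x
      S-elim x h = [ (λ c → x , c , inj₁ refl)
                   , (λ e → let (t , p) = ∃ᵇ-elim _ e ; (c , b) = ∧-split p in t , c , inj₂ b) ]′ (∨-split {Cen x} h)

      same : ∀ t t′ → Cen t ≡ true → Cen t′ ≡ true → (depth4 t ≡ depth4 t′) × (rankOfPar t ≡ rankOfPar t′) × (rankOf t ≡ rankOf t′)
      same t t′ h h′ = kind-injective t t′ (trans (Cen-kind t h) (sym (Cen-kind t′ h′)))

      not-adjacent : ∀ j → Cen (par j) ≡ true → Cen (suc j) ≡ true → ⊥
      not-adjacent j h h′ = next4≢ _ (trans (sym (depth4-suc j)) (sym (proj₁ (same _ _ h h′))))

      two-apart : ∀ i j → par i ≡ suc j → Cen (par j) ≡ true → Cen (suc i) ≡ true → ⊥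
      two-apart i j e h h′ = next4²≢ _ (trans (cong next4 (sym (depth4-suc j))) (trans (cong (next4 ∘ depth4) (sym e)) (trans (sym (depth4-suc i)) (sym (proj₁ (same _ _ h h′))))))

      star-disjoint : ∀ t t′ x → Cen t ≡ true → Cen t′ ≡ true → InStar t x → InStar t′ x → t ≡ t′
      star-disjoint t t′ x h h′ (inj₁ e) (inj₁ e′) = trans (sym e) e′
      star-disjoint t t′ .t h h′ (inj₁ refl) (inj₂ b) = ⊥-elim ([ (λ { (j , refl , refl) → not-adjacent j h′ h }) , (λ { (j , refl , refl) → not-adjacent j h h′ }) ]′ (nb-elim t′ t b))
      star-disjoint t t′ .t′ h h′ (inj₂ b) (inj₁ refl) = ⊥-elim ([ (λ { (j , refl , refl) → not-adjacent j h h′ }) , (λ { (j , refl , refl) → not-adjacent j h′ h }) ]′ (nb-elim t t′ b))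
      star-disjoint t t′ x h h′ (inj₂ b) (inj₂ b′) = go (nb-elim t x b) (nb-elim t′ x b′)
        where
        go : _ → _ → t ≡ t′
        go (inj₁ (j , refl , e)) (inj₁ (j′ , refl , e′)) = trans (sym e) e′
        go (inj₁ (j , e , refl)) (inj₂ (i , refl , e′)) = ⊥-elim (two-apart i j (trans e′ e) h h′)
        go (inj₂ (i , refl , e′)) (inj₁ (j , e , refl)) = ⊥-elim (two-apart i j (trans e′ e) h′ h)
        go (inj₂ (i , refl , e)) (inj₂ (i′ , refl , e′)) = cong suc (rk-injective i i′ (trans e (sym e′)) (proj₂ (proj₂ (same _ _ h h′))))

      S-edge : ∀ j → S (par j) ≡ true → S (suc j) ≡ true → (Cen (par j) ≡ true) ⊎ (Cen (suc j) ≡ true)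
      S-edge j p q = go (S-elim _ p) (S-elim _ q)
        where
        Goal : Set
        Goal = (Cen (par j) ≡ true) ⊎ (Cen (suc j) ≡ true)
        go : (∃ λ t → (Cen t ≡ true) × InStar t (par j)) → (∃ λ t → (Cen t ≡ true) × InStar t (suc j)) → Goal
        go (t , h , inj₁ e) _ = inj₁ (trans (cong Cen e) h)
        go _ (t′ , h′ , inj₁ e) = inj₂ (trans (cong Cen e) h′)
        go (t , h , inj₂ b) (t′ , h′ , inj₂ b′) = leaves (nb-elim t (par j) b) (nb-elim t′ (suc j) b′)
          where
          leaves : _ → _ → Goal
          leaves _ (inj₁ (j′ , refl , e)) = inj₁ (trans (cong Cen e) h′)
          -- A child of one centre joined to the parent of another: the centres lie three levels
          -- apart.
          leaves (inj₁ (i , e , e₁)) (inj₂ (i′ , e′ , e₁′)) = ⊥-elim (next4³≢ (depth4 t) (begin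
            next4 (next4 (next4 (depth4 t))) ≡⟨ cong (next4 ∘ next4) (trans (cong (next4 ∘ depth4) (sym e₁)) (trans (sym (depth4-suc i)) (cong depth4 (sym e)))) ⟩
            next4 (next4 (depth4 (par j))) ≡⟨ cong next4 (trans (sym (depth4-suc j)) (cong depth4 (sym e₁′))) ⟩
            next4 (depth4 (par i′)) ≡⟨ trans (sym (depth4-suc i′)) (cong depth4 (sym e′)) ⟩
            depth4 t′ ≡⟨ proj₁ (same t′ t h′ h) ⟩
            depth4 t ∎))
            where open ≡-Reasoning
          -- Both leaves are parents of their centres, which therefore lie one level apart.
          leaves (inj₂ (i , e , e₁)) (inj₂ (i′ , e′ , e₁′)) = ⊥-elim (next4≢ (depth4 t) (begin
            next4 (depth4 t) ≡⟨ cong next4 (trans (cong depth4 e) (trans (depth4-suc i) (trans (cong (next4 ∘ depth4) e₁) (sym (depth4-suc j))))) ⟩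
            next4 (depth4 (suc j)) ≡⟨ cong (next4 ∘ depth4) (sym e₁′) ⟩
            next4 (depth4 (par i′)) ≡⟨ trans (sym (depth4-suc i′)) (cong depth4 (sym e′)) ⟩
            depth4 t′ ≡⟨ proj₁ (same t′ t h′ h) ⟩
            depth4 t ∎))
            where open ≡-Reasoning

      -- Below a vertex outside S, a child in S can only be the parent of its centre. Its rank is
      -- then the common value of `rankOfPar`, and siblings of equal rank coincide.
      S-child : ∀ i j → par i ≡ par j → S (par i) ≡ false → S (suc i) ≡ true → S (suc j) ≡ true → i ≡ j
      S-child i j e out p q = let (t , h , r) = starTop i out p ; (t′ , h′ , r′) = starTop j (trans (cong S (sym e)) out) q in
        rk-injective i j e (trans (sym r) (trans (proj₁ (proj₂ (same t t′ h h′))) r′))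
        where
        starTop : ∀ i → S (par i) ≡ false → S (suc i) ≡ true → ∃ λ t → (Cen t ≡ true) × (rankOfPar t ≡ rk i)
        starTop i out p = go (S-elim _ p)
          where
          in-S : ∀ t x → Cen t ≡ true → InStar t x → S x ≡ true
          in-S t .t h (inj₁ refl) = ∨-inl h
          in-S t x h (inj₂ b) = ∨-inr {Cen x} (∃ᵇ-intro _ t (∧-join h b))
          go : (∃ λ t → (Cen t ≡ true) × InStar t (suc i)) → ∃ λ t → (Cen t ≡ true) × (rankOfPar t ≡ rk i)
          go (t , h , inj₁ refl) = ⊥-elim (true≢false (in-S (suc i) (par i) h (inj₂ (nb-up i))) out)
          go (t , h , inj₂ b) = leaf (nb-elim t (suc i) b)
            where
            leaf : _ → ∃ λ t → (Cen t ≡ true) × (rankOfPar t ≡ rk i)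
            leaf (inj₁ (j′ , refl , e)) = ⊥-elim (true≢false (in-S t (par i) h (inj₁ e)) out)
            leaf (inj₂ (j′ , refl , e)) = t , h , cong rankOf e

-- Grouping components by isomorphism type

same-block : ∀ u b b′ c → b * u ≤ c → c < b * u + u → b′ * u ≤ c → c < b′ * u + u → b ≡ b′
same-block u b b′ c p q p′ q′ with <-cmp b b′
... | tri≈ _ e _ = e
... | tri< lt _ _ = ⊥-elim (<⇒≱ q (≤-trans (≤-trans (≤-reflexive (+-comm (b * u) u)) (*-monoˡ-≤ u lt)) p′))
... | tri> _ _ gt = ⊥-elim (<⇒≱ q′ (≤-trans (≤-trans (≤-reflexive (+-comm (b′ * u) u)) (*-monoˡ-≤ u gt)) p))

-- L′ adds to the separator the components outside complete groups of u components of the same shape.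
module Grouping {n′ Δ : ℕ} (T : RTree n′ (suc Δ)) (d : ℕ) (r : ℕ) (r≤d : r ≤ d) (c : ℕ → Fin (suc Δ)) (b : ℕ) (u′ : ℕ) where
  open Tree T
  open Fold T
  open Separator T d
  open Components T d r r≤d c
  open Centres T d r r≤d c using (below; kinds)

  u : ℕ
  u = suc u′

  A : V → Bool
  A = below b

  A-inner : ∀ j → L (par j) ≡ false → L (suc j) ≡ false → A (par j) ≡ A (suc j)
  A-inner = Centres.A-inner T d r r≤d c b

  -- A top gets a fixed mark: the edge to its parent does not belong to the component.
  mark : V → Fin 3
  mark zero = suc zero
  mark (suc j) = if L (par j) then suc zero else (if dir j then suc zero else suc (suc zero))

  at? : ∀ ρ (a : Fin C) → Dec (∃ λ x → (L x ≡ false) × (top x ≡ ρ) × (ad x ≡ toℕ a))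
  at? ρ a = any? λ x → (L x Data.Bool.≟ false) ×-dec (top x ≟ ρ) ×-dec (ad x Data.Nat.≟ toℕ a)

  markAt : ∀ {ρ} {a : Fin C} → Dec (∃ λ x → (L x ≡ false) × (top x ≡ ρ) × (ad x ≡ toℕ a)) → Fin 3
  markAt (yes (x , _)) = mark x
  markAt (no _) = zero

  opaque
    -- The isomorphism type of the component with top `ρ` as a table over addresses: 0 for a vacant
    -- address, otherwise the mark of the vertex there. Addresses record ranks, so equal tables give
    -- an isomorphism that respects them.
    shape : V → Fin C → Fin 3
    shape ρ a = markAt {ρ} {a} (at? ρ a)

    shape≡ : ∀ ρ a {p} → at? ρ a ≡ p → shape ρ a ≡ markAt {ρ} {a} p
    shape≡ ρ a e = cong (markAt {ρ} {a}) e

  mark≢0 : ∀ x → mark x ≢ zero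
  mark≢0 zero ()
  mark≢0 (suc j) with L (par j) | dir j
  ... | true | _ = λ ()
  ... | false | true = λ ()
  ... | false | false = λ ()

  K : ℕ
  K = 3 ^ C

  opaque
    code : V → Fin K
    code ρ = Data.Fin.funToFin (shape ρ)

    code⇒shape : ∀ ρ ρ′ → code ρ ≡ code ρ′ → ∀ a → shape ρ a ≡ shape ρ′ a
    code⇒shape ρ ρ′ e a = trans (sym (finToFun-funToFin (shape ρ) a)) (trans (cong (λ k → Data.Fin.finToFun k a) e) (finToFun-funToFin (shape ρ′) a))

  Copy : V → V → Set
  Copy x ρ′ = ∃ λ x′ → (L x′ ≡ false) × (top x′ ≡ ρ′) × (ad x′ ≡ ad x) × (mark x′ ≡ mark x)

  twin : ∀ x ρ′ → L x ≡ false → code (top x) ≡ code ρ′ → Copy x ρ′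
  twin x ρ′ l e = go (at? (top x) (address x)) (at? ρ′ (address x)) refl refl
    where
    s≡ : shape (top x) (address x) ≡ shape ρ′ (address x)
    s≡ = code⇒shape (top x) ρ′ e (address x)
    go : ∀ p q → at? (top x) (address x) ≡ p → at? ρ′ (address x) ≡ q → Copy x ρ′
    go (no ¬p) _ _ _ = ⊥-elim (¬p (x , l , refl , sym (toℕ-address x)))
    go (yes (x₁ , l₁ , t₁ , a₁)) (no ¬q) ep eq = ⊥-elim (mark≢0 x₁ (trans (sym (shape≡ _ _ ep)) (trans s≡ (shape≡ _ _ eq))))
    go (yes (x₁ , l₁ , t₁ , a₁)) (yes (x₂ , l₂ , t₂ , a₂)) ep eq = x₂ , l₂ , t₂ , trans a₂ (toℕ-address x) ,
      trans (sym (shape≡ _ _ eq)) (trans (sym s≡) (trans (shape≡ _ _ ep) (cong mark x₁≡x)))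
      where
      x₁≡x : x₁ ≡ x
      x₁≡x = address-injective x₁ x t₁ (trans a₁ (toℕ-address x))

  Root : Fin K → V → Bool
  Root κ ρ = (not (L ρ) ∧ not (A ρ)) ∧ ((top ρ == ρ) ∧ (code ρ == κ))

  Root-elim : ∀ {κ ρ} → Root κ ρ ≡ true → (L ρ ≡ false) × (A ρ ≡ false) × (top ρ ≡ ρ) × (code ρ ≡ κ)
  Root-elim {κ} {ρ} h = let (p , q) = ∧-split {not (L ρ) ∧ not (A ρ)} h ; (p₁ , p₂) = ∧-split {not (L ρ)} p ; (q₁ , q₂) = ∧-split {top ρ == ρ} q in
    not-true p₁ , not-true p₂ , ==⇒≡ q₁ , ==⇒≡ q₂

  A-top : ∀ x → L x ≡ false → A x ≡ false → A (top x) ≡ false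
  A-top x l a = top-invariant (λ y → A y ≡ false) (λ j p q e → trans (A-inner j q p) e) x l a

  Root-top : ∀ x → L x ≡ false → A x ≡ false → Root (code (top x)) (top x) ≡ true
  Root-top x l a = ∧-join (∧-join (not-false (L-top x l)) (not-false (A-top x l a)))
    (∧-join (subst (λ z → (z == top x) ≡ true) (sym (top-idem x l)) (==-refl (top x))) (==-refl (code (top x))))

  -- The position of the component of `x` among those of its type; quotient and remainder by `u`
  -- give its group and its place in the group.
  number : V → ℕ
  number x = rankIn (Root (code (top x))) (top x)

  number< : ∀ x → L x ≡ false → A x ≡ false → number x < count (Root (code (top x)))
  number< x l a = rankIn<count _ (top x) (Root-top x l a)

  block : V → ℕ
  block x = number x / u

  number-split : ∀ x → number x ≡ block x * u + number x % u
  number-split x = trans (m≡m%n+[m/n]*n (number x) u) (+-comm (number x % u) _)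

  opaque
    full : V → Bool
    full x = does (block x * u + u ≤? count (Root (code (top x))))

    full⇒ : ∀ x → full x ≡ true → block x * u + u ≤ count (Root (code (top x)))
    full⇒ x = ≡true⇒ (_ ≤? _)

    full-intro : ∀ x → block x * u + u ≤ count (Root (code (top x))) → full x ≡ true
    full-intro x = dec-true (_ ≤? _)

    ¬full⇒ : ∀ x → full x ≡ false → count (Root (code (top x))) < block x * u + u
    ¬full⇒ x e = ≰⇒> (≡false⇒ (_ ≤? _) e)

  leftover : V → Bool
  leftover x = (not (L x) ∧ not (A x)) ∧ not (full x)

  leftover-elim : ∀ x → leftover x ≡ true → (L x ≡ false) × (A x ≡ false) × (full x ≡ false)
  leftover-elim x h = let (p , q) = ∧-split {not (L x) ∧ not (A x)} h ; (p₁ , p₂) = ∧-split {not (L x)} p in not-true p₁ , not-true p₂ , not-true q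

  L′ : V → Bool
  L′ x = L x ∨ leftover x

  number-cong : ∀ {x y} → top x ≡ top y → number x ≡ number y
  number-cong = cong (λ t → rankIn (Root (code t)) t)

  full-cong : ∀ {x y} → top x ≡ top y → full x ≡ full y
  full-cong {x} {y} e = [ (λ p → trans p (sym (full-intro y (subst (λ t → rankIn (Root (code t)) t / u * u + u ≤ count (Root (code t))) e (full⇒ x p)))))
    , (λ p → trans p (sym (¬true⇒false λ q → true≢false (full-intro x (subst (λ t → rankIn (Root (code t)) t / u * u + u ≤ count (Root (code t))) (sym e) (full⇒ y q))) p))) ]′ (bool-cases (full x))

  -- Each type has at most one incomplete group, so type, place in the group and address determine a
  -- leftover vertex.
  leftover≤ : count leftover ≤ K * (u * C)
  leftover≤ = count-injection leftover (λ x → pair (code (top x)) (pair (fromℕ< (m%n<n (number x) u)) (address x))) inj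
    where
    inj : ∀ x y → leftover x ≡ true → leftover y ≡ true → pair (code (top x)) (pair (fromℕ< (m%n<n (number x) u)) (address x)) ≡ pair (code (top y)) (pair (fromℕ< (m%n<n (number y) u)) (address y)) → x ≡ y
    inj x y p q e = address-injective x y tops (trans (sym (toℕ-address x)) (trans (cong toℕ (cong proj₂ e₂)) (toℕ-address y)))
      where
      e₁ = trans (sym (unpair-pair _ _)) (trans (cong unpair e) (unpair-pair _ _))
      e₂ = trans (sym (unpair-pair _ _)) (trans (cong (unpair ∘ proj₂) e₁) (unpair-pair _ _))
      κ≡ : code (top x) ≡ code (top y)
      κ≡ = cong proj₁ e₁
      remainders : number x % u ≡ number y % u
      remainders = trans (sym (toℕ-fromℕ< (m%n<n (number x) u))) (trans (cong toℕ (cong proj₁ e₂)) (toℕ-fromℕ< (m%n<n (number y) u)))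
      lower : ∀ x → leftover x ≡ true → block x * u ≤ count (Root (code (top x)))
      lower x p = let (l , a , _) = leftover-elim x p in ≤-trans (≤-trans (m≤m+n _ _) (≤-reflexive (sym (number-split x)))) (<⇒≤ (number< x l a))
      upper : ∀ x → leftover x ≡ true → count (Root (code (top x))) < block x * u + u
      upper x p = ¬full⇒ x (proj₂ (proj₂ (leftover-elim x p)))
      blocks : block x ≡ block y
      blocks = same-block u (block x) (block y) (count (Root (code (top x)))) (lower x p) (upper x p)
        (subst (λ κ → block y * u ≤ count (Root κ)) (sym κ≡) (lower y q)) (subst (λ κ → count (Root κ) < block y * u + u) (sym κ≡) (upper y q))
      numbers : number x ≡ number y
      numbers = trans (number-split x) (trans (cong₂ (λ a b → a * u + b) blocks remainders) (sym (number-split y)))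
      rootOf : ∀ x → leftover x ≡ true → Root (code (top x)) (top x) ≡ true
      rootOf x p = let (l , a , _) = leftover-elim x p in Root-top x l a
      tops : top x ≡ top y
      tops = rankIn-injective (Root (code (top x))) (top x) (top y) (rootOf x p)
        (trans (cong (λ κ → Root κ (top y)) κ≡) (rootOf y q)) (trans numbers (cong (λ κ → rankIn (Root κ) (top y)) (sym κ≡)))

  B : V → Set
  B x = (L′ x ≡ false) × (A x ≡ false)

  B-elim : ∀ x → B x → (L x ≡ false) × (A x ≡ false) × (full x ≡ true)
  B-elim x (l , a) = let (l₁ , l₂) = ∨-false {L x} l in l₁ , a ,
    [ (λ f → f) , (λ f → ⊥-elim (true≢false (∧-join (∧-join (not-false l₁) (not-false a)) (not-false f)) l₂)) ]′ (bool-cases (full x))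

  B-intro : ∀ x → L x ≡ false → A x ≡ false → full x ≡ true → B x
  B-intro x l a f = ¬true⇒false (λ h → [ (λ h → true≢false h l) , (λ h → true≢false f (proj₂ (proj₂ (leftover-elim x h)))) ]′ (∨-split {L x} h)) , a

  record Twin (x : V) (q : Fin u) (x′ : V) : Set where
    constructor twins
    field
      L-twin : L x′ ≡ false
      A-twin : A x′ ≡ false
      code-twin : code (top x′) ≡ code (top x)
      number-twin : number x′ ≡ block x * u + toℕ q
      ad-twin : ad x′ ≡ ad x

  Twin-unique : ∀ x q y z → Twin x q y → Twin x q z → y ≡ z
  Twin-unique x q y z (twins l a κ ν e) (twins l′ a′ κ′ ν′ e′) = address-injective y z
    (rankIn-injective (Root (code (top y))) (top y) (top z) (Root-top y l a)
      (trans (cong (λ k → Root k (top z)) (trans κ (sym κ′))) (Root-top z l′ a′))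
      (trans ν (trans (sym ν′) (cong (λ k → rankIn (Root k) (top z)) (trans κ′ (sym κ))))))
    (trans e (sym e′))

  Found : V → Fin u → Set
  Found x q = ∃ λ x′ → Twin x q x′ × (mark x′ ≡ mark x)

  find : ∀ x q → B x → Found x q
  find x q Bx = go (select (Root (code (top x))) (block x * u + toℕ q) (<-≤-trans (+-monoʳ-< (block x * u) (toℕ<n q)) (full⇒ x f)))
    where
    l = proj₁ (B-elim x Bx)
    f = proj₂ (proj₂ (B-elim x Bx))
    go : (∃ λ ρ → (Root (code (top x)) ρ ≡ true) × (rankIn (Root (code (top x))) ρ ≡ block x * u + toℕ q)) → _
    go (ρ , Rρ , eq) = finish (twin x ρ l (sym (proj₂ (proj₂ (proj₂ (Root-elim Rρ))))))
      where
      κ≡ : code ρ ≡ code (top x)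
      κ≡ = proj₂ (proj₂ (proj₂ (Root-elim Rρ)))
      A-of : ∀ x′ → L x′ ≡ false → top x′ ≡ ρ → A x′ ≡ false
      A-of x′ l′ t = trans (cong₂ (λ l t → not l ∧ does (toℕ t <? b)) (trans l′ (sym (proj₁ (Root-elim Rρ)))) (trans t (sym (proj₁ (proj₂ (proj₂ (Root-elim Rρ))))))) (proj₁ (proj₂ (Root-elim Rρ)))
      finish : Copy x ρ → Found x q
      finish (x′ , l′ , t , a , mk) = x′ , twins l′ (A-of x′ l′ t) (trans (cong code t) κ≡)
        (trans (cong (λ t → rankIn (Root (code t)) t) t) (trans (cong (λ κ → rankIn (Root κ) ρ) κ≡) eq)) a , mk

  B? : ∀ x → Dec (B x)
  B? x = (L′ x Data.Bool.≟ false) ×-dec (A x Data.Bool.≟ false)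

  opaque
    cls : V → Fin u → V
    cls x q = by (B? x)
      where
      by : Dec (B x) → V
      by (yes Bx) = proj₁ (find x q Bx)
      by (no _) = x

    cls-spec : ∀ x q → B x → Twin x q (cls x q) × (mark (cls x q) ≡ mark x)
    cls-spec x q Bx with B? x
    ... | yes Bx′ = proj₂ (find x q Bx′)
    ... | no ¬Bx = ⊥-elim (¬Bx Bx)

  cls-twin : ∀ x q → B x → Twin x q (cls x q)
  cls-twin x q Bx = proj₁ (cls-spec x q Bx)

  Twin-block : ∀ {x q x′} → Twin x q x′ → block x′ ≡ block x
  Twin-block {x} {q} {x′} t = same-block u (block x′) (block x) (number x′)
    (≤-trans (m≤m+n _ _) (≤-reflexive (sym (number-split x′))))
    (≤-trans (s≤s (≤-reflexive (number-split x′))) (+-monoʳ-< (block x′ * u) (m%n<n (number x′) u)))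
    (≤-trans (m≤m+n _ (toℕ q)) (≤-reflexive (sym (Twin.number-twin t))))
    (≤-trans (s≤s (≤-reflexive (Twin.number-twin t))) (+-monoʳ-< (block x * u) (toℕ<n q)))

  cls-B : ∀ x q → B x → B (cls x q)
  cls-B x q Bx = B-intro (cls x q) L-twin A-twin (full-intro (cls x q)
      (subst₂ (λ β κ → β * u + u ≤ count (Root κ)) (sym (Twin-block t)) (sym code-twin) (full⇒ x (proj₂ (proj₂ (B-elim x Bx))))))
    where
    t = cls-twin x q Bx
    open Twin t

  cls-unique : ∀ x q y → B x → Twin x q y → cls x q ≡ y
  cls-unique x q y Bx t = Twin-unique x q (cls x q) y (cls-twin x q Bx) t

  cls-self : ∀ x → B x → ∃ λ q → cls x q ≡ x
  cls-self x Bx = fromℕ< (m%n<n (number x) u) , cls-unique x _ x Bx (twins (proj₁ (B-elim x Bx)) (proj₂ Bx) refl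
    (trans (number-split x) (cong (block x * u +_) (sym (toℕ-fromℕ< (m%n<n (number x) u))))) refl)

  cls-injective : ∀ x → B x → Injective₁ (cls x)
  cls-injective x Bx q q′ e = toℕ-injective (+-cancelˡ-≡ (block x * u) _ _
    (trans (sym (Twin.number-twin (cls-twin x q Bx))) (trans (cong number e) (Twin.number-twin (cls-twin x q′ Bx)))))

  cls-cls : ∀ x q q′ → B x → cls (cls x q) q′ ≡ cls x q′
  cls-cls x q q′ Bx = sym (cls-unique x q′ _ Bx (twins L-twin A-twin (trans code-twin (Twin.code-twin t))
      (trans number-twin (cong (λ β → β * u + toℕ q′) (Twin-block t))) (trans ad-twin (Twin.ad-twin t))))
    where
    t = cls-twin x q Bx
    open Twin (cls-twin (cls x q) q′ (cls-B x q Bx))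

  -- Leftover vertices form whole components, so none of them gets a child outside `L′`; this is why
  -- `one-child` survives the enlargement.
  L′-par : ∀ j → L′ (suc j) ≡ false → L (par j) ≡ false → L′ (par j) ≡ false
  L′-par j l p = ∨-both-false p (¬true⇒false λ h → let (_ , a , f) = leftover-elim (par j) h ; l₁ = proj₁ (∨-false {L (suc j)} l) in
    true≢false (∧-join (∧-join (not-false l₁) (not-false (trans (sym (A-inner j p l₁)) a))) (not-false (trans (full-cong (top-inner j l₁ p)) f)))
      (proj₂ (∨-false {L (suc j)} l)))

  topOf-ad : ∀ x → L′ x ≡ false → topOf L′ x ≡ does (ad x Data.Nat.≟ 0)
  topOf-ad zero l = sym (dec-true (ad zero Data.Nat.≟ 0) ad-zero)
  topOf-ad (suc j) l = by (bool-cases (L (par j)))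
    where
    by : (L (par j) ≡ true) ⊎ (L (par j) ≡ false) → L′ (par j) ≡ does (ad (suc j) Data.Nat.≟ 0)
    by (inj₁ p) = trans (∨-inl p) (sym (dec-true (ad (suc j) Data.Nat.≟ 0) (ad-top j (inj₂ p))))
    by (inj₂ p) = trans (L′-par j l p) (sym (dec-false (ad (suc j) Data.Nat.≟ 0) λ e →
      case trans (sym (ad-inner j (proj₁ (∨-false {L (suc j)} l)) p)) e of λ ()))

  cls-top : ∀ x q → B x → topOf L′ (cls x q) ≡ topOf L′ x
  cls-top x q Bx = trans (topOf-ad (cls x q) (proj₁ (cls-B x q Bx))) (trans (cong (λ a → does (a Data.Nat.≟ 0)) (Twin.ad-twin (cls-twin x q Bx))) (sym (topOf-ad x (proj₁ Bx))))

  EdgeTwin : Fin n′ → Fin u → Set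
  EdgeTwin j q = ∃ λ j′ → (cls (suc j) q ≡ suc j′) × (dir j′ ≡ dir j) × (par j′ ≡ cls (par j) q)

  -- The address of a child determines that of its parent, so the parent of a copy is the copy of
  -- the parent; equal marks give equal directions.
  cls-edge : ∀ j q → B (suc j) → L′ (par j) ≡ false → EdgeTwin j q
  cls-edge j q Bj lp = go (cls (suc j) q) refl (cls-spec (suc j) q Bj)
    where
    l : L (suc j) ≡ false
    l = proj₁ (B-elim (suc j) Bj)
    p : L (par j) ≡ false
    p = proj₁ (∨-false lp)
    Bp : B (par j)
    Bp = lp , trans (A-inner j p l) (proj₂ Bj)
    dir-mark : ∀ a b → (if a then suc zero else suc (suc zero)) ≡ (if b then suc zero else suc (suc (zero {0}))) → a ≡ b
    dir-mark true true _ = refl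
    dir-mark false false _ = refl
    dir-mark true false ()
    dir-mark false true ()
    go : ∀ x′ → cls (suc j) q ≡ x′ → Twin (suc j) q (cls (suc j) q) × (mark (cls (suc j) q) ≡ mark (suc j)) → EdgeTwin j q
    go x′ eq spec = inner x′ eq (subst (λ y → Twin (suc j) q y × (mark y ≡ mark (suc j))) eq spec)
      where
      inner : ∀ y → cls (suc j) q ≡ y → Twin (suc j) q y × (mark y ≡ mark (suc j)) → EdgeTwin j q
      inner zero _ (t , _) = case trans (sym ad-zero) (trans (Twin.ad-twin t) (ad-inner j l p)) of λ ()
      inner (suc j′) eq (t , mk) = j′ , eq , dir-mark (dir j′) (dir j)
            (trans (sym (cong (λ z → if z then suc zero else (if dir j′ then suc zero else suc (suc zero))) p′))
              (trans mk (cong (λ z → if z then suc zero else (if dir j then suc zero else suc (suc zero))) p)))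
          , sym (cls-unique (par j) q (par j′) Bp (twins p′ (trans (A-inner j′ p′ L-twin) A-twin)
              (trans (cong code (sym tp′)) (trans code-twin (cong code tp)))
              (trans (number-cong (sym tp′)) (trans number-twin (cong (λ ν → ν / u * u + toℕ q) (number-cong tp))))
              (proj₂ (mixed-radix (rk j′) (rk j) _ _ (cong Data.Nat.pred (trans (sym (ad-inner j′ L-twin p′)) (trans ad-twin (ad-inner j l p))))))))
        where
        open Twin t
        p′ : L (par j′) ≡ false
        p′ = ¬true⇒false λ h → case trans (sym (ad-top j′ (inj₂ h))) (trans ad-twin (ad-inner j l p)) of λ ()
        tp′ : top (suc j′) ≡ top (par j′)
        tp′ = top-inner j′ L-twin p′
        tp : top (suc j) ≡ top (par j)
        tp = top-inner j l p

  L′-one-child : ∀ i j → par i ≡ par j → L′ (par i) ≡ true → L′ (suc i) ≡ false → L′ (suc j) ≡ false → i ≡ j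
  L′-one-child i j e Lp ¬Li ¬Lj = [ (λ h → one-child i j e h (proj₁ (∨-false ¬Li)) (proj₁ (∨-false ¬Lj)))
                                  , (λ h → ⊥-elim (true≢false Lp (L′-par i ¬Li h))) ]′ (bool-cases (L (par i)))

  A⇒¬L′ : ∀ x → A x ≡ true → L′ x ≡ false
  A⇒¬L′ x a = ∨-both-false (not-true (proj₁ (∧-split a))) (¬true⇒false λ h → true≢false a (proj₁ (proj₂ (leftover-elim x h))))

  decomposition : Fin kinds → Decomposition T u
  decomposition κ = record
    { L = L′ ; A = A ; Cen = C₀.Cen b κ ; A⇒¬L = A⇒¬L′ ; one-child = L′-one-child
    ; A-edge = λ j p q → A-inner j (proj₁ (∨-false p)) (proj₁ (∨-false q))
    ; Cen⇒A = C₀.Cen⇒A b κ ; Cen-nb⇒A = C₀.Cen-nb⇒A b κ ; star-disjoint = C₀.star-disjoint b κ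
    ; S-edge = C₀.S-edge b κ ; S-child = C₀.S-child b κ
    ; cls = cls ; cls-self = cls-self ; cls-injective = cls-injective ; cls-B = cls-B ; cls-cls = cls-cls
    ; cls-top = cls-top ; cls-edge = cls-edge }
    where module C₀ = Centres T d r r≤d c

  L′≤ : count L′ ≤ count L + K * (u * C)
  L′≤ = ≤-trans (count-∨ L leftover) (+-monoʳ-≤ (count L) leftover≤)

-- From oriented trees given by arcs to rooted trees

length-filter-tabulate : ∀ {A : Set} {Q : A → Set} (Q? : ∀ x → Dec (Q x)) (f : Fin n → A) →
  length (filter Q? (tabulate f)) ≡ count (λ i → does (Q? (f i)))
length-filter-tabulate {zero} Q? f = sym (sum-zero _)
length-filter-tabulate {suc n} Q? f = trans (by (does (Q? (f zero))) refl) (sym (sum-suc _))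
  where
  by : ∀ b → does (Q? (f zero)) ≡ b → length (filter Q? (f zero ∷ tabulate (f ∘ suc))) ≡ 𝟙 (does (Q? (f zero))) + count (λ i → does (Q? (f (suc i))))
  by b e with does (Q? (f zero))
  ... | true = cong suc (length-filter-tabulate Q? (f ∘ suc))
  ... | false = length-filter-tabulate Q? (f ∘ suc)

length-filter-allFin : {Q : Fin n → Set} (Q? : ∀ x → Dec (Q x)) → length (filter Q? (allFin n)) ≡ count (λ i → does (Q? i))
length-filter-allFin Q? = length-filter-tabulate Q? id

count-inject : (h : Fin m → Fin n) → Injective₁ h → (P : Fin m → Bool) (Q : Fin n → Bool) →
  (∀ i → P i ≡ true → Q (h i) ≡ true) → count P ≤ count Q
count-inject h inj P Q h⇒ = ≤-trans (≤-reflexive (count-fibres h P)) (sum-mono λ c → by c (Q c) refl)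
  where
  by : ∀ c b → Q c ≡ b → count (λ i → P i ∧ (h i == c)) ≤ 𝟙 b
  by c true _ = count-≤1 _ λ i j p q → inj i j (trans (==⇒≡ (proj₂ (∧-split {P i} p))) (sym (==⇒≡ (proj₂ (∧-split {P j} q)))))
  by c false e = ≤-reflexive (count-false _ λ i → ¬true⇒false λ h → let (p , q) = ∧-split {P i} h in true≢false (trans (cong Q (sym (==⇒≡ q))) (h⇒ i p)) e)

surjective : (h : Fin n → Fin n) → Injective₁ h → ∀ y → ∃ λ x → h x ≡ y
surjective {n} h inj y with any? (λ x → h x ≟ y)
... | yes p = p
... | no ¬p = ⊥-elim (<-irrefl refl (<-≤-trans (≤-trans (+-monoˡ-≤ n (count≥1 (y ==_) y (==-refl y)))
    (count-image h inj (y ==_) (λ _ → true) (λ i → ≢⇒==false λ e → ¬p (i , sym e)) (λ _ _ → refl) (λ _ → refl))) (count≤n (λ (_ : Fin n) → true))))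

update : {A : Set} → (ℕ → A) → ℕ → A → ℕ → A
update g i v j = if does (j Data.Nat.≟ i) then v else g j

update-at : {A : Set} (g : ℕ → A) (i : ℕ) (v : A) → update g i v i ≡ v
update-at g i v = cong (λ b → if b then v else g i) (dec-true (i Data.Nat.≟ i) refl)

update-< : {A : Set} (g : ℕ → A) (i : ℕ) (v : A) {j : ℕ} → j < i → update g i v j ≡ g j
update-< g i v {j} lt = cong (λ b → if b then v else g j) (dec-false (j Data.Nat.≟ i) (<⇒≢ lt))

directed : Digraph n → Bool → Fin n → Fin n → Bool
directed G true u v = adj G u v
directed G false u v = adj G v u

module Ordering {m′ : ℕ} (T : OrientedTree (suc (suc m′))) where
  private
    μ ν : ℕ
    μ = suc m′
    ν = suc μ

  Joins : Fin μ → Fin ν → Fin ν → Set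
  Joins e x y = (arc T e ≡ (x , y)) ⊎ (arc T e ≡ (y , x))

  -- Search order: connectivity yields an edge leaving the vertices listed so far, and its listed
  -- end becomes the parent. The functions are total on ℕ, with arbitrary values beyond the listed
  -- range.
  record Grown (k : ℕ) : Set where
    field
      o : ℕ → Fin ν
      p : ℕ → ℕ
      edge : ℕ → Fin μ
      o-injective : ∀ i i′ → i ≤ k → i′ ≤ k → o i ≡ o i′ → i ≡ i′
      p≤ : ∀ i → i < k → p i ≤ i
      joins : ∀ i → i < k → Joins (edge i) (o (p i)) (o (suc i))

  private
    start : Grown 0
    start = record { o = λ _ → zero ; p = λ _ → 0 ; edge = λ _ → zero ; o-injective = λ { zero zero _ _ _ → refl }
                   ; p≤ = λ _ () ; joins = λ _ () }

    module Grow {k} (g : Grown k) (k< : suc k < ν) where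
      open Grown g

      inside : Fin ν → Bool
      inside v = ∃ᵇ {suc k} (λ i → o (toℕ i) == v)

      inside-elim : ∀ v → inside v ≡ true → ∃ λ i → (i ≤ k) × (o i ≡ v)
      inside-elim v h = let (i , e) = ∃ᵇ-elim _ h in toℕ i , ≤-pred (toℕ<n i) , ==⇒≡ e

      inside-intro : ∀ i → i ≤ k → inside (o i) ≡ true
      inside-intro i le = ∃ᵇ-intro _ (fromℕ< (s≤s le)) (subst (λ j → (o j == o i) ≡ true) (sym (toℕ-fromℕ< (s≤s le))) (==-refl (o i)))

      count-inside : count inside ≤ suc k
      count-inside = ≤-trans (sum-mono λ v → by v (inside v) refl) (≤-reflexive (trans (∑-comm (λ v (i : Fin (suc k)) → 𝟙 (o (toℕ i) == v)))
        (trans (sum-cong-≗ {suc k} λ i → count-single (o (toℕ i))) (trans (sum-const (suc k) 1) (*-identityʳ (suc k))))))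
        where
        by : ∀ v b → inside v ≡ b → 𝟙 b ≤ sum {suc k} (λ i → 𝟙 (o (toℕ i) == v))
        by v false _ = z≤n
        by v true h = let (i , e) = ∃ᵇ-elim {suc k} _ h in ≤-trans (≤-reflexive (sym (cong 𝟙 e))) (term≤sum (λ i → 𝟙 (o (toℕ i) == v)) i)

      outsider : ∃ λ v → inside v ≡ false
      outsider = let (v , e) = count-pos (not ∘ inside) (+-cancelˡ-< (count inside) 0 _ (<-≤-trans
                         (≤-trans (s≤s (≤-trans (≤-reflexive (+-identityʳ (count inside))) count-inside)) k<)
                         (≤-reflexive (sym (count-not inside))))) in v , not-true e

      Crossing : Set
      Crossing = ∃ λ x → ∃ λ y → (inside x ≡ true) × (inside y ≡ false) × Touches T x y

      cross : ∀ x y → Star (Touches T) x y → inside x ≡ true → inside y ≡ false → Crossing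
      cross x .x nil p q = ⊥-elim (true≢false p q)
      cross x y (_◅_ {j = z} t ts) p q = [ (λ h → cross z y ts h q) , (λ h → x , z , p , h , t) ]′ (bool-cases (inside z))

      crossing′ : Crossing
      crossing′ = let (v , out) = outsider in cross (o 0) v (connected T (o 0) v) (inside-intro 0 z≤n) out

      grow : Grown (suc k)
      grow = go crossing′
        where
        go : Crossing → Grown (suc k)
        go (x , y , px , py , e , touch) = from (inside-elim x px)
          where
          from : (∃ λ i → (i ≤ k) × (o i ≡ x)) → Grown (suc k)
          from (i₀ , i₀≤ , ox) = record { o = o′ ; p = update p k i₀ ; edge = update edge k e ; o-injective = inj
              ; p≤ = λ i lt → [ (λ lt → ≤-trans (≤-reflexive (update-< p k i₀ lt)) (p≤ i lt)) , (λ { refl → ≤-trans (≤-reflexive (update-at p k i₀)) i₀≤ }) ]′ (m≤n⇒m<n∨m≡n (≤-pred lt))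
              ; joins = λ i lt → [ (λ lt → subst (λ z → z) (sym (cong₃ Joins (update-< edge k e lt)
                                      (trans (cong o′ (update-< p k i₀ lt)) (old _ (≤-trans (p≤ i lt) (<⇒≤ lt)))) (old (suc i) lt))) (joins i lt))
                                 , (λ { refl → subst (λ z → z) (sym (cong₃ Joins (update-at edge k e)
                                      (trans (cong o′ (update-at p k i₀)) (trans (old _ i₀≤) ox)) (update-at o (suc k) y))) touch }) ]′ (m≤n⇒m<n∨m≡n (≤-pred lt)) }
            where
            cong₃ : ∀ (f : Fin μ → Fin ν → Fin ν → Set) {a a′ b b′ c c′} → a ≡ a′ → b ≡ b′ → c ≡ c′ → f a b c ≡ f a′ b′ c′
            cong₃ f refl refl refl = refl
            o′ : ℕ → Fin ν
            o′ = update o (suc k) y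
            old : ∀ i → i ≤ k → o′ i ≡ o i
            old i le = update-< o (suc k) y (s≤s le)
            fresh : ∀ i → i ≤ k → o i ≢ y
            fresh i le eq = true≢false (trans (cong inside (sym eq)) (inside-intro i le)) py
            inj : ∀ i i′ → i ≤ suc k → i′ ≤ suc k → o′ i ≡ o′ i′ → i ≡ i′
            inj i i′ le le′ eq = cases (m≤n⇒m<n∨m≡n le) (m≤n⇒m<n∨m≡n le′)
              where
              cases : (i < suc k) ⊎ (i ≡ suc k) → (i′ < suc k) ⊎ (i′ ≡ suc k) → i ≡ i′
              cases (inj₁ a) (inj₁ b) = o-injective i i′ (≤-pred a) (≤-pred b) (trans (sym (old i (≤-pred a))) (trans eq (old i′ (≤-pred b))))
              cases (inj₁ a) (inj₂ refl) = ⊥-elim (fresh i (≤-pred a) (trans (sym (old i (≤-pred a))) (trans eq (update-at o (suc k) y))))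
              cases (inj₂ refl) (inj₁ b) = ⊥-elim (fresh i′ (≤-pred b) (trans (sym (old i′ (≤-pred b))) (trans (sym eq) (update-at o (suc k) y))))
              cases (inj₂ a) (inj₂ b) = trans a (sym b)

    opaque
      growAll : ∀ k → k < ν → Grown k
      growAll zero _ = start
      growAll (suc k) lt = Grow.grow (growAll k (<-trans (n<1+n k) lt)) lt

  module G = Grown (growAll μ ≤-refl)

  O : Fin ν → Fin ν
  O i = G.o (toℕ i)

  O-injective : Injective₁ O
  O-injective i i′ e = toℕ-injective (G.o-injective _ _ (≤-pred (toℕ<n i)) (≤-pred (toℕ<n i′)) e)

  par<n : ∀ (j : Fin μ) → G.p (toℕ j) < ν
  par<n j = s≤s (≤-trans (G.p≤ (toℕ j) (toℕ<n j)) (<⇒≤ (toℕ<n j)))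

  par : Fin μ → Fin ν
  par j = fromℕ< (par<n j)

  par≤ : ∀ j → toℕ (par j) ≤ toℕ j
  par≤ j = ≤-trans (≤-reflexive (toℕ-fromℕ< (par<n j))) (G.p≤ (toℕ j) (toℕ<n j))

  edge : Fin μ → Fin μ
  edge j = G.edge (toℕ j)

  edge-joins : ∀ j → Joins (edge j) (O (par j)) (O (suc j))
  edge-joins j = subst (λ i → Joins (edge j) (G.o i) (O (suc j))) (sym (toℕ-fromℕ< (par<n j))) (G.joins (toℕ j) (toℕ<n j))

  -- The later end of the edge chosen at `j` is `O (suc j)`, which fixes `j`. There are only μ arcs,
  -- so every arc is chosen, as `contains` needs.
  edge-injective : Injective₁ edge
  edge-injective j j′ e = go (edge-joins j) (subst (λ z → Joins z (O (par j′)) (O (suc j′))) (sym e) (edge-joins j′))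
    where
    straight : suc j ≡ suc j′ → j ≡ j′
    straight = suc-injective
    crossed : par j ≡ suc j′ → suc j ≡ par j′ → j ≡ j′
    crossed a b = ⊥-elim (<-irrefl refl (≤-trans (≤-trans (≤-reflexive (cong toℕ (sym a))) (par≤ j))
      (≤-trans (n≤1+n _) (≤-trans (≤-reflexive (cong toℕ b)) (par≤ j′)))))
    pairs : ∀ {a b c d : Fin ν} → (a , b) ≡ (c , d) → (a ≡ c) × (b ≡ d)
    pairs refl = refl , refl
    go : Joins (edge j) (O (par j)) (O (suc j)) → Joins (edge j) (O (par j′)) (O (suc j′)) → j ≡ j′
    go (inj₁ p) (inj₁ q) = straight (O-injective _ _ (proj₂ (pairs (trans (sym p) q))))
    go (inj₂ p) (inj₂ q) = straight (O-injective _ _ (proj₁ (pairs (trans (sym p) q))))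
    go (inj₁ p) (inj₂ q) = let (a , b) = pairs (trans (sym p) q) in crossed (O-injective _ _ a) (O-injective _ _ b)
    go (inj₂ p) (inj₁ q) = let (a , b) = pairs (trans (sym p) q) in crossed (O-injective _ _ b) (O-injective _ _ a)

  dir : Fin μ → Bool
  dir j = [ (λ _ → true) , (λ _ → false) ]′ (edge-joins j)

  rooted : ∀ {Δ} → MaxDegAtMost T Δ → RTree μ Δ
  rooted {Δ} deg = record { par = par ; dir = dir ; par≤ = par≤ ; children≤ = children≤ }
    where
    children≤ : ∀ v → count (λ j → par j == v) ≤ Δ
    children≤ v = ≤-trans (count-inject edge edge-injective (λ j → par j == v) (λ i → does (touches? i)) touching)
        (≤-trans (≤-reflexive (sym (length-filter-allFin touches?))) (deg (O v)))
      where
      touches? : ∀ i → Dec ((proj₁ (arc T i) ≡ O v) ⊎ (proj₂ (arc T i) ≡ O v))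
      touches? i = (proj₁ (arc T i) ≟ O v) ⊎-dec (proj₂ (arc T i) ≟ O v)
      touching : ∀ j → (par j == v) ≡ true → does (touches? (edge j)) ≡ true
      touching j e = dec-true (touches? (edge j)) ([ (λ a → inj₁ (trans (cong proj₁ a) (cong O (==⇒≡ e)))) , (λ a → inj₂ (trans (cong proj₂ a) (cong O (==⇒≡ e)))) ]′ (edge-joins j))

  module _ (G : Digraph ν) where

    private
      E : Bool → Fin ν → Fin ν → Bool
      E = directed G

    contains : ∀ (f : Permutation′ ν) → (∀ j → E (dir j) (f ⟨$⟩ʳ par j) (f ⟨$⟩ʳ suc j) ≡ true) → Contains G T
    contains f sat = F , (λ {x} {y} e → trans (sym (proj₂ (inv x))) (trans (cong O (⟨$⟩-injective f e)) (proj₂ (inv y)))) , arcs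
      where
      inv : ∀ v → ∃ λ i → O i ≡ v
      inv = surjective O O-injective
      F : Fin ν → Fin ν
      F v = f ⟨$⟩ʳ proj₁ (inv v)
      F-O : ∀ i → F (O i) ≡ f ⟨$⟩ʳ i
      F-O i = cong (f ⟨$⟩ʳ_) (O-injective _ _ (proj₂ (inv (O i))))
      arcs : ∀ e → adj G (F (proj₁ (arc T e))) (F (proj₂ (arc T e))) ≡ true
      arcs e = go (surjective edge edge-injective e)
        where
        go : (∃ λ j → edge j ≡ e) → adj G (F (proj₁ (arc T e))) (F (proj₂ (arc T e))) ≡ true
        go (j , refl) = by (edge-joins j) (sat j)
          where
          by : (w : Joins (edge j) (O (par j)) (O (suc j))) → E ([ (λ _ → true) , (λ _ → false) ]′ w) (f ⟨$⟩ʳ par j) (f ⟨$⟩ʳ suc j) ≡ true →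
            adj G (F (proj₁ (arc T (edge j)))) (F (proj₂ (arc T (edge j)))) ≡ true
          by (inj₁ a) h = trans (cong₂ (adj G) (trans (cong (F ∘ proj₁) a) (F-O (par j))) (trans (cong (F ∘ proj₂) a) (F-O (suc j)))) h
          by (inj₂ a) h = trans (cong₂ (adj G) (trans (cong (F ∘ proj₁) a) (F-O (suc j))) (trans (cong (F ∘ proj₂) a) (F-O (par j)))) h

containsOrdered : ∀ {m′ Δ} (G : Digraph (suc (suc m′))) →
  (∀ (R : RTree (suc m′) Δ) → ∃ λ (f : Permutation′ (suc (suc m′))) →
    ∀ i → directed G (RTree.dir R i) (f ⟨$⟩ʳ RTree.par R i) (f ⟨$⟩ʳ suc i) ≡ true) →
  (T : OrientedTree (suc (suc m′))) → MaxDegAtMost T Δ → Contains G T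
containsOrdered G embeds T deg = let (f , sat) = embeds (Ordering.rooted T deg) in Ordering.contains T G f sat

-- Numerical constants and conclusion

floor : ∀ a Q → 1 ≤ Q → ∃ λ h → (Q * h ≤ a) × (a < Q * suc h)
floor a Q Q≥1 = h , ≤-trans (≤-reflexive (*-comm Q h)) (m/n*n≤m a Q) , (begin-strict
  a ≡⟨ m≡m%n+[m/n]*n a Q ⟩
  a % Q + h * Q <⟨ +-monoˡ-< (h * Q) (m%n<n a Q) ⟩
  Q + h * Q ≡⟨ *-comm (suc h) Q ⟩
  Q * suc h ∎)
  where
  open ≤-Reasoning
  instance
    Q≢0 : NonZero Q
    Q≢0 = >-nonZero Q≥1
  h = a / Q

m<2^m : ∀ m → m < 2 ^ m
m<2^m zero = s≤s z≤n
m<2^m (suc m) = ≤-trans (s≤s (m<2^m m)) (≤-trans (+-monoˡ-≤ (2 ^ m) (m^n>0 2 m)) (≤-reflexive (cong (2 ^ m +_) (sym (+-identityʳ (2 ^ m))))))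

-- Since (y + 1)⁴ ≤ 2^(4y), a cubic polynomial is eventually below 2^h.
cubic<exponential : ∀ P → ∃ λ h₀ → ∀ h → h₀ ≤ h → P * (suc h * (suc h * suc h)) < 2 ^ h
cubic<exponential P = 4 * (64 * P) , λ h le → by h le (floor h 4 (s≤s z≤n))
  where
  by : ∀ h → 4 * (64 * P) ≤ h → (∃ λ y → (4 * y ≤ h) × (h < 4 * suc y)) → P * (suc h * (suc h * suc h)) < 2 ^ h
  by h le (y , lo , hi) = begin-strict
    P * (suc h * (suc h * suc h)) ≤⟨ *-monoʳ-≤ P (*-mono-≤ hi (*-mono-≤ hi hi)) ⟩
    P * (4 * z * (4 * z * (4 * z))) ≡⟨ lem P z ⟩
    64 * P * (z * (z * z)) <⟨ *-monoˡ-< (z * (z * z)) (*-cancelˡ-< 4 (64 * P) z (≤-<-trans le hi)) ⟩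
    z * (z * (z * z)) ≤⟨ *-mono-≤ (m<2^m y) (*-mono-≤ (m<2^m y) (*-mono-≤ (m<2^m y) (m<2^m y))) ⟩
    2 ^ y * (2 ^ y * (2 ^ y * 2 ^ y)) ≡⟨ cong (λ a → 2 ^ y * (2 ^ y * a)) (sym (^-distribˡ-+-* 2 y y)) ⟩
    2 ^ y * (2 ^ y * 2 ^ (y + y)) ≡⟨ cong (2 ^ y *_) (sym (^-distribˡ-+-* 2 y (y + y))) ⟩
    2 ^ y * 2 ^ (y + (y + y)) ≡⟨ sym (^-distribˡ-+-* 2 y (y + (y + y))) ⟩
    2 ^ (y + (y + (y + y))) ≤⟨ ^-monoʳ-≤ 2 (≤-trans (≤-reflexive (lem′ y)) lo) ⟩
    2 ^ h ∎
    where
    open ≤-Reasoning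
    z = suc y
    lem : ∀ P z → P * (4 * z * (4 * z * (4 * z))) ≡ 64 * P * (z * (z * z))
    lem = solve-∀
    lem′ : ∀ y → y + (y + (y + y)) ≡ 4 * y
    lem′ = solve-∀

-- `h` will be about n over a constant, so `testCount` is bounded by a cubic in h + 1 and loses
-- against 2^h.
large : ∀ Q c → ∃ λ n₀ → ∀ a → n₀ ≤ a → ∀ h → a < Q * suc h → (testCount a < 2 ^ h) × (c ≤ h)
large Q c = Q * suc (c + h₀) , λ a le h lt → let h≥ = at-least a le h lt in
    (begin-strict
      testCount a ≤⟨ *-monoʳ-≤ 2 (*-monoʳ-≤ 2 (*-mono-≤ (<⇒≤ lt) (*-mono-≤ (<⇒≤ lt) (<⇒≤ lt)))) ⟩
      2 * (2 * (Q * suc h * (Q * suc h * (Q * suc h)))) ≡⟨ lem Q (suc h) ⟩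
      4 * (Q * (Q * Q)) * (suc h * (suc h * suc h)) <⟨ proj₂ poly h (≤-trans (m≤n+m h₀ c) h≥) ⟩
      2 ^ h ∎) , ≤-trans (m≤m+n c h₀) h≥
  where
  open ≤-Reasoning
  poly = cubic<exponential (4 * (Q * (Q * Q)))
  h₀ = proj₁ poly
  lem : ∀ Q s → 2 * (2 * (Q * s * (Q * s * (Q * s)))) ≡ 4 * (Q * (Q * Q)) * (s * (s * s))
  lem = solve-∀
  at-least : ∀ a → Q * suc (c + h₀) ≤ a → ∀ h → a < Q * suc h → c + h₀ ≤ h
  at-least a le h lt = ≤-pred (<⇒≤ (*-cancelˡ-< Q (suc (c + h₀)) (suc h) (≤-<-trans le lt)))

-- The unit of error is h. The depth d gives |L| ≤ h, and 3^C·C·R ≤ 2^j bounds the leftover vertices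
-- by h, so |L′| ≤ 2h; as there are fewer than 2^h tests, p = 3h suffices. Of w·h reserved vertices
-- at most (Δ + 2)h touch L, and one of 4(Δ+1)² kinds is kept, which leaves the 3Xh centres
-- required. The 2 in w + 2 pays for the overshoot C and the rounding 2^j, each at most h.
spanning : ∀ {n′ Δ} (E : Bool → Fin (suc n′) → Fin (suc n′) → Bool) (E-sym : ∀ s a b → E s a b ≡ E (not s) b a)
  (g e : ℕ) (deg : ∀ s a → suc n′ + 2 * g ≤ 2 * count (E s a)) (n≤eg : suc n′ ≤ e * g)
  (T : RTree n′ (suc Δ)) (X w R′ h d j θ′ y : ℕ) →
  let R = suc R′ ; C = suc (code≤ Δ d) in
  suc X ≡ e ^ suc (suc Δ + 1) + e ^ suc (suc Δ + 1) → w ≡ 4 * (suc Δ * suc Δ) * (X * 3) + (suc Δ + 1) →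
  (w + 2) * h ≤ g → suc n′ ≤ R * h → R * suc Δ ≤ suc d → 3 ^ C * C * R ≤ 2 ^ j →
  1 ≤ h → C ≤ h → 2 ^ j * 2 ^ j ≤ h → testCount (suc n′) < 2 ^ h →
  4 ^ j * (8 * suc θ′ * y) ≤ g → suc n′ ≤ 8 * suc θ′ * suc θ′ * y → 2 * suc n′ + 2 * suc n′ < 2 ^ y →
  ∃ λ (f : Permutation′ (suc n′)) → ∀ i → E (RTree.dir T i) (f ⟨$⟩ʳ RTree.par T i) (f ⟨$⟩ʳ suc i) ≡ true
spanning {n′} {Δ} E E-sym g e deg n≤eg T X w R′ h d j θ′ y X≡ w≡ wh≤g n≤Rh R≤d KCR≤ h≥1 C≤h 4^j≤h N< δ≤g n≤δ 4n< =
  withSeparator (Separator.separator T d)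
  where
  R = suc R′
  C = suc (code≤ Δ d)
  K = 3 ^ C
  ν = suc n′
  J = 2 ^ j

  J≥1 : 1 ≤ J
  J≥1 = m^n>0 2 j

  J≤h : J ≤ h
  J≤h = ≤-trans (≤-trans (≤-reflexive (sym (*-identityʳ J))) (*-monoʳ-≤ J J≥1)) 4^j≤h

  2g≤n : 2 * g ≤ ν
  2g≤n = +-cancelˡ-≤ ν (2 * g) ν (≤-trans (deg true zero) (≤-trans (*-monoʳ-≤ 2 (count≤n (E true zero))) (≤-reflexive (cong (ν +_) (+-identityʳ ν)))))

  g≤n : g ≤ ν
  g≤n = ≤-trans (m≤m+n g (g + 0)) 2g≤n

  whh≤g : w * h + h + h ≤ g
  whh≤g = ≤-trans (≤-reflexive (lem w h)) wh≤g
    where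
    lem : ∀ w h → w * h + h + h ≡ (w + 2) * h
    lem = solve-∀

  Goal : Set
  Goal = ∃ λ (f : Permutation′ ν) → ∀ i → E (RTree.dir T i) (f ⟨$⟩ʳ RTree.par T i) (f ⟨$⟩ʳ suc i) ≡ true

  withSeparator : (∃ λ r → ∃ λ (c : ℕ → Fin (suc Δ)) → (r ≤ d) × (suc d * count (λ x → avoids c (Separator.path T d r x)) ≤ ν * suc Δ)) → Goal
  withSeparator (r , c , r≤d , sep) = withThreshold (Centres.threshold T d r r≤d c (w * h) θ≤)
    where
    open Components T d r r≤d c using (L; L-def)

    L≤h : count L ≤ h
    L≤h = *-cancelˡ-≤ (suc d) (begin
      suc d * count L ≡⟨ cong (suc d *_) (sum-cong-≗ λ x → cong 𝟙 (L-def x)) ⟩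
      suc d * count (λ x → avoids c (Separator.path T d r x)) ≤⟨ sep ⟩
      ν * suc Δ ≤⟨ *-monoˡ-≤ (suc Δ) n≤Rh ⟩
      R * h * suc Δ ≡⟨ lem R h (suc Δ) ⟩
      R * suc Δ * h ≤⟨ *-monoˡ-≤ h R≤d ⟩
      suc d * h ∎)
      where
      open ≤-Reasoning
      lem : ∀ a b c → a * b * c ≡ a * c * b
      lem = solve-∀

    θ≤ : w * h ≤ count (not ∘ L)
    θ≤ = +-cancelˡ-≤ (count L) _ _ (begin
      count L + w * h ≤⟨ +-monoˡ-≤ (w * h) L≤h ⟩
      h + w * h ≡⟨ +-comm h (w * h) ⟩
      w * h + h ≤⟨ ≤-trans (m≤m+n (w * h + h) h) (≤-trans whh≤g g≤n) ⟩
      ν ≡⟨ sym (count-not L) ⟩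
      count L + count (not ∘ L) ∎)
      where open ≤-Reasoning

    withThreshold : (∃ λ b → (w * h ≤ count (Centres.below T d r r≤d c b)) × (count (Centres.below T d r r≤d c b) ≤ w * h + C)) → Goal
    withThreshold (b , lo , hi) = withKind (Centres.commonKind T d r r≤d c b)
      where
      module Ce = Centres T d r r≤d c
      a = count (Ce.below b)

      a+J≤g : a + J ≤ g
      a+J≤g = ≤-trans (+-mono-≤ hi J≤h) (≤-trans (+-monoˡ-≤ h (+-monoʳ-≤ (w * h) C≤h)) whh≤g)

      a≤g : a ≤ g
      a≤g = ≤-trans (m≤m+n a J) a+J≤g

      free = ν ∸ a

      a+free : a + free ≡ ν
      a+free = m+[n∸m]≡n (≤-trans a≤g g≤n)

      h≤free : h ≤ free
      h≤free = ≤-trans (≤-trans (m≤n+m h (w * h + h)) whh≤g) (+-cancelˡ-≤ a g free (≤-trans (+-monoˡ-≤ g a≤g)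
        (≤-trans (≤-reflexive (cong (g +_) (sym (+-identityʳ g)))) (≤-trans 2g≤n (≤-reflexive (sym a+free))))))

      withKind : (∃ λ κ → count (λ t → Ce.below b t ∧ Ce.isolated b t) ≤ 4 * (suc Δ * suc Δ) * count (λ t → (Ce.below b t ∧ Ce.isolated b t) ∧ (Ce.kind t == κ))) → Goal
      withKind (κ , many) = withParts (floor free J J≥1)
        where
        centres = count (Ce.Cen b κ)
        X3h≤centres : X * (3 * h) ≤ centres
        X3h≤centres = *-cancelˡ-≤ (4 * (suc Δ * suc Δ)) (+-cancelʳ-≤ (h * (suc Δ + 1)) _ _ (begin
          4 * (suc Δ * suc Δ) * (X * (3 * h)) + h * (suc Δ + 1) ≡⟨ lem (4 * (suc Δ * suc Δ)) X h (suc Δ + 1) ⟩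
          (4 * (suc Δ * suc Δ) * (X * 3) + (suc Δ + 1)) * h ≡⟨ cong (_* h) (sym w≡) ⟩
          w * h ≤⟨ lo ⟩
          a ≤⟨ Ce.A≤ b ⟩
          count (λ t → Ce.below b t ∧ Ce.isolated b t) + count L * (suc Δ + 1) ≤⟨ +-mono-≤ many (*-monoˡ-≤ (suc Δ + 1) L≤h) ⟩
          4 * (suc Δ * suc Δ) * centres + h * (suc Δ + 1) ∎))
          where
          open ≤-Reasoning
          lem : ∀ k x h s → k * (x * (3 * h)) + h * s ≡ (k * (x * 3) + s) * h
          lem = solve-∀

        withParts : (∃ λ u → (J * u ≤ free) × (free < J * suc u)) → Goal
        withParts (zero , _ , lt) = ⊥-elim (<⇒≱ lt (≤-trans (≤-reflexive (*-identityʳ J)) (≤-trans J≤h h≤free)))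
        withParts (suc u′ , Ju≤ , lt) = embed E E-sym g e deg n≤eg T (Gr.decomposition κ)
            (≤-trans h≥1 (≤-trans (m≤n+m h (w * h + h)) whh≤g)) a≤g X (3 * h) X≡ X3h≤centres enough
            θ′ y j (≤-trans d≤n n≤δ) 4n< slack-ok (≤-trans (+-monoʳ-≤ a dbl≤) (≤-reflexive a+free)) room
          where
          module Gr = Grouping T d r r≤d c b u′
          u = suc u′
          dbl≤ : dbl j u ≤ free
          dbl≤ = ≤-trans (≤-reflexive (dbl≡ j u)) Ju≤
          d≤n : dbl j u ≤ ν
          d≤n = ≤-trans dbl≤ (m∸n≤m ν a)
          -- Rounding leaves fewer than J vertices outside A and the parts; with J ≤ u these are
          -- fewer than one class.
          J≤u : J ≤ u
          J≤u = ≤-pred (*-cancelˡ-< J J (suc u) (≤-<-trans (≤-trans 4^j≤h h≤free) lt))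
          free< : free < J * u + J
          free< = <-≤-trans lt (≤-reflexive (trans (*-suc J u) (+-comm J (J * u))))
          room : ν < a + J * u + u
          room = begin-strict
            ν ≡⟨ sym a+free ⟩
            a + free <⟨ +-monoʳ-< a (<-≤-trans free< (+-monoʳ-≤ (J * u) J≤u)) ⟩
            a + (J * u + u) ≡⟨ sym (+-assoc a (J * u) u) ⟩
            a + J * u + u ∎
            where open ≤-Reasoning
          slack-ok : ν + slack (8 * suc θ′ * y) j ≤ 2 * g + dbl j u
          slack-ok = begin
            ν + slack (8 * suc θ′ * y) j ≤⟨ +-mono-≤ (≤-trans (≤-reflexive (sym a+free)) (+-monoʳ-≤ a (<⇒≤ free<))) (≤-trans (slack≤ (8 * suc θ′ * y) j) δ≤g) ⟩
            a + (J * u + J) + g ≡⟨ lem a (J * u) J g ⟩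
            a + J + g + J * u ≤⟨ +-monoˡ-≤ (J * u) (+-monoˡ-≤ g a+J≤g) ⟩
            g + g + J * u ≡⟨ cong₂ _+_ (cong (g +_) (sym (+-identityʳ g))) (sym (dbl≡ j u)) ⟩
            2 * g + dbl j u ∎
            where
            open ≤-Reasoning
            lem : ∀ a b c g → a + (b + c) + g ≡ a + c + g + b
            lem = solve-∀
          leftover≤h : K * (u * C) ≤ h
          leftover≤h = *-cancelˡ-≤ R (begin
            R * (K * (u * C)) ≡⟨ lem R K u C ⟩
            K * C * R * u ≤⟨ *-monoˡ-≤ u KCR≤ ⟩
            J * u ≤⟨ ≤-trans Ju≤ (m∸n≤m ν a) ⟩
            ν ≤⟨ n≤Rh ⟩
            R * h ∎)
            where
            open ≤-Reasoning
            lem : ∀ r k u c → r * (k * (u * c)) ≡ k * c * r * u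
            lem = solve-∀
          L′≤2h : count Gr.L′ ≤ h + h
          L′≤2h = ≤-trans Gr.L′≤ (+-mono-≤ L≤h leftover≤h)
          enough : 2 ^ count Gr.L′ * testCount ν < 2 ^ (3 * h)
          enough = begin-strict
            2 ^ count Gr.L′ * testCount ν ≤⟨ *-monoˡ-≤ (testCount ν) (^-monoʳ-≤ 2 L′≤2h) ⟩
            2 ^ (h + h) * testCount ν <⟨ *-monoʳ-< (2 ^ (h + h)) ⦃ m^n≢0 2 (h + h) ⦄ N< ⟩
            2 ^ (h + h) * 2 ^ h ≡⟨ sym (^-distribˡ-+-* 2 (h + h) h) ⟩
            2 ^ (h + h + h) ≡⟨ cong (2 ^_) (lem h) ⟩
            2 ^ (3 * h) ∎
            where
            open ≤-Reasoning
            lem : ∀ h → h + h + h ≡ 3 * h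
            lem = solve-∀

-- The numerator of α is at least 1, so α ≥ 1/q for its denominator q, and only q is kept.
clearDenominators : ∀ a d .(c : Coprime (suc a) (suc d)) n k → (ℚ.½ ℚ.+ ℚ.mkℚ (ℤ.+ suc a) d c) ℚ.* ℕtoℚ n ℚ.≤ ℕtoℚ k → (suc d + 2) * n ≤ 2 * suc d * k
clearDenominators a d c n k h = ≤-trans (*-monoˡ-≤ n (+-monoʳ-≤ (suc d) (m≤n*m 2 (suc a))))
    (≤-trans (≤-reflexive (lem₁ (suc d) (suc a) n)) (≤-trans (ℤ.drop‿+≤+ (subst₂ ℤ._≤_ left right (ℚᵘ.drop-*≤* unnormalised))) (≤-reflexive (lem₂ k (suc d)))))
  where
  α : ℚᵘ.ℚᵘ
  α = mkℚᵘ (ℤ.+ suc a) d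
  unnormalised : (ℚᵘ.½ ℚᵘ.+ α) ℚᵘ.* mkℚᵘ (ℤ.+ n) 0 ℚᵘ.≤ mkℚᵘ (ℤ.+ k) 0
  unnormalised = ℚᵘ.≤-respˡ-≃ (ℚᵘ.≃-trans (ℚ.toℚᵘ-homo-* (ℚ.½ ℚ.+ ℚ.mkℚ (ℤ.+ suc a) d c) (ℕtoℚ n))
      (ℚᵘ.*-cong (ℚ.toℚᵘ-homo-+ ℚ.½ (ℚ.mkℚ (ℤ.+ suc a) d c)) (ℚ.toℚᵘ-fromℚᵘ (mkℚᵘ (ℤ.+ n) 0))))
    (ℚᵘ.≤-respʳ-≃ (ℚ.toℚᵘ-fromℚᵘ (mkℚᵘ (ℤ.+ k) 0)) (ℚ.toℚᵘ-mono-≤ h))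
  left : ℚᵘ.↥ ((ℚᵘ.½ ℚᵘ.+ α) ℚᵘ.* mkℚᵘ (ℤ.+ n) 0) ℤ.* ℤ.+ 1 ≡ ℤ.+ ((1 * suc d + suc a * 2) * n * 1)
  left = trans (cong (λ z → z ℤ.* ℤ.+ n ℤ.* ℤ.+ 1) (trans (cong₂ ℤ._+_ (sym (ℤ.pos-* 1 (suc d))) (sym (ℤ.pos-* (suc a) 2))) (sym (ℤ.pos-+ (1 * suc d) (suc a * 2)))))
    (trans (cong (ℤ._* ℤ.+ 1) (sym (ℤ.pos-* (1 * suc d + suc a * 2) n))) (sym (ℤ.pos-* ((1 * suc d + suc a * 2) * n) 1)))
  right : ℤ.+ k ℤ.* ℚᵘ.↧ ((ℚᵘ.½ ℚᵘ.+ α) ℚᵘ.* mkℚᵘ (ℤ.+ n) 0) ≡ ℤ.+ (k * (2 * suc d * 1))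
  right = sym (ℤ.pos-* k (2 * suc d * 1))
  lem₁ : ∀ d a n → (d + a * 2) * n ≡ (1 * d + a * 2) * n * 1
  lem₁ = solve-∀
  lem₂ : ∀ k d → k * (2 * d * 1) ≡ 2 * d * k
  lem₂ = solve-∀

does-≟ : ∀ b → does (b Data.Bool.≟ true) ≡ b
does-≟ true = refl
does-≟ false = refl

-- From minimum semidegree (1/2 + 1/q)n to the integral slack g = ⌊n/q⌋.
integralDegree : ∀ q n k g → 1 ≤ q → (q + 2) * n ≤ 2 * q * k → q * g ≤ n → n + 2 * g ≤ 2 * k
integralDegree q n k g q≥1 h le = *-cancelˡ-≤ q ⦃ >-nonZero q≥1 ⦄ (begin
  q * (n + 2 * g) ≡⟨ lem q n g ⟩
  q * n + 2 * (q * g) ≤⟨ +-monoʳ-≤ (q * n) (*-monoʳ-≤ 2 le) ⟩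
  q * n + 2 * n ≡⟨ sym (*-distribʳ-+ n q 2) ⟩
  (q + 2) * n ≤⟨ h ⟩
  2 * q * k ≡⟨ lem′ q k ⟩
  q * (2 * k) ∎)
  where
  open ≤-Reasoning
  lem : ∀ q n g → q * (n + 2 * g) ≡ q * n + 2 * (q * g)
  lem = solve-∀
  lem′ : ∀ q k → 2 * q * k ≡ q * (2 * k)
  lem′ = solve-∀

double-floor : ∀ Q h a → 1 ≤ h → a < Q * suc h → a ≤ 2 * Q * h
double-floor Q h a h≥1 lt = ≤-trans (<⇒≤ lt) (≤-trans (*-monoʳ-≤ Q (+-monoˡ-≤ h h≥1)) (≤-reflexive (lem Q h)))
  where
  lem : ∀ Q h → Q * (h + h) ≡ 2 * Q * h
  lem = solve-∀

-- The constants, in the order in which they are chosen: the degree slack is at least n/e, the unit h of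
-- the error terms is g/W, the depth of the blocks is d, and the classes fill 2^j parts.
module Constants (Δ q : ℕ) where
  e X w W R′ R d C j θ′ Z : ℕ
  -- The factor 2, here and in `R′`, absorbs the rounding down of a quotient.
  e = 2 * q
  X = Data.Nat.pred (e ^ suc (suc Δ + 1) + e ^ suc (suc Δ + 1))
  w = 4 * (suc Δ * suc Δ) * (X * 3) + (suc Δ + 1)
  W = w + 2
  R′ = e * (2 * W)
  R = suc R′
  d = R * suc Δ
  C = suc (code≤ Δ d)
  -- Only 2^j ≥ 3^C·C·R is wanted, and m < 2^m gives it at once.
  j = 3 ^ C * C * R
  -- With y = ⌊g/Z⌋ one gets n ≤ e·g ≤ 2e·Z·y = 8θ·(2e·4^j)·y, which has to be at most 8θ²y.
  θ′ = 2 * e * 4 ^ j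
  Z = 4 ^ j * (8 * suc θ′)

  opaque
    forH : ∃ λ n₀ → ∀ n → n₀ ≤ n → ∀ h → n < q * W * suc h → (testCount n < 2 ^ h) × (1 + C + 2 ^ j * 2 ^ j ≤ h)
    forH = large (q * W) (1 + C + 2 ^ j * 2 ^ j)

    forY : ∃ λ n₀ → ∀ n → n₀ ≤ n → ∀ y → n < q * Z * suc y → (testCount n < 2 ^ y) × (1 ≤ y)
    forY = large (q * Z) 1

  module Main (q≥1 : 1 ≤ q) {n′ : ℕ} (n≥₁ : proj₁ forH ≤ suc n′) (n≥₂ : proj₁ forY ≤ suc n′)
    (E : Bool → Fin (suc n′) → Fin (suc n′) → Bool) (E-sym : ∀ s a b → E s a b ≡ E (not s) b a)
    (deg : ∀ s a → (q + 2) * suc n′ ≤ 2 * q * count (E s a)) (T : RTree n′ (suc Δ)) where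

    ν : ℕ
    ν = suc n′

    nest : ∀ P g h → ν < q * suc g → g < P * suc h → ν < q * P * suc h
    nest P g h lt lt′ = <-≤-trans lt (≤-trans (*-monoʳ-≤ q lt′) (≤-reflexive (sym (*-assoc q P (suc h)))))

    result : ∃ λ (f : Permutation′ ν) → ∀ i → E (RTree.dir T i) (f ⟨$⟩ʳ RTree.par T i) (f ⟨$⟩ʳ suc i) ≡ true
    result = withG (floor ν q q≥1)
      where
      W≥1 : 1 ≤ W
      W≥1 = ≤-trans (s≤s z≤n) (m≤n+m 2 w)
      Z≥1 : 1 ≤ Z
      Z≥1 = *-mono-≤ (m^n>0 4 j) (s≤s (z≤n {n = θ′ + 7 * suc θ′}))
      e≥1 : 1 ≤ e
      e≥1 = *-mono-≤ (s≤s (z≤n {1})) q≥1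
      withG : (∃ λ g → (q * g ≤ ν) × (ν < q * suc g)) → _
      withG (g , qg≤ , ν<) = withHY (floor g W W≥1) (floor g Z Z≥1)
        where
        withHY : (∃ λ h → (W * h ≤ g) × (g < W * suc h)) → (∃ λ y → (Z * y ≤ g) × (g < Z * suc y)) → _
        withHY (h , Wh≤ , g<) (y , Zy≤ , g<′) = spanning E E-sym g e
            (λ s a → integralDegree q ν (count (E s a)) g q≥1 (deg s a) qg≤) n≤eg T X w R′ h d j θ′ y
            (suc-pred (e ^ suc (suc Δ + 1) + e ^ suc (suc Δ + 1)) ⦃ >-nonZero (≤-trans (m^n>0 e ⦃ >-nonZero e≥1 ⦄ (suc (suc Δ + 1))) (m≤m+n _ _)) ⦄)
            refl Wh≤ n≤Rh (n≤1+n d) (<⇒≤ (m<2^m j)) h≥1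
            (≤-trans (≤-trans (n≤1+n C) (m≤m+n (1 + C) _)) c≤h) (≤-trans (m≤n+m _ (1 + C)) c≤h) N<
            (≤-trans (≤-reflexive (lem₁ (4 ^ j) θ′ y)) Zy≤) n≤δ
            (≤-<-trans four (proj₁ big₂))
          where
          big₁ = proj₂ forH ν n≥₁ h (nest W g h ν< g<)
          big₂ = proj₂ forY ν n≥₂ y (nest Z g y ν< g<′)
          N< = proj₁ big₁
          c≤h = proj₂ big₁
          h≥1 : 1 ≤ h
          h≥1 = ≤-trans (≤-trans (m≤m+n 1 C) (m≤m+n (1 + C) _)) c≤h
          g≥1 : 1 ≤ g
          g≥1 = ≤-trans (*-mono-≤ W≥1 h≥1) Wh≤
          n≤eg : ν ≤ e * g
          n≤eg = double-floor q g ν g≥1 ν<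
          n≤Rh : ν ≤ R * h
          n≤Rh = ≤-trans n≤eg (≤-trans (*-monoʳ-≤ e (double-floor W h g h≥1 g<)) (≤-trans (≤-reflexive (sym (*-assoc e (2 * W) h))) (*-monoˡ-≤ h (n≤1+n R′))))
          lem₁ : ∀ a t y → a * (8 * suc t * y) ≡ a * (8 * suc t) * y
          lem₁ = solve-∀
          n≤δ : ν ≤ 8 * suc θ′ * suc θ′ * y
          n≤δ = ≤-trans n≤eg (≤-trans (*-monoʳ-≤ e (double-floor Z y g (proj₂ big₂) g<′))
            (≤-trans (≤-reflexive (lem e (4 ^ j) (8 * suc θ′) y)) (*-monoˡ-≤ y (*-monoʳ-≤ (8 * suc θ′) (n≤1+n θ′)))))
            where
            lem : ∀ e p t y → e * (2 * (p * t) * y) ≡ t * (2 * e * p) * y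
            lem = solve-∀
          four : 2 * ν + 2 * ν ≤ testCount ν
          four = ≤-trans (≤-reflexive (lem ν)) (*-monoʳ-≤ 2 (*-monoʳ-≤ 2 (m≤m*n ν (ν * ν))))
            where
            lem : ∀ a → 2 * a + 2 * a ≡ 2 * (2 * a)
            lem = solve-∀

spanningTree : ∀ Δ q → 1 ≤ q → ∀ m′ → proj₁ (Constants.forH Δ q) + proj₁ (Constants.forY Δ q) ≤ m′ →
  (G : Digraph (suc (suc m′))) →
  (∀ x → (q + 2) * suc (suc m′) ≤ 2 * q * outdeg G x) → (∀ x → (q + 2) * suc (suc m′) ≤ 2 * q * indeg G x) →
  (T : OrientedTree (suc (suc m′))) → MaxDegAtMost T (suc Δ) → Contains G T
spanningTree Δ q q≥1 m′ le G out inn = containsOrdered G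
    (Constants.Main.result Δ q q≥1 (large-enough (≤-trans (m≤m+n _ _) le)) (large-enough (≤-trans (m≤n+m _ (proj₁ (Constants.forH Δ q))) le))
      (directed G) symmetric degrees)
  where
  large-enough : ∀ {a} → a ≤ m′ → a ≤ suc (suc m′)
  large-enough = m≤n⇒m≤1+n ∘ m≤n⇒m≤1+n
  degrees : ∀ s x → (q + 2) * suc (suc m′) ≤ 2 * q * count (directed G s x)
  degrees true x = subst (λ k → (q + 2) * suc (suc m′) ≤ 2 * q * k)
    (trans (length-filter-allFin (λ y → adj G x y Data.Bool.≟ true)) (sum-cong-≗ λ y → cong 𝟙 (does-≟ (adj G x y)))) (out x)
  degrees false x = subst (λ k → (q + 2) * suc (suc m′) ≤ 2 * q * k)
    (trans (length-filter-allFin (λ y → adj G y x Data.Bool.≟ true)) (sum-cong-≗ λ y → cong 𝟙 (does-≟ (adj G y x)))) (inn x)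
  symmetric : ∀ s x y → directed G s x y ≡ directed G (not s) y x
  symmetric true x y = refl
  symmetric false x y = refl

theorem1p2 : (Δ : ℕ) (α : ℚ.ℚ) → ℚ.0ℚ ℚ.< α →
    Σ ℕ λ n₀ → (n : ℕ) → n ≥ n₀ → (G : Digraph n) →
    MinSemidegreeAtLeast G ((ℚ.½ ℚ.+ α) ℚ.* ℕtoℚ n) →
    (T : OrientedTree n) → MaxDegAtMost T Δ → Contains G T
theorem1p2 Δ (ℚ.mkℚ (ℤ.+ suc a) d c) _ = 2 + (proj₁ (Constants.forH Δ (suc d)) + proj₁ (Constants.forY Δ (suc d))) , embeds
  where
  embeds : (n : ℕ) → n ≥ 2 + (proj₁ (Constants.forH Δ (suc d)) + proj₁ (Constants.forY Δ (suc d))) → (G : Digraph n) →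
    MinSemidegreeAtLeast G ((ℚ.½ ℚ.+ ℚ.mkℚ (ℤ.+ suc a) d c) ℚ.* ℕtoℚ n) → (T : OrientedTree n) → MaxDegAtMost T Δ → Contains G T
  embeds (suc (suc m′)) (s≤s (s≤s le)) G semi T deg = spanningTree Δ (suc d) (s≤s z≤n) m′ le G
    (λ x → clearDenominators a d c _ _ (proj₁ (semi x))) (λ x → clearDenominators a d c _ _ (proj₂ (semi x)))
    -- The degree bound is weakened to Δ + 1, so that the alphabet of ranks is nonempty even for Δ =
    -- 0.
    T (λ v → m≤n⇒m≤1+n (deg v))
theorem1p2 Δ (ℚ.mkℚ (ℤ.+ zero) d c) (ℚ.*<* (ℤ.+<+ ()))
theorem1p2 Δ (ℚ.mkℚ ℤ.-[1+ a ] d c) (ℚ.*<* ())
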